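{- Let $\mathcal P$ be a finite chiral or directly regular $4$-polytope of type $\{p, q, r\}$, with facets $\mathcal K$ and vertex-figures $\mathcal L$. If $q$ is prime and if $q^2$ does not divide $|\Gamma^+(\mathcal K) \diamond \Gamma^+(\mathcal L^{\delta})|$, then $\mathcal P \diamond \mathcal P^{\delta}$ is polytopal.
   Context: An abstract polytope of rank $n$ (an $n$-polytope) is a ranked poset of faces with ranks from $-1$ to $n$, with a unique least face $F_{ -1}$ (rank $-1$) and a unique greatest face $F_n$ (rank $n$), in which every flag (maximal chain) has $n+2$ faces, which satisfies the diamond condition (whenever $F<G$ with ranks $j-1$ and $j+1$ there are exactly two $j$-faces strictly between them), and which is strongly flag-connected (any two flags $\Phi,\Psi$ are joined by a sequence of flags, consecutive ones adjacent, all containing $\Phi\cap\Psi$; two flags are adjacent if they differ in exactly one face). $\Phi^j$ denotes the unique flag differing from $\Phi$ only in its $j$-face, and $\Phi^{i,j}=(\Phi^i)^j$. Each polytope considered has a fixed base flag $\Phi$. $\mathcal P$ is regular if its automorphism group $\Gamma(\mathcal P)$ is transitive on flags; then $\Gamma(\mathcal P)$ is generated by $\rho_0,\dots,\rho_{n-1}$, where $\rho_i$ maps $\Phi$ to $\Phi^i$. Put $\sigma_i=\rho_{i-1}\rho_i$ and $\Gamma^+(\mathcal P)=\langle\sigma_1,\dots,\sigma_{n-1}\rangle$; $\mathcal P$ is directly regular if it is regular and $\Gamma^+(\mathcal P)$ has index $2$ in $\Gamma(\mathcal P)$. $\mathcal P$ is chiral if $\Gamma(\mathcal P)$ has exactly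 two orbits on flags and adjacent flags lie in distinct orbits; then $\Gamma^+(\mathcal P):=\Gamma(\mathcal P)$ is generated by $\sigma_1,\dots,\sigma_{n-1}$, where $\sigma_i$ maps $\Phi$ to $\Phi^{i,i-1}$. In both cases $(\sigma_i\cdots\sigma_j)^2=1$ for $i<j$, and the type of $\mathcal P$ is $\{p_1,\dots,p_{n-1}\}$ where $p_i$ is the order of $\sigma_i$. Facets and vertex-figures: for a chiral or directly regular $4$-polytope $\mathcal P$ with $\Gamma^+(\mathcal P)=\langle\sigma_1,\sigma_2,\sigma_3\rangle$ and base flag $\{F_{ -1},F_0,\dots,F_4\}$, the facet $\mathcal K$ is the section $F_3/F_{ -1}$ and the vertex-figure $\mathcal L$ is the section $F_4/F_0$ (a section $G/F$ is $\{H: F\le H\le G\}$); both are chiral or directly regular polyhedra, with $\Gamma^+(\mathcal K)=\langle\sigma_1,\sigma_2\rangle$ and $\Gamma^+(\mathcal L)=\langle\sigma_2,\sigma_3\rangle$ (with these specified generators). Dual: for an $n$-polytope $\mathcal P$, $\mathcal P^\delta$ is $\mathcal P$ with reversed order; $\Gamma^+(\mathcal P^\delta)$ is the same group with specified generators $\sigma_i'=\sigma_{n-i}^{ -1}$. (So $\Gamma^+(\mathcal L^\delta)$ has specified generators $\sigma_3^{ -1},\sigma_2^{ -1}$, in this order.) Intersection property: for a group $G$ with specified generators $\sigma_1,\dots,\sigma_{n-1}$, put $\tau_{i,j}=\sigma_i\cdots\sigma_j$ ($1\le i\le j\le n-1$) and, for $I\subseteq\{0,\dots,n-1\}$, $G_I=\langle\tau_{i,j}\mid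 i\le j,\ i-1,j\in I\rangle$. $G$ has the intersection property if $G_I\cap G_J=G_{I\cap J}$ for all $I,J$. Rotation groups of chiral or directly regular polytopes have this property. Mix: for groups with specified generators $\Gamma=\langle x_1,\dots,x_k\rangle$, $\Gamma'=\langle x_1',\dots,x_k'\rangle$, $\Gamma\diamond\Gamma'$ is the subgroup of $\Gamma\times\Gamma'$ generated by $(x_i,x_i')$, $i=1,\dots,k$. $\mathcal P\diamond\mathcal Q$ is the flag-connected pre-polytope (polytope axioms with strong flag-connectedness weakened to flag-connectedness) built from $\Gamma^+(\mathcal P)\diamond\Gamma^+(\mathcal Q)$ with generators $\beta_i=(\sigma_i,\sigma_i')$; it is polytopal (i.e. a polytope) if and only if this group with generators $\beta_i$ has the intersection property. -}

module Defs where

open import Algebra.Bundles using (Group)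
open import Algebra.Construct.DirectProduct using () renaming (group to _×ᴳ_)
open import Algebra.Definitions.RawMonoid using () renaming (_×_ to power)
open import Data.Empty using (⊥-elim)
open import Data.Fin as Fin using (Fin; zero; suc; toℕ; inject₁; opposite)
open import Data.Fin.Patterns using (0F; 1F; 2F; 4F; 5F)
open import Data.Fin.Properties as Fin using (toℕ<n; toℕ-injective)
open import Data.List using (List; []; _∷_; length; map; foldr; filter; allFin; applyUpTo)
open import Data.List.Membership.Propositional using () renaming (_∈_ to _∈ᴾ_)
open import Data.List.Membership.Propositional.Properties using (∈-map⁻; ∈-applyUpTo⁺)
open import Data.List.Properties using (length-map; ∷-injectiveˡ; ∷-injectiveʳ)
open import Data.List.Relation.Unary.All as All using (All; []; _∷_)
open import Data.List.Relation.Unary.AllPairs as AllPairs using (AllPairs; []; _∷_)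
open import Data.List.Relation.Unary.AllPairs.Properties as AllPairs using ()
open import Data.List.Relation.Unary.Any as Any using (Any; here; there)
open import Data.Nat as ℕ using (ℕ; zero; suc; _+_)
open import Data.Nat.Properties as ℕ using ()
open import Data.Product using (Σ; ∃; _×_; _,_; proj₁; proj₂)
open import Data.Sum using (_⊎_; inj₁; inj₂)
open import Data.Vec using (Vec; lookup)
open import Function using (_∘_; _on_; _⇔_; Equivalence)
open import Function.Definitions using (Bijective)
open import Level using (Level; _⊔_) renaming (suc to lsuc)
open import Relation.Binary using (Rel; Poset; Decidable; IsPartialOrder)
open import Relation.Binary.Bundles.Raw using (RawRelation)
open import Relation.Binary.Construct.Closure.ReflexiveTransitive using (Star)
import Relation.Binary.Construct.On as On
open import Relation.Binary.PropositionalEquality using (_≡_; _≢_; refl; sym; trans; cong; subst)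
open import Relation.Nullary using (¬_)
open import Relation.Nullary.Decidable using (_×-dec_)
open import Relation.Unary using (Pred)

-- For an equivalence relation ∼ : there are exactly k equivalence classes.
HasCardinality : ∀ {a ℓ} {A : Set a} → Rel A ℓ → ℕ → Set (a ⊔ ℓ)
HasCardinality {A = A} _∼_ k = ∃ λ (f : Fin k → A) → Bijective _≡_ _∼_ f

module GroupNotions {c ℓ} (G : Group c ℓ) where
  open Group G renaming (refl to ≈-refl; sym to ≈-sym; trans to ≈-trans)

  data ⟨_⟩ {i} {I : Set i} (s : I → Carrier) : Pred Carrier (c ⊔ ℓ ⊔ i) where
    gen  : ∀ k → ⟨ s ⟩ (s k)
    unit : ⟨ s ⟩ ε
    mul  : ∀ {x y} → ⟨ s ⟩ x → ⟨ s ⟩ y → ⟨ s ⟩ (x ∙ y)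
    inv  : ∀ {x} → ⟨ s ⟩ x → ⟨ s ⟩ (x ⁻¹)
    resp : ∀ {x y} → x ≈ y → ⟨ s ⟩ x → ⟨ s ⟩ y

  -- x lies in the right coset H g.
  InCoset : ∀ {h} → Pred Carrier h → Carrier → Carrier → Set h
  InCoset H g x = H (x ∙ g ⁻¹)

  HasIndex : ∀ {h} → Pred Carrier h → ℕ → Set (c ⊔ h)
  HasIndex H k = HasCardinality (λ x y → InCoset H y x) k

  HasOrder : Carrier → ℕ → Set ℓ
  HasOrder x k = 0 ℕ.< k
               × power rawMonoid k x ≈ ε
               × (∀ m → 0 ℕ.< m → power rawMonoid m x ≈ ε → k ℕ.≤ m)

-- The group meant is the subgroup of `ambient` generated by the `generator i`.
-- The index i : Fin k stands for the generator with number i + 1.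
record GeneratedGroup (k : ℕ) c ℓ : Set (lsuc (c ⊔ ℓ)) where
  field
    ambient : Group c ℓ
  open Group ambient public
  open GroupNotions ambient public
  field
    generator : Fin k → Carrier

  Element : Set (c ⊔ ℓ)
  Element = ∃ ⟨ generator ⟩

  _≈ᴱ_ : Rel Element ℓ
  _≈ᴱ_ = _≈_ on proj₁

  HasSize : ℕ → Set (c ⊔ ℓ)
  HasSize = HasCardinality _≈ᴱ_

  τ : Fin k → Fin k → Carrier
  τ i j = foldr _∙_ ε (map generator (filter (λ m → (i Fin.≤? m) ×-dec (m Fin.≤? j)) (allFin k)))

  -- In terms of indices shifted as above, the condition "i - 1, j ∈ I" on
  -- τ i j reads "inject₁ i, suc j ∈ I".
  Sub : ∀ {h} → Pred (Fin (suc k)) h → Pred Carrier (c ⊔ ℓ ⊔ h)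
  Sub I = ⟨ (λ ((i , j , _) : ∃ λ i → ∃ λ j → i Fin.≤ j × I (inject₁ i) × I (suc j)) → τ i j) ⟩

_⋄_ : ∀ {k c₁ ℓ₁ c₂ ℓ₂} → GeneratedGroup k c₁ ℓ₁ → GeneratedGroup k c₂ ℓ₂ →
      GeneratedGroup k (c₁ ⊔ c₂) (ℓ₁ ⊔ ℓ₂)
G ⋄ H = record
  { ambient   = G.ambient ×ᴳ H.ambient
  ; generator = λ i → G.generator i , H.generator i
  } where module G = GeneratedGroup G; module H = GeneratedGroup H

-- Γ⁺(P^δ) obtained from Γ⁺(P): generators σ'ᵢ = σₙ₋ᵢ⁻¹, where n = k + 1.
_ᵟ : ∀ {k c ℓ} → GeneratedGroup k c ℓ → GeneratedGroup k c ℓ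
G ᵟ = record
  { ambient   = ambient
  ; generator = λ i → generator (opposite i) ⁻¹
  } where open GeneratedGroup G

-- Faces of rank j (-1 ≤ j ≤ n) have `rank` equal to j + 1 in Fin (2 + n).
-- `proper` converts a proper rank 0 ≤ j ≤ n - 1 to this numbering.
proper : ∀ {n} → Fin n → Fin (2 + n)
proper j = suc (inject₁ j)

module Chains {c ℓ₁ ℓ₂} (R : RawRelation c ℓ₁ ℓ₂) where
  open RawRelation R renaming (_∼_ to _≤_) using (Carrier; _≈_)

  infix 4 _<_ _∈_ _≐_

  _<_ : Rel Carrier (ℓ₁ ⊔ ℓ₂)
  x < y = x ≤ y × ¬ (x ≈ y)

  _∈_ : Carrier → List Carrier → Set (c ⊔ ℓ₁)
  x ∈ xs = Any (x ≈_) xs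

  -- Ranks are bounded, so every chain is finite and can be listed in
  -- increasing order.
  record Flag : Set (c ⊔ ℓ₁ ⊔ ℓ₂) where
    field
      faces   : List Carrier
      chain   : AllPairs _<_ faces
      maximal : ∀ x → (∀ y → y ∈ faces → x ≤ y ⊎ y ≤ x) → x ∈ faces
  open Flag public

  _≐_ : Rel Flag (c ⊔ ℓ₁)
  Φ ≐ Ψ = ∀ x → (x ∈ faces Φ) ⇔ (x ∈ faces Ψ)

  module Adjacency {N} (rank : Carrier → Fin N) where

    _~[_]_ : Flag → Fin N → Flag → Set (c ⊔ ℓ₁)
    Φ ~[ j ] Ψ = (∀ x → rank x ≢ j → (x ∈ faces Φ) ⇔ (x ∈ faces Ψ)) × ¬ (Φ ≐ Ψ)

    Adjacent : Rel Flag (c ⊔ ℓ₁)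
    Adjacent Φ Ψ = ∃ λ j → Φ ~[ j ] Ψ

record IsPolytope (n : ℕ) {c ℓ₁ ℓ₂} (R : RawRelation c ℓ₁ ℓ₂) : Set (c ⊔ ℓ₁ ⊔ ℓ₂) where
  open RawRelation R renaming (_∼_ to _≤_) using (Carrier; _≈_)
  open Chains R public
  field
    isPartialOrder : IsPartialOrder _≈_ _≤_

    rank      : Carrier → Fin (2 + n)
    rank-cong : ∀ {x y} → x ≈ y → rank x ≡ rank y
    rank-mono : ∀ {x y} → x < y → rank x Fin.< rank y

    least         : Carrier
    least-min     : ∀ x → least ≤ x
    rank-least    : rank least ≡ zero
    greatest      : Carrier
    greatest-max  : ∀ x → x ≤ greatest
    rank-greatest : rank greatest ≡ Fin.fromℕ (suc n)

    flag-length : ∀ (Φ : Flag) → length (faces Φ) ≡ 2 + n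

    diamond : ∀ (j : Fin n) F G → F < G →
              toℕ (rank F) ≡ toℕ j → toℕ (rank G) ≡ 2 + toℕ j →
              ∃ λ H₁ → ∃ λ H₂ →
                (rank H₁ ≡ proper j × F < H₁ × H₁ < G) ×
                (rank H₂ ≡ proper j × F < H₂ × H₂ < G) ×
                ¬ (H₁ ≈ H₂) ×
                (∀ H → rank H ≡ proper j → F < H → H < G → H ≈ H₁ ⊎ H ≈ H₂)

  open Adjacency rank public

  field
    stronglyFlagConnected :
      ∀ (Φ Ψ : Flag) →
      let Step = λ Θ Θ′ → Adjacent Θ Θ′ × (∀ x → x ∈ faces Φ → x ∈ faces Ψ → x ∈ faces Θ′)
      in ∃ λ Ψ′ → Star Step Φ Ψ′ × Ψ′ ≐ Ψ

record Polytope (n : ℕ) c ℓ₁ ℓ₂ : Set (lsuc (c ⊔ ℓ₁ ⊔ ℓ₂)) where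
  field
    raw        : RawRelation c ℓ₁ ℓ₂
    isPolytope : IsPolytope n raw
  open RawRelation raw public renaming (_∼_ to _≤_) using (Carrier; _≈_)
  open IsPolytope isPolytope public

  poset : Poset c ℓ₁ ℓ₂
  poset = record { isPartialOrder = isPartialOrder }

  -- A constructively finite poset: finitely many faces, decidable order.
  IsFinite : Set (c ⊔ ℓ₁ ⊔ ℓ₂)
  IsFinite = (∃ λ N → HasCardinality _≈_ N) × Decidable _≤_

record Automorphism {c ℓ₁ ℓ₂} (P : Poset c ℓ₁ ℓ₂) : Set (c ⊔ ℓ₁ ⊔ ℓ₂) where
  open Poset P using (Carrier; _≈_; _≤_; antisym; reflexive; module Eq)
  field
    to        : Carrier → Carrier
    from      : Carrier → Carrier
    to-mono   : ∀ {x y} → x ≤ y → to x ≤ to y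
    from-mono : ∀ {x y} → x ≤ y → from x ≤ from y
    to-from   : ∀ x → to (from x) ≈ x
    from-to   : ∀ x → from (to x) ≈ x

  to-cong : ∀ {x y} → x ≈ y → to x ≈ to y
  to-cong e = antisym (to-mono (reflexive e)) (to-mono (reflexive (Eq.sym e)))

  from-cong : ∀ {x y} → x ≈ y → from x ≈ from y
  from-cong e = antisym (from-mono (reflexive e)) (from-mono (reflexive (Eq.sym e)))

  to-injective : ∀ {x y} → to x ≈ to y → x ≈ y
  to-injective e = Eq.trans (Eq.sym (from-to _)) (Eq.trans (from-cong e) (from-to _))

-- Automorphisms act on the right: f ∙ g is "first f, then g". This is the
-- convention under which ρᵢ₋₁ρᵢ maps Φ to Φ^{i,i-1}.
automorphismGroup : ∀ {c ℓ₁ ℓ₂} → Poset c ℓ₁ ℓ₂ → Group (c ⊔ ℓ₁ ⊔ ℓ₂) (c ⊔ ℓ₁)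
automorphismGroup P = record
  { Carrier = Automorphism P
  ; _≈_ = λ f g → ∀ x → to f x ≈ to g x
  ; _∙_ = λ f g → record
    { to        = to g ∘ to f
    ; from      = from f ∘ from g
    ; to-mono   = to-mono g ∘ to-mono f
    ; from-mono = from-mono f ∘ from-mono g
    ; to-from   = λ x → Eq.trans (to-cong g (to-from f _)) (to-from g x)
    ; from-to   = λ x → Eq.trans (from-cong f (from-to g _)) (from-to f x)
    }
  ; ε = record
    { to = λ x → x ; from = λ x → x ; to-mono = λ p → p ; from-mono = λ p → p
    ; to-from = λ _ → Eq.refl ; from-to = λ _ → Eq.refl
    }
  ; _⁻¹ = λ f → record
    { to = from f ; from = to f ; to-mono = from-mono f ; from-mono = to-mono f
    ; to-from = from-to f ; from-to = to-from f
    }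
  ; isGroup = record
    { isMonoid = record
      { isSemigroup = record
        { isMagma = record
          { isEquivalence = record
            { refl  = λ _ → Eq.refl
            ; sym   = λ p x → Eq.sym (p x)
            ; trans = λ p q x → Eq.trans (p x) (q x)
            }
          ; ∙-cong = λ {_} {_} {g} p q x → Eq.trans (to-cong g (p x)) (q _)
          }
        ; assoc = λ _ _ _ _ → Eq.refl
        }
      ; identity = (λ _ _ → Eq.refl) , (λ _ _ → Eq.refl)
      }
    ; inverse = to-from , from-to
    ; ⁻¹-cong = λ {f} {g} p x →
        Eq.trans (from-cong f (Eq.trans (Eq.sym (to-from g x)) (Eq.sym (p _)))) (from-to f _)
    }
  }
  where
  open Poset P
  open Automorphism

-- `section P F G` is the section G/F.
section : ∀ {c ℓ₁ ℓ₂} (P : Poset c ℓ₁ ℓ₂) (F G : Poset.Carrier P) → Poset (c ⊔ ℓ₂) ℓ₁ ℓ₂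
section P F G = On.poset P (proj₁ {B = λ H → F ≤ H × H ≤ G})
  where open Poset P

restrict : ∀ {c ℓ₁ ℓ₂} (P : Poset c ℓ₁ ℓ₂) {F G : Poset.Carrier P} (γ : Automorphism P) →
           Poset._≈_ P (Automorphism.to γ F) F → Poset._≈_ P (Automorphism.to γ G) G →
           Automorphism (section P F G)
restrict P {F} {G} γ fixF fixG = record
  { to        = λ (x , l , u) → to x , ≤-respˡ-≈ fixF (to-mono l) , ≤-respʳ-≈ fixG (to-mono u)
  ; from      = λ (x , l , u) → from x , ≤-respˡ-≈ (fix⁻¹ fixF) (from-mono l)
                                       , ≤-respʳ-≈ (fix⁻¹ fixG) (from-mono u)
  ; to-mono   = to-mono
  ; from-mono = from-mono
  ; to-from   = λ x → to-from (proj₁ x)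
  ; from-to   = λ x → from-to (proj₁ x)
  }
  where
  open Poset P
  open Automorphism γ
  fix⁻¹ : ∀ {x} → to x ≈ x → from x ≈ x
  fix⁻¹ e = Eq.trans (from-cong (Eq.sym e)) (from-to _)

module Symmetry {k c ℓ₁ ℓ₂} (P : Polytope (suc k) c ℓ₁ ℓ₂) where
  open Polytope P

  Γ : Group (c ⊔ ℓ₁ ⊔ ℓ₂) (c ⊔ ℓ₁)
  Γ = automorphismGroup poset

  open Group Γ using (_∙_)
  open GroupNotions Γ using (⟨_⟩; HasIndex)
  open Automorphism using (to)

  Maps : Automorphism poset → Flag → Flag → Set (c ⊔ ℓ₁)
  Maps γ Φ Ψ = ∀ x → (x ∈ faces Φ) ⇔ (to γ x ∈ faces Ψ)

  SameOrbit : Rel Flag (c ⊔ ℓ₁ ⊔ ℓ₂)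
  SameOrbit Φ Ψ = ∃ λ γ → Maps γ Φ Ψ

  IsRegular : Set (c ⊔ ℓ₁ ⊔ ℓ₂)
  IsRegular = ∀ Φ Ψ → SameOrbit Φ Ψ

  IsChiral : Set (c ⊔ ℓ₁ ⊔ ℓ₂)
  IsChiral = HasCardinality SameOrbit 2 × (∀ Φ Ψ → Adjacent Φ Ψ → ¬ SameOrbit Φ Ψ)

  -- Automorphisms are determined by the image of Φ, so the generators ρ, σ in
  -- the next two records are determined by P and Φ.
  record DirectlyRegular (Φ : Flag) : Set (c ⊔ ℓ₁ ⊔ ℓ₂) where
    field
      isRegular : IsRegular
      ρ         : Fin (suc k) → Automorphism poset
      ρ-maps    : ∀ j → ∃ λ Ψ → Φ ~[ proper j ] Ψ × Maps (ρ j) Φ Ψ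

    σ : Fin k → Automorphism poset
    σ i = ρ (inject₁ i) ∙ ρ (suc i)

    field
      index-2 : HasIndex ⟨ σ ⟩ 2

  record Chiral (Φ : Flag) : Set (c ⊔ ℓ₁ ⊔ ℓ₂) where
    field
      isChiral : IsChiral
      σ        : Fin k → Automorphism poset
      σ-maps   : ∀ i → ∃ λ Ψ → ∃ λ Ψ′ →
                 Φ ~[ proper (suc i) ] Ψ × Ψ ~[ proper (inject₁ i) ] Ψ′ × Maps (σ i) Φ Ψ′

  ChiralOrDirectlyRegular : Flag → Set (c ⊔ ℓ₁ ⊔ ℓ₂)
  ChiralOrDirectlyRegular Φ = Chiral Φ ⊎ DirectlyRegular Φ

  rotation : ∀ {Φ} → ChiralOrDirectlyRegular Φ → Fin k → Automorphism poset
  rotation (inj₁ ch) = Chiral.σ ch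
  rotation (inj₂ dr) = DirectlyRegular.σ dr

  Γ⁺ : ∀ {Φ} → ChiralOrDirectlyRegular Φ → GeneratedGroup k (c ⊔ ℓ₁ ⊔ ℓ₂) (c ⊔ ℓ₁)
  Γ⁺ S = record { ambient = Γ ; generator = rotation S }

  HasType : ∀ {Φ} → ChiralOrDirectlyRegular Φ → Vec ℕ k → Set (c ⊔ ℓ₁)
  HasType S p = ∀ i → GroupNotions.HasOrder Γ (rotation S i) (lookup p i)

increasing-full : ∀ a xs → AllPairs ℕ._<_ xs → All (a ℕ.≤_) xs → All (ℕ._< a + length xs) xs →
                  xs ≡ applyUpTo (a +_) (length xs)
increasing-full a [] _ _ _ = refl
increasing-full a (x ∷ xs) (x< ∷ inc) (a≤x ∷ _) (x<b ∷ <b) =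
  trans (cong (x ∷_) tail≡) (cong (_∷ applyUpTo (λ i → a + suc i) (length xs)) head≡)
  where
  tail≡′ : xs ≡ applyUpTo (suc a +_) (length xs)
  tail≡′ = increasing-full (suc a) xs inc
             (All.map (ℕ.≤-<-trans a≤x) x<)
             (All.map (λ {y} → subst (y ℕ.<_) (ℕ.+-suc a (length xs))) <b)
  shift : ∀ m f g → (∀ i → f i ≡ g i) → applyUpTo f m ≡ applyUpTo {A = ℕ} g m
  shift zero    f g e = refl
  shift (suc m) f g e =
    trans (cong (_∷ _) (e 0)) (cong (g 0 ∷_) (shift m (f ∘ suc) (g ∘ suc) (e ∘ suc)))
  tail≡ : xs ≡ applyUpTo (λ i → a + suc i) (length xs)
  tail≡ = trans tail≡′ (shift (length xs) _ _ (λ i → sym (ℕ.+-suc a i)))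
  bound : ∀ ys → All (x ℕ.<_) ys → x ℕ.< a + suc (length ys) →
          ys ≡ applyUpTo (λ i → a + suc i) (length ys) → x ℕ.< suc a
  bound []       _       lt _    = subst (x ℕ.<_) (ℕ.+-comm a 1) lt
  bound (y ∷ ys) (p ∷ _) _  e    = subst (x ℕ.<_) (trans (∷-injectiveˡ e) (ℕ.+-comm a 1)) p
  head≡ : x ≡ a + 0
  head≡ = trans (ℕ.≤-antisym (ℕ.≤-pred (bound xs x< x<b tail≡)) a≤x) (sym (ℕ.+-identityʳ a))

module BaseFaces {k c ℓ₁ ℓ₂} (P : Polytope (suc k) c ℓ₁ ℓ₂) where
  open Polytope P
  open Symmetry P
  open Automorphism
  open Poset poset using (module Eq)

  rankℕ : Carrier → ℕ
  rankℕ = toℕ ∘ rank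

  ranks : ∀ (f : Carrier → Carrier) → (∀ {x y} → x < y → f x < f y) → ∀ Φ →
          map (rankℕ ∘ f) (faces Φ) ≡ applyUpTo (0 +_) (3 + k)
  ranks f f-mono Φ =
    trans (increasing-full 0 _
            (AllPairs.map⁺ (AllPairs.map (rank-mono ∘ f-mono) (chain Φ)))
            (All.universal (λ _ → ℕ.z≤n) _)
            (subst (λ m → All (ℕ._< m) ys) (sym len) (below (faces Φ))))
          (cong (applyUpTo (0 +_)) len)
    where
    ys = map (rankℕ ∘ f) (faces Φ)
    len : length ys ≡ 3 + k
    len = trans (length-map _ (faces Φ)) (flag-length Φ)
    below : ∀ xs → All (ℕ._< 3 + k) (map (rankℕ ∘ f) xs)
    below []       = []
    below (x ∷ xs) = toℕ<n _ ∷ below xs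

  map-pointwise : ∀ (f g : Carrier → ℕ) xs → map f xs ≡ map g xs → ∀ {x} → x ∈ᴾ xs → f x ≡ g x
  map-pointwise f g (x ∷ xs) e (here refl) = ∷-injectiveˡ e
  map-pointwise f g (x ∷ xs) e (there p)   = map-pointwise f g xs (∷-injectiveʳ e) p

  to-strict : ∀ (γ : Automorphism poset) {x y} → x < y → to γ x < to γ y
  to-strict γ (p , ne) = to-mono γ p , ne ∘ to-injective γ

  rank-preserved : ∀ (γ : Automorphism poset) (Φ : Flag) {x} → x ∈ᴾ faces Φ → rank (to γ x) ≡ rank x
  rank-preserved γ Φ p = toℕ-injective
    (map-pointwise (rankℕ ∘ to γ) rankℕ (faces Φ)
      (trans (ranks (to γ) (to-strict γ) Φ) (sym (ranks (λ x → x) (λ q → q) Φ))) p)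

  weaken : ∀ {x xs} → x ∈ᴾ xs → x ∈ xs
  weaken = Any.map Eq.reflexive

  rank-below : ∀ {x y ys} → All (x <_) ys → y ∈ ys → rank x ≡ rank y → x ≈ y
  rank-below (lt ∷ _) (here e)  r = ⊥-elim (Fin.<-irrefl (trans r (rank-cong e)) (rank-mono lt))
  rank-below (_ ∷ lts) (there p) r = rank-below lts p r

  rank-unique : ∀ {xs u v} → AllPairs _<_ xs → u ∈ xs → v ∈ xs → rank u ≡ rank v → u ≈ v
  rank-unique _          (here e)  (here e′) _ = Eq.trans e (Eq.sym e′)
  rank-unique (lt ∷ _)   (here e)  (there q) r =
    Eq.trans e (rank-below lt q (trans (sym (rank-cong e)) r))
  rank-unique (lt ∷ _)   (there p) (here e)  r =
    Eq.trans (Eq.sym (rank-below lt p (trans (sym (rank-cong e)) (sym r)))) (Eq.sym e)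
  rank-unique (_ ∷ inc)  (there p) (there q) r = rank-unique inc p q r

  abstract
    faceOf : ∀ (Φ : Flag) (j : Fin (3 + k)) → ∃ λ x → x ∈ᴾ faces Φ × rank x ≡ j
    faceOf Φ j with ∈-map⁻ rankℕ (subst (toℕ j ∈ᴾ_) (sym (ranks (λ x → x) (λ q → q) Φ))
                                        (∈-applyUpTo⁺ (0 +_) (toℕ<n j)))
    ... | x , x∈ , e = x , x∈ , sym (toℕ-injective e)

  face : Flag → Fin (3 + k) → Carrier
  face Φ j = proj₁ (faceOf Φ j)

  face-∈ : ∀ Φ j → face Φ j ∈ᴾ faces Φ
  face-∈ Φ j = proj₁ (proj₂ (faceOf Φ j))

  face-rank : ∀ Φ j → rank (face Φ j) ≡ j
  face-rank Φ j = proj₂ (proj₂ (faceOf Φ j))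

  fixed : ∀ (γ : Automorphism poset) {Φ Ψ} j → Maps γ Φ Ψ → face Φ j ∈ faces Ψ → to γ (face Φ j) ≈ face Φ j
  fixed γ {Φ} {Ψ} j maps p =
    rank-unique {u = to γ (face Φ j)} (chain Ψ) (Equivalence.to (maps (face Φ j)) (weaken (face-∈ Φ j))) p
                (rank-preserved γ Φ (face-∈ Φ j))

  stays : ∀ {Φ Ψ i} x → Φ ~[ i ] Ψ → rank x ≢ i → x ∈ faces Φ → x ∈ faces Ψ
  stays x (same , _) ne = Equivalence.to (same x ne)

  rotation-fixes : ∀ {Φ} (S : ChiralOrDirectlyRegular Φ) i j →
                   j ≢ proper (suc i) → j ≢ proper (inject₁ i) →
                   to (rotation S i) (face Φ j) ≈ face Φ j
  rotation-fixes {Φ} (inj₁ ch) i j ne ne′ with Chiral.σ-maps ch i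
  ... | Ψ , Ψ′ , adj , adj′ , maps =
    fixed (Chiral.σ ch i) {Ψ = Ψ′} j maps
      (stays {Ψ} {Ψ′} x adj′ (ne′ ∘ trans (sym r)) (stays {Φ} {Ψ} x adj (ne ∘ trans (sym r)) (weaken x∈)))
    where
    x = face Φ j
    x∈ = face-∈ Φ j
    r = face-rank Φ j
  rotation-fixes {Φ} (inj₂ dr) i j ne ne′ =
    Eq.trans (to-cong (ρ (suc i)) (fix (inject₁ i) ne′)) (fix (suc i) ne)
    where
    open DirectlyRegular dr
    fix : ∀ m → j ≢ proper m → to (ρ m) (face Φ j) ≈ face Φ j
    fix m ne″ with ρ-maps m
    ... | Ψ , adj , maps =
      fixed (ρ m) {Ψ = Ψ} j maps
        (stays {Φ} {Ψ} (face Φ j) adj (ne″ ∘ trans (sym (face-rank Φ j)))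
               (weaken (face-∈ Φ j)))

module Rank4 {c ℓ₁ ℓ₂} (P : Polytope 4 c ℓ₁ ℓ₂) where
  open Polytope P
  open Symmetry P public
  open BaseFaces P

  -- F₃/F₋₁ and F₄/F₀, in the shifted numbering of ranks.
  facet vertexFigure : Flag → Poset (c ⊔ ℓ₂) ℓ₁ ℓ₂
  facet        Φ = section poset (face Φ 0F) (face Φ 4F)
  vertexFigure Φ = section poset (face Φ 1F) (face Φ 5F)

  -- Γ⁺(K) = ⟨σ₁, σ₂⟩, realised as automorphisms of K.
  Γ⁺-facet : ∀ {Φ} → ChiralOrDirectlyRegular Φ → GeneratedGroup 2 (c ⊔ ℓ₁ ⊔ ℓ₂) (c ⊔ ℓ₁ ⊔ ℓ₂)
  Γ⁺-facet {Φ} S = record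
    { ambient   = automorphismGroup (facet Φ)
    ; generator = λ where
        0F → restrict poset (rotation S 0F) (rotation-fixes S 0F 0F (λ ()) (λ ()))
                                            (rotation-fixes S 0F 4F (λ ()) (λ ()))
        1F → restrict poset (rotation S 1F) (rotation-fixes S 1F 0F (λ ()) (λ ()))
                                            (rotation-fixes S 1F 4F (λ ()) (λ ()))
    }

  -- Γ⁺(L) = ⟨σ₂, σ₃⟩, realised as automorphisms of L.
  Γ⁺-vertexFigure : ∀ {Φ} → ChiralOrDirectlyRegular Φ →
                    GeneratedGroup 2 (c ⊔ ℓ₁ ⊔ ℓ₂) (c ⊔ ℓ₁ ⊔ ℓ₂)
  Γ⁺-vertexFigure {Φ} S = record
    { ambient   = automorphismGroup (vertexFigure Φ)
    ; generator = λ where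
        0F → restrict poset (rotation S 1F) (rotation-fixes S 1F 1F (λ ()) (λ ()))
                                            (rotation-fixes S 1F 5F (λ ()) (λ ()))
        1F → restrict poset (rotation S 2F) (rotation-fixes S 2F 1F (λ ()) (λ ()))
                                            (rotation-fixes S 2F 5F (λ ()) (λ ()))
    }

-- For G = ⟨σ₁,…,σₙ₋₁⟩ (k = n - 1), the j-faces are the right cosets of
-- G_{{0,…,n-1} ∖ {j}}, which for j = -1, n is G itself; a j-face is below an
-- l-face iff j ≤ l and the two cosets meet. (E. Schulte, A. I. Weiss, Chiral
-- polytopes, 1991.)
module CosetGeometry {k c ℓ} (G : GeneratedGroup k c ℓ) where
  open GeneratedGroup G

  faceStabilizer : Fin (3 + k) → Pred Carrier (c ⊔ ℓ)
  faceStabilizer r = Sub (λ m → proper m ≢ r)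

  Face : Set (c ⊔ ℓ)
  Face = Fin (3 + k) × Element

  cosetGeometry : RawRelation (c ⊔ ℓ) (c ⊔ ℓ) (c ⊔ ℓ)
  cosetGeometry = record
    { Carrier = Face
    ; _≈_ = λ (r , g , _) (s , h , _) → r ≡ s × InCoset (faceStabilizer r) h g
    ; _∼_ = λ (r , g , _) (s , h , _) →
              r Fin.≤ s × ∃ λ x → InCoset (faceStabilizer r) g x × InCoset (faceStabilizer s) h x
    }

-- For G = Γ⁺(P) ⋄ Γ⁺(Q), the structure built from G is the mix P ⋄ Q.
Polytopal : ∀ {k c ℓ} → GeneratedGroup k c ℓ → Set (c ⊔ ℓ)
Polytopal {k} G = IsPolytope (suc k) (CosetGeometry.cosetGeometry G)

{-# OPTIONS --safe #-}
-- Let β₁, β₂, β₃ be the generators of the mix M of Γ⁺(P) with Γ⁺(P^δ). The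
-- even flags of P ⋄ P^δ correspond to the elements of M; adding a second copy
-- of M for the odd flags, the i-adjacencies become involutions rᵢ of M ⊔ M, the
-- faces of rank j become the classes of flags connected without rⱼ, and the
-- coset geometry is a polytope once rᵢ and rⱼ commute for |i - j| ≥ 2, once
-- rⱼ always changes the j-face, and once flags that are connected by ranks
-- below b, and also by ranks ≥ a, are connected by ranks in [a, b).
--
-- Only the last condition for [a, b) = {1, 2} does not come directly from
-- the free action of Γ⁺(P) on flags: it says that ⟨β₁, β₂⟩ ∩ ⟨β₂, β₃⟩ = ⟨β₂⟩.
-- Both components of an element of the intersection fix the base vertex and
-- the base facet, so they lie in ⟨σ₂⟩, of prime order q. If the intersection were
-- larger than ⟨β₂⟩, it would be ⟨σ₂⟩ × ⟨σ₂⟩, and q² would divide the order of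
-- Γ⁺(K) ⋄ Γ⁺(L^δ).
module Submission where

open import Defs
open import Algebra.Bundles using (Group)
import Algebra.Properties.Group
import Algebra.Properties.Monoid.Mult
open import Data.Empty using (⊥; ⊥-elim)
open import Data.Fin as Fin using (Fin; zero; suc; toℕ; inject₁; opposite)
open import Data.Fin.Patterns using (0F; 1F; 2F; 3F; 4F; 5F)
open import Data.Fin.Properties as Fin using (toℕ<n; toℕ-injective; toℕ-inject₁; toℕ-fromℕ<; opposite-involutive)
open import Data.List using (List; []; _∷_; [_]; length; lookup; tabulate; deduplicate; allFin)
open import Data.List.Membership.Propositional using () renaming (_∈_ to _∈ᴾ_)
open import Data.List.Membership.Propositional.Properties using (∈-tabulate⁺; ∈-tabulate⁻; ∈-lookup; ∈-allFin)
import Data.List.Membership.Setoid.Properties as Membership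
open import Data.List.Relation.Unary.All as All using (All; []; _∷_)
open import Data.List.Relation.Unary.AllPairs as AllPairs using (AllPairs; []; _∷_)
open import Data.List.Relation.Unary.AllPairs.Properties as AllPairs using ()
open import Data.List.Relation.Unary.Any as Any using (Any; here; there)
open import Data.List.Relation.Unary.Any.Properties using (lookup-index)
open import Data.List.Relation.Unary.Unique.DecSetoid.Properties using (deduplicate-!)
open import Data.Nat as ℕ using (ℕ; zero; suc; _+_; _*_; _∸_; _%_; _/_; _^_; NonZero)
open import Data.Nat.Coprimality using (Coprime; coprime-Bézout)
open import Data.Nat.Divisibility using (_∣_; _∣?_; divides; divides-refl; ∣⇒≤)
open import Data.Nat.DivMod using (m≡m%n+[m/n]*n; m%n<n)
open import Data.Nat.GCD using (module Bézout)
open import Data.Nat.Induction using (<-wellFounded; Acc; acc)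
open import Data.Nat.Primality using (Prime; prime⇒irreducible; prime⇒nonZero)
open import Data.Nat.Properties as ℕ using ()
open import Data.Nat.Tactic.RingSolver using (solve-∀)
open import Data.Product using (∃; _×_; _,_; proj₁; proj₂)
open import Data.Sum using (_⊎_; inj₁; inj₂)
open import Data.Unit using (⊤; tt)
open import Data.Vec using (_∷_; [])
open import Function using (_∘_; id; _⇔_; mk⇔; Equivalence)
open import Level using (Level; _⊔_; 0ℓ) renaming (suc to lsuc)
open import Relation.Binary using (Rel; Symmetric; Setoid; DecSetoid; Poset; IsEquivalence; IsPartialOrder; tri<; tri≈; tri>)
open import Relation.Binary.Bundles.Raw using (RawRelation)
open import Relation.Binary.Construct.Closure.ReflexiveTransitive using (Star; _◅_) renaming (ε to [-])
open import Relation.Binary.PropositionalEquality as ≡ using (_≡_; _≢_)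
import Relation.Binary.Reasoning.Setoid
open import Relation.Nullary using (¬_; Dec; yes; no)
open import Relation.Nullary.Decidable as Dec using (_×-dec_; _⊎-dec_; _→-dec_; ¬?; toWitness; decidable-stable)
open import Relation.Unary using (Pred)

-- Flags related by involutions

-- The rotation group of a chiral polytope contains no reflections, so adjacency cannot be expressed
-- inside M; the formal odd copy supplies them, and the same graph serves directly regular
-- polytopes.
--
-- An element of M acts on the flags of P through either component. Through the second one, rank i
-- of the mix appears as rank 3 - i of P, since that component belongs to the dual. A relation holds
-- in M once it holds for both actions, and an automorphism is determined by the image of one flag,
-- so relations can be checked on flags of P.
--
-- The intersection property concerns arbitrary sets of ranks. Intervals are enough because
-- reflections of non-neighbouring ranks commute, so the common faces of two flags can be dealt with
-- one at a time. This requires knowing which faces two flags of the mix share; finiteness makes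
-- that decidable by a bounded search for paths.
--
-- Primality turns the last step into an alternative: a pair of powers of σ₂ and its inverse whose
-- exponents differ modulo q generates, together with β₂, all of ⟨σ₂⟩ × ⟨σ₂⟩.

record FlagGraph (n : ℕ) c ℓ : Set (lsuc (c ⊔ ℓ)) where
  field
    setoid : Setoid c ℓ
  open Setoid setoid public renaming (Carrier to F)
  field
    r            : Fin n → F → F
    r-cong       : ∀ i {x y} → x ≈ y → r i x ≈ r i y
    r-involutive : ∀ i x → r i (r i x) ≈ x

  data Conn {h} (I : Pred (Fin n) h) : F → F → Set (c ⊔ ℓ ⊔ h) where
    done : ∀ {x y} → x ≈ y → Conn I x y
    step : ∀ {x y} i → I i → Conn I (r i x) y → Conn I x y

  private variable
    h     : Level
    I J   : Pred (Fin n) h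
    x y z : F

  weaken : (∀ {i} → I i → J i) → Conn I x y → Conn J x y
  weaken I⊆J (done e)     = done e
  weaken I⊆J (step i p c) = step i (I⊆J p) (weaken I⊆J c)

  conn-refl : Conn I x x
  conn-refl = done refl

  conn-respˡ : x ≈ y → Conn I y z → Conn I x z
  conn-respˡ e (done e′)    = done (trans e e′)
  conn-respˡ e (step i p c) = step i p (conn-respˡ (r-cong i e) c)

  conn-trans : Conn I x y → Conn I y z → Conn I x z
  conn-trans (done e)     d = conn-respˡ e d
  conn-trans (step i p c) d = step i p (conn-trans c d)

  conn-step : ∀ i → I i → Conn I x (r i x)
  conn-step i p = step i p conn-refl

  conn-sym : Conn I x y → Conn I y x
  conn-sym (done e)     = done (sym e)
  conn-sym (step i p c) = conn-trans (conn-sym c) (step i p (done (r-involutive i _)))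

  conn-shift : ∀ i → (∀ {j} → I j → ∀ x → r j (r i x) ≈ r i (r j x)) →
               Conn I x y → Conn I (r i x) (r i y)
  conn-shift i comm (done e)     = done (r-cong i e)
  conn-shift i comm (step j p c) =
    step j p (conn-respˡ (comm p _) (conn-shift i comm c))

  Except : Fin n → Pred (Fin n) 0ℓ
  Except j m = m ≢ j

  Everything : Pred (Fin n) 0ℓ
  Everything _ = ⊤

  -- Consecutive steps of the one rank `j` cancel in pairs.
  conn-singleton : ∀ j → Conn (_≡ j) x y → x ≈ y ⊎ r j x ≈ y
  conn-singleton j (done e) = inj₁ e
  conn-singleton j (step .j ≡.refl c) with conn-singleton j c
  ... | inj₁ e = inj₂ e
  ... | inj₂ e = inj₁ (trans (sym (r-involutive j _)) e)

  IsCommuting : Set (c ⊔ ℓ)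
  IsCommuting = ∀ {i j} → suc (toℕ i) ℕ.< toℕ j → ∀ x → r i (r j x) ≈ r j (r i x)

  IsFacewiseFree : Set (c ⊔ ℓ)
  IsFacewiseFree = ∀ j x → ¬ Conn (Except j) x (r j x)

  IsSeparating : Set (c ⊔ ℓ)
  IsSeparating = ∀ (a : ℕ) (b : Fin n) → a ℕ.≤ toℕ b → ∀ {x y} →
    Conn (λ m → a ℕ.≤ toℕ m) x y → Conn (λ m → toℕ m ℕ.< toℕ b) x y →
    Conn (λ m → a ℕ.≤ toℕ m × toℕ m ℕ.< toℕ b) x y

  module Commuting (r-comm : IsCommuting) where

    comm-far : ∀ {i j} → suc (toℕ i) ℕ.< toℕ j ⊎ suc (toℕ j) ℕ.< toℕ i →
               ∀ x → r i (r j x) ≈ r j (r i x)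
    comm-far (inj₁ lt) x = r-comm lt x
    comm-far (inj₂ lt) x = sym (r-comm lt x)

    -- Ranks on different sides of `s` differ by at least two, so their reflections commute and the
    -- low steps can be made before the high ones.
    conn-split : ∀ (s : Fin n) → Conn (Except s) x y →
                 ∃ λ z → Conn (λ m → toℕ m ℕ.< toℕ s) x z × Conn (λ m → toℕ s ℕ.< toℕ m) z y
    conn-split {x} s (done e) = x , conn-refl , done e
    conn-split {x} s (step i p c) with conn-split s c
    ... | z , lo , hi with ℕ.<-cmp (toℕ i) (toℕ s)
    ... | tri< i<s _ _ = z , step i i<s lo , hi
    ... | tri≈ _ e _ = ⊥-elim (p (toℕ-injective e))
    -- The step of rank `i` is postponed past the low path: reflected by `r i`, that path starts at
    -- `x` again and ends at `r i z`, from where `i` leads back to `z`.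
    ... | tri> _ _ s<i = r i z
        , conn-respˡ (sym (r-involutive i x))
            (conn-shift i (λ j<s → comm-far (inj₁ (ℕ.≤-trans (ℕ.s≤s j<s) s<i))) lo)
        , step i s<i (conn-respˡ (r-involutive i z) hi)

    -- Every rank of `I` other than `j` commutes with `j`, so the steps of rank `j` can be collected
    -- at the start, where only their parity counts.
    conn-around : ∀ (j : Fin n) → (∀ {m} → I m → suc (toℕ m) ≢ toℕ j × suc (toℕ j) ≢ toℕ m) →
                  Conn I x y → Conn (Except j) x y ⊎ Conn (Except j) (r j x) y
    conn-around j far (done e) = inj₁ (done e)
    conn-around j far (step i p c) with conn-around j far c | ℕ.<-cmp (toℕ i) (toℕ j)
    ... | inj₁ d | tri< _ ne _ = inj₁ (step i (ne ∘ ≡.cong toℕ) d)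
    ... | inj₁ d | tri> _ ne _ = inj₁ (step i (ne ∘ ≡.cong toℕ) d)
    ... | inj₂ d | tri< lt ne _ = inj₂ (step i (ne ∘ ≡.cong toℕ)
          (conn-respˡ (comm-far (inj₁ (ℕ.≤∧≢⇒< lt (proj₁ (far p)))) _) d))
    ... | inj₂ d | tri> _ ne gt = inj₂ (step i (ne ∘ ≡.cong toℕ)
          (conn-respˡ (comm-far (inj₂ (ℕ.≤∧≢⇒< gt (proj₂ (far p)))) _) d))
    ... | inj₁ d | tri≈ _ e _ with ≡.refl ← toℕ-injective e = inj₂ d
    ... | inj₂ d | tri≈ _ e _ with ≡.refl ← toℕ-injective e =
      inj₁ (conn-respˡ (sym (r-involutive i _)) d)

    -- The faces common to x and y are removed from the admissible ranks one
    -- at a time, in increasing order, moving x along the way: after stage s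
    -- the flags x′ and y are joined by ranks ≥ a, and a - 1 is the last
    -- common rank below s.
    module _ (separating : IsSeparating) {d} {D : Pred (Fin n) d} (D? : ∀ j → Dec (D j)) {x y : F}
             (common : ∀ {j} → D j → Conn (Except j) x y) (connected : Conn Everything x y) where

      private
        Free : Pred (Fin n) d
        Free j = ¬ D j

        Stage : ℕ → Set (c ⊔ ℓ ⊔ d)
        Stage s = ∃ λ a → ∃ λ x′ → a ℕ.≤ s × Conn Free x x′ × Conn (λ m → a ℕ.≤ toℕ m) x′ y
                  × (∀ m → a ℕ.≤ toℕ m → toℕ m ℕ.< s → Free m)

        stage : ∀ s → s ℕ.≤ n → Stage s
        stage zero    _   = 0 , x , ℕ.z≤n , conn-refl , weaken (λ _ → ℕ.z≤n) connected , λ _ _ ()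
        stage (suc s) s<n with stage s (ℕ.<⇒≤ s<n) | D? (Fin.fromℕ< s<n)
        ... | a , x′ , a≤s , path , rest , free | no ¬d =
          a , x′ , ℕ.m≤n⇒m≤1+n a≤s , path , rest , free′
          where
          free′ : ∀ m → a ℕ.≤ toℕ m → toℕ m ℕ.< suc s → Free m
          free′ m a≤m m<1+s with toℕ m ℕ.≟ s
          ... | no  m≢s = free m a≤m (ℕ.≤∧≢⇒< (ℕ.≤-pred m<1+s) m≢s)
          ... | yes ≡.refl = ¬d ∘ ≡.subst D (≡.sym (Fin.fromℕ<-toℕ m s<n))
        ... | a , x′ , a≤s , path , rest , free | yes dₛ
          -- Going back to `x` along `path` avoids `j`, because `path` uses no rank in `D`; so `x′`
          -- and `y` still share the `j`-face.
          with conn-split j (conn-trans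
                 (conn-sym (weaken {J = Except j} (λ ¬d e → ¬d (≡.subst D (≡.sym e) dₛ)) path))
                 (common dₛ))
          where
          j : Fin n
          j = Fin.fromℕ< s<n
        ... | z , lo , hi = suc s , z , ℕ.≤-refl
            , conn-trans path (weaken (λ {m} (a≤m , m<j) → free m a≤m (≡.subst (toℕ m ℕ.<_) j≡s m<j)) between)
            , weaken (λ {m} → ≡.subst (λ t → suc t ℕ.≤ toℕ m) j≡s) hi
            , λ m s<m m<1+s → ⊥-elim (ℕ.<-irrefl ≡.refl (ℕ.<-≤-trans s<m (ℕ.≤-pred m<1+s)))
          where
          j : Fin n
          j = Fin.fromℕ< s<n
          j≡s : toℕ j ≡ s
          j≡s = Fin.toℕ-fromℕ< s<n
          a≤j : a ℕ.≤ toℕ j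
          a≤j = ≡.subst (a ℕ.≤_) (≡.sym j≡s) a≤s
          between : Conn (λ m → a ℕ.≤ toℕ m × toℕ m ℕ.< toℕ j) x′ z
          -- `rest` followed by the reverse of `hi` also joins `x′` to `z`, by ranks at least `a`,
          -- while `lo` uses ranks below `j`.
          between = separating a j a≤j
            (conn-trans rest (conn-sym (weaken (λ j<m → ℕ.≤-trans a≤j (ℕ.<⇒≤ j<m)) hi))) lo

      conn-free : Conn (λ j → ¬ D j) x y
      conn-free with stage n ℕ.≤-refl
      ... | a , x′ , _ , path , rest , free =
        conn-trans path (weaken (λ {m} a≤m → free m a≤m (toℕ<n m)) rest)

  -- Connection is decidable in a finite flag graph

  private
    steps : Conn I x y → ℕ
    steps (done _)     = 0
    steps (step _ _ c) = suc (steps c)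

    vertex : (p : Conn I x y) → Fin (suc (steps p)) → F
    vertex {x = x} _  zero    = x
    vertex (step _ _ c) (suc k) = vertex c k

    suffix : (p : Conn I x y) (k : Fin (suc (steps p))) →
             ∃ λ (q : Conn I (vertex p k) y) → steps q + toℕ k ≡ steps p
    suffix p zero = p , ℕ.+-identityʳ _
    suffix (step _ _ c) (suc k) with suffix c k
    ... | q , e = q , ≡.trans (ℕ.+-suc _ _) (≡.cong suc e)

    splice : (p : Conn I x y) (k : Fin (suc (steps p))) (q : Conn I (vertex p k) y) →
             ∃ λ (p′ : Conn I x y) → steps p′ ≡ steps q + toℕ k
    splice p zero q = q , ≡.sym (ℕ.+-identityʳ _)
    splice (step i m c) (suc k) q with splice c k q
    ... | p′ , e = step i m p′ , ≡.trans (≡.cong suc e) (≡.sym (ℕ.+-suc _ _))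

    steps-respˡ : (e : x ≈ y) (p : Conn I y z) → steps (conn-respˡ e p) ≡ steps p
    steps-respˡ e (done _)     = ≡.refl
    steps-respˡ e (step i _ c) = ≡.cong suc (steps-respˡ (r-cong i e) c)

  module _ {K} (code : F → Fin K) (code-injective : ∀ {x y} → code x ≡ code y → x ≈ y)
           (_≟_ : ∀ x y → Dec (x ≈ y)) where

    private
      -- A path with at least `K` steps visits more than `K` flags counted along the way, hence one
      -- of them twice, and the loop between the two visits is cut out.
      shorten : (p : Conn I x y) → K ℕ.≤ steps p → ∃ λ (p′ : Conn I x y) → steps p′ ℕ.< steps p
      shorten p K≤ with Fin.pigeonhole (ℕ.s≤s K≤) (code ∘ vertex p)
      ... | i , j , i<j , e with suffix p j
      ... | q , q-steps with splice p i (conn-respˡ (code-injective e) q)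
      ... | p′ , p′-steps = p′ ,
        ≡.subst₂ ℕ._<_ (≡.sym (≡.trans p′-steps (≡.cong (_+ toℕ i) (steps-respˡ _ q)))) q-steps
          (ℕ.+-monoʳ-< (steps q) i<j)

      short : (p : Conn I x y) → Acc ℕ._<_ (steps p) → ∃ λ (p′ : Conn I x y) → steps p′ ℕ.≤ K
      short p (acc rec) with K ℕ.≤? steps p
      ... | no  K≰ = p , ℕ.<⇒≤ (ℕ.≰⇒> K≰)
      ... | yes K≤ with shorten p K≤
      ...   | p′ , lt = short p′ (rec lt)

      bounded? : (∀ i → Dec (I i)) → ∀ b x y → Dec (∃ λ (p : Conn I x y) → steps p ℕ.≤ b)
      bounded? I? b x y with x ≟ y
      ... | yes e = yes (done e , ℕ.z≤n)
      bounded? I? zero    x y | no ne = no λ where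
        (done e , _)      → ne e
        (step _ _ _ , ())
      bounded? I? (suc b) x y | no ne with Fin.any? (λ i → I? i ×-dec bounded? I? b (r i x) y)
      ... | yes (i , m , p , le) = yes (step i m p , ℕ.s≤s le)
      ... | no none = no λ where
        (done e , _)              → ne e
        (step i m p , ℕ.s≤s le) → none (i , m , p , le)

    -- Repeated shortening leaves a path of at most `K` steps, so a search up to that length is
    -- exhaustive.
    conn? : (∀ i → Dec (I i)) → ∀ x y → Dec (Conn I x y)
    conn? I? x y = Dec.map′ proj₁ (λ p → short p (<-wellFounded _)) (bounded? I? K x y)

-- The flag graph of a rotation group

module RotationGraph {c ℓ} (A : GeneratedGroup 3 c ℓ) where
  open GeneratedGroup A
  open Algebra.Properties.Group ambient
  open Relation.Binary.Reasoning.Setoid setoid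

  -- In terms of reflections, prefix i is ρ₀ρᵢ.
  prefix : Fin 4 → Carrier
  prefix 0F = ε
  prefix 1F = generator 0F
  prefix 2F = generator 0F ∙ generator 1F
  prefix 3F = (generator 0F ∙ generator 1F) ∙ generator 2F

  -- Telescoping: in terms of reflections `τ i j` is ρᵢρⱼ₊₁, and ρ₀ρᵢ times ρᵢρⱼ₊₁ is ρ₀ρⱼ₊₁.
  prefix-τ : ∀ i j → i Fin.≤ j → prefix (suc j) ≈ prefix (inject₁ i) ∙ τ i j
  prefix-τ 0F 0F _ = sym (trans (identityˡ _) (identityʳ _))
  prefix-τ 0F 1F _ = sym (trans (identityˡ _) (∙-congˡ (identityʳ _)))
  prefix-τ 0F 2F _ = sym (trans (identityˡ _) (trans (∙-congˡ (∙-congˡ (identityʳ _))) (sym (assoc _ _ _))))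
  prefix-τ 1F 1F _ = ∙-congˡ (sym (identityʳ _))
  prefix-τ 1F 2F _ = trans (assoc _ _ _) (∙-congˡ (∙-congˡ (sym (identityʳ _))))
  prefix-τ 2F 2F _ = ∙-congˡ (sym (identityʳ _))
  prefix-τ 1F 0F ()
  prefix-τ 2F 0F ()
  prefix-τ 2F 1F (ℕ.s≤s ())

  τ-prefix : ∀ i j → i Fin.≤ j → prefix (inject₁ i) ⁻¹ ∙ prefix (suc j) ≈ τ i j
  τ-prefix i j i≤j = begin
    prefix (inject₁ i) ⁻¹ ∙ prefix (suc j)                ≈⟨ ∙-congˡ (prefix-τ i j i≤j) ⟩
    prefix (inject₁ i) ⁻¹ ∙ (prefix (inject₁ i) ∙ τ i j)  ≈⟨ assoc _ _ _ ⟨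
    (prefix (inject₁ i) ⁻¹ ∙ prefix (inject₁ i)) ∙ τ i j  ≈⟨ ∙-congʳ (inverseˡ _) ⟩
    ε ∙ τ i j                                             ≈⟨ identityˡ _ ⟩
    τ i j                                                 ∎

  -- even x stands for the flag Φx and odd x for the flag Φ⁰x.
  data RFlag : Set c where
    even odd : Carrier → RFlag

  data _≈ᶠ_ : RFlag → RFlag → Set (c ⊔ ℓ) where
    even : ∀ {x y} → x ≈ y → even x ≈ᶠ even y
    odd  : ∀ {x y} → x ≈ y → odd x ≈ᶠ odd y

  underlying : RFlag → Carrier
  underlying (even x) = x
  underlying (odd x)  = x

  -- The flag i-adjacent to Φx is Φⁱx = Φ⁰(ρ₀ρᵢx), hence the multiplication by `prefix i` on the
  -- left; right translations then commute with every reflection.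
  reflect : Fin 4 → RFlag → RFlag
  reflect i (even x) = odd (prefix i ∙ x)
  reflect i (odd x)  = even (prefix i ⁻¹ ∙ x)

  graph : FlagGraph 4 c (c ⊔ ℓ)
  graph = record
    { setoid = record
      { Carrier = RFlag
      ; _≈_ = _≈ᶠ_
      ; isEquivalence = record
        { refl  = λ { {even _} → even refl ; {odd _} → odd refl }
        ; sym   = λ { (even e) → even (sym e) ; (odd e) → odd (sym e) }
        ; trans = λ { (even e) (even e′) → even (trans e e′) ; (odd e) (odd e′) → odd (trans e e′) }
        }
      }
    ; r = reflect
    ; r-cong = λ { i (even e) → odd (∙-congˡ e) ; i (odd e) → even (∙-congˡ e) }
    ; r-involutive = λ where
        i (even x) → even (trans (sym (assoc _ _ _)) (trans (∙-congʳ (inverseˡ _)) (identityˡ _)))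
        i (odd x)  → odd (trans (sym (assoc _ _ _)) (trans (∙-congʳ (inverseʳ _)) (identityˡ _)))
    }

  open FlagGraph graph public
    using (Conn; done; step; IsCommuting; IsFacewiseFree; IsSeparating; Except; Everything)
  open FlagGraph graph using (weaken; conn-trans; conn-sym; conn-respˡ) renaming (refl to ≈ᶠ-refl)

  translate : RFlag → Carrier → RFlag
  translate (even x) g = even (x ∙ g)
  translate (odd x)  g = odd (x ∙ g)

  private variable
    h : Level
    I : Pred (Fin 4) h
    x y z : Carrier

  conn-translate : ∀ {e f} g → Conn I e f → Conn I (translate e g) (translate f g)
  conn-translate g (done (even e)) = done (even (∙-congʳ e))
  conn-translate g (done (odd e))  = done (odd (∙-congʳ e))
  conn-translate {e = even x} g (step i p c) =
    step i p (conn-respˡ (odd (sym (assoc _ _ _))) (conn-translate g c))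
  conn-translate {e = odd x} g (step i p c) =
    step i p (conn-respˡ (even (sym (assoc _ _ _))) (conn-translate g c))

  private
    sub-flip : ∀ i j → Sub I (prefix i ⁻¹ ∙ prefix j) → Sub I (prefix j ⁻¹ ∙ prefix i)
    sub-flip i j s = resp (trans (⁻¹-anti-homo-∙ _ _) (∙-congˡ (⁻¹-involutive _))) (inv s)

    sub-prefix : ∀ i j → I i → I j → Sub I (prefix i ⁻¹ ∙ prefix j)
    sub-prefix 0F 0F p q = resp (sym (inverseˡ _)) unit
    sub-prefix 1F 1F p q = resp (sym (inverseˡ _)) unit
    sub-prefix 2F 2F p q = resp (sym (inverseˡ _)) unit
    sub-prefix 3F 3F p q = resp (sym (inverseˡ _)) unit
    sub-prefix 0F 1F p q = resp (sym (τ-prefix 0F 0F ℕ.z≤n)) (gen (0F , 0F , ℕ.z≤n , p , q))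
    sub-prefix 0F 2F p q = resp (sym (τ-prefix 0F 1F ℕ.z≤n)) (gen (0F , 1F , ℕ.z≤n , p , q))
    sub-prefix 0F 3F p q = resp (sym (τ-prefix 0F 2F ℕ.z≤n)) (gen (0F , 2F , ℕ.z≤n , p , q))
    sub-prefix 1F 2F p q = resp (sym (τ-prefix 1F 1F (ℕ.s≤s ℕ.z≤n))) (gen (1F , 1F , ℕ.s≤s ℕ.z≤n , p , q))
    sub-prefix 1F 3F p q = resp (sym (τ-prefix 1F 2F (ℕ.s≤s ℕ.z≤n))) (gen (1F , 2F , ℕ.s≤s ℕ.z≤n , p , q))
    sub-prefix 2F 3F p q = resp (sym (τ-prefix 2F 2F (ℕ.s≤s (ℕ.s≤s ℕ.z≤n)))) 
      (gen (2F , 2F , ℕ.s≤s (ℕ.s≤s ℕ.z≤n) , p , q))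
    sub-prefix {I = I} 1F 0F p q = sub-flip {I = I} 0F 1F (sub-prefix {I = I} 0F 1F q p)
    sub-prefix {I = I} 2F 0F p q = sub-flip {I = I} 0F 2F (sub-prefix {I = I} 0F 2F q p)
    sub-prefix {I = I} 3F 0F p q = sub-flip {I = I} 0F 3F (sub-prefix {I = I} 0F 3F q p)
    sub-prefix {I = I} 2F 1F p q = sub-flip {I = I} 1F 2F (sub-prefix {I = I} 1F 2F q p)
    sub-prefix {I = I} 3F 1F p q = sub-flip {I = I} 1F 3F (sub-prefix {I = I} 1F 3F q p)
    sub-prefix {I = I} 3F 2F p q = sub-flip {I = I} 2F 3F (sub-prefix {I = I} 2F 3F q p)

  -- Each step changes parity, so the steps come in pairs; ranks `i`, `j` in succession multiply on
  -- the left by ρⱼρᵢ, which lies in `Sub I`.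
  conn⇒sub : Conn I (even x) (even y) → Sub I (y ∙ x ⁻¹)
  conn⇒sub (done (even e)) = resp (sym (trans (∙-congʳ (sym e)) (inverseʳ _))) unit
  conn⇒sub {x = x} {y = y} (step i p (step j q c)) = resp eq (mul (conn⇒sub c) (sub-prefix j i q p))
    where
    u v : Carrier
    u = prefix j
    v = prefix i
    eq : (y ∙ (u ⁻¹ ∙ (v ∙ x)) ⁻¹) ∙ (u ⁻¹ ∙ v) ≈ y ∙ x ⁻¹
    eq = begin
      (y ∙ (u ⁻¹ ∙ (v ∙ x)) ⁻¹) ∙ (u ⁻¹ ∙ v)        ≈⟨ assoc _ _ _ ⟩
      y ∙ ((u ⁻¹ ∙ (v ∙ x)) ⁻¹ ∙ (u ⁻¹ ∙ v))        ≈⟨ ∙-congˡ (∙-congʳ (⁻¹-cong (sym (assoc _ _ _)))) ⟩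
      y ∙ (((u ⁻¹ ∙ v) ∙ x) ⁻¹ ∙ (u ⁻¹ ∙ v))        ≈⟨ ∙-congˡ (∙-congʳ (⁻¹-anti-homo-∙ _ _)) ⟩
      y ∙ ((x ⁻¹ ∙ (u ⁻¹ ∙ v) ⁻¹) ∙ (u ⁻¹ ∙ v))     ≈⟨ ∙-congˡ (assoc _ _ _) ⟩
      y ∙ (x ⁻¹ ∙ ((u ⁻¹ ∙ v) ⁻¹ ∙ (u ⁻¹ ∙ v)))     ≈⟨ ∙-congˡ (∙-congˡ (inverseˡ _)) ⟩
      y ∙ (x ⁻¹ ∙ ε)                                ≈⟨ ∙-congˡ (identityʳ _) ⟩
      y ∙ x ⁻¹                                      ∎

  sub⇒conn′ : Sub I z → ∀ x → Conn I (even x) (even (z ∙ x))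
  sub⇒conn′ (gen (i , j , i≤j , p , q)) x =
    -- ρᵢρⱼ₊₁ as two steps: the factor next to `x` acts first, so rank j + 1 precedes rank i.
    step (suc j) q (step (inject₁ i) p
      (done (even (trans (sym (assoc _ _ _)) (∙-congʳ (τ-prefix i j i≤j))))))
  sub⇒conn′ unit x = done (even (sym (identityˡ x)))
  sub⇒conn′ (mul s t) x =
    conn-trans (sub⇒conn′ t x) (conn-trans (sub⇒conn′ s _) (done (even (sym (assoc _ _ _)))))
  sub⇒conn′ (inv s) x =
    conn-sym (conn-trans (sub⇒conn′ s _)
      (done (even (trans (sym (assoc _ _ _)) (trans (∙-congʳ (inverseʳ _)) (identityˡ _))))))
  sub⇒conn′ (resp e s) x = conn-trans (sub⇒conn′ s x) (done (even (∙-congʳ e)))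

  sub⇒conn : Sub I (y ∙ x ⁻¹) → Conn I (even x) (even y)
  sub⇒conn {y = y} {x = x} s = conn-trans (sub⇒conn′ s x)
    (done (even (trans (assoc _ _ _) (trans (∙-congˡ (inverseˡ _)) (identityʳ _)))))

  prefix-generated : ∀ i → ⟨ generator ⟩ (prefix i)
  prefix-generated 0F = unit
  prefix-generated 1F = gen 0F
  prefix-generated 2F = mul (gen 0F) (gen 1F)
  prefix-generated 3F = mul (mul (gen 0F) (gen 1F)) (gen 2F)

  reflect-generated : ∀ i e → ⟨ generator ⟩ (underlying e) → ⟨ generator ⟩ (underlying (reflect i e))
  reflect-generated i (even x) p = mul (prefix-generated i) p
  reflect-generated i (odd x)  p = mul (inv (prefix-generated i)) p

  conn-generated : ∀ {e f} → Conn I e f → ⟨ generator ⟩ (underlying e) → ⟨ generator ⟩ (underlying f)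
  conn-generated (done (even e)) p = resp e p
  conn-generated (done (odd e))  p = resp e p
  conn-generated {e = e} (step i _ c) p = conn-generated c (reflect-generated i e p)

  private
    generator-conn : ⟨ generator ⟩ z → ∀ x → Conn Everything (even x) (even (z ∙ x))
    generator-conn s = sub⇒conn′ (everything s)
      where
      at : ∀ i → Sub Everything (generator i)
      at 0F = resp (identityʳ _) (gen (0F , 0F , ℕ.z≤n , tt , tt))
      at 1F = resp (identityʳ _) (gen (1F , 1F , ℕ.s≤s ℕ.z≤n , tt , tt))
      at 2F = resp (identityʳ _) (gen (2F , 2F , ℕ.s≤s (ℕ.s≤s ℕ.z≤n) , tt , tt))
      everything : ∀ {z} → ⟨ generator ⟩ z → Sub Everything z
      everything (gen i)    = at i
      everything unit       = unit
      everything (mul s t)  = mul (everything s) (everything t)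
      everything (inv s)    = inv (everything s)
      everything (resp e s) = resp e (everything s)

  generated⇒conn : ∀ {e f} → ⟨ generator ⟩ (underlying e) → ⟨ generator ⟩ (underlying f) → Conn Everything e f
  generated⇒conn {e} {f} p q = conn-trans (conn-sym (from-ε e p)) (from-ε f q)
    where
    from-ε : ∀ e → ⟨ generator ⟩ (underlying e) → Conn Everything (even ε) e
    from-ε (even x) p = conn-trans (generator-conn p ε) (done (even (identityʳ _)))
    from-ε (odd x)  p = conn-trans (from-ε (even x) p) (step 0F tt (done (odd (identityˡ x))))

  private
    evenize : ∀ i → I i → ∀ e → ∃ λ x → Conn I e (even x)
    evenize i p (even x) = x , done ≈ᶠ-refl
    evenize i p (odd x)  = _ , step i p (done ≈ᶠ-refl)

    to-base : Conn I (even x) (even y) → Conn I (even ε) (even (y ∙ x ⁻¹))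
    to-base {x = x} c = conn-respˡ (even (sym (inverseʳ x))) (conn-translate (x ⁻¹) c)

    from-base : Conn I (even ε) (even (y ∙ x ⁻¹)) → Conn I (even x) (even y)
    from-base {x = x} c = conn-respˡ (even (sym (identityˡ x))) (conn-trans (conn-translate x c)
      (done (even (trans (assoc _ _ _) (trans (∙-congˡ (inverseˡ x)) (identityʳ _))))))

  -- A rank of `I` makes both ends even, and a right translation moves the first one to the base
  -- flag. This reduces a statement on paths to one on elements of the group, at the price of a
  -- nonempty `I`.
  conn-∩ : ∀ {j k} {J : Pred (Fin 4) j} {K : Pred (Fin 4) k} →
    ∀ i → I i → (∀ {m} → I m → J m) → (∀ {m} → I m → K m) →
    (∀ z → Conn J (even ε) (even z) → Conn K (even ε) (even z) → Conn I (even ε) (even z)) →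
    ∀ {e f} → Conn J e f → Conn K e f → Conn I e f
  conn-∩ {I = I} i p I⊆J I⊆K base {e} {f} c d with evenize {I = I} i p e | evenize {I = I} i p f
  ... | x , e→x | y , f→y = conn-trans e→x (conn-trans (from-base (base (y ∙ x ⁻¹)
      (to-base (conn-trans (conn-sym (weaken I⊆J e→x)) (conn-trans c (weaken I⊆J f→y))))
      (to-base (conn-trans (conn-sym (weaken I⊆K e→x)) (conn-trans d (weaken I⊆K f→y)))))) (conn-sym f→y))

-- The coset geometry

toℕ-proper : ∀ {n} (m : Fin n) → toℕ (proper m) ≡ suc (toℕ m)
toℕ-proper m = ≡.cong suc (toℕ-inject₁ m)

proper-injective : ∀ {n} {i j : Fin n} → proper i ≡ proper j → i ≡ j
proper-injective = Fin.inject₁-injective ∘ Fin.suc-injective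

allPairs-lookup-injective : ∀ {a r e} {A : Set a} {R : Rel A r} {_≋_ : Rel A e} → Symmetric _≋_ →
  (∀ {x y} → R x y → ¬ x ≋ y) → ∀ {xs} → AllPairs R xs →
  ∀ {i j} → lookup xs i ≋ lookup xs j → i ≡ j
allPairs-lookup-injective s sep (_ ∷ _)  {zero}  {zero}  _ = ≡.refl
allPairs-lookup-injective s sep (rs ∷ _) {zero}  {suc j} e = ⊥-elim (sep (All.lookup rs (∈-lookup j)) e)
allPairs-lookup-injective s sep (rs ∷ _) {suc i} {zero}  e = ⊥-elim (sep (All.lookup rs (∈-lookup i)) (s e))
allPairs-lookup-injective {_≋_ = _≋_} s sep (_ ∷ ps) {suc i} {suc j} e =
  ≡.cong suc (allPairs-lookup-injective {_≋_ = _≋_} s sep ps e)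

module CosetPolytope {c ℓ} (A : GeneratedGroup 3 c ℓ) where
  open GeneratedGroup A using (Carrier; ⟨_⟩; generator; unit; Element; ε)
  open RotationGraph A
  open FlagGraph graph hiding (setoid; Conn; done; step; IsCommuting; IsFacewiseFree; IsSeparating; Except; Everything)
  open CosetGeometry A
  open Chains cosetGeometry

  third-rank : ∀ (r s : Fin 6) → ∃ λ (m : Fin 4) → proper m ≢ r × proper m ≢ s
  third-rank = toWitness {a? = Fin.all? λ r → Fin.all? λ s → Fin.any? λ m →
    ¬? (proper m Fin.≟ r) ×-dec ¬? (proper m Fin.≟ s)} tt

  -- Every `m` avoids the two improper ranks, which lets the least and the greatest face be treated
  -- like all others.
  Avoid : Fin 6 → Pred (Fin 4) 0ℓ
  Avoid r m = proper m ≢ r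

  rankᶠ : Face → Fin 6
  rankᶠ = proj₁

  Incident : RFlag → Face → Set (c ⊔ ℓ)
  Incident e (r , g , _) = Conn (Avoid r) (even g) e

  Generated : RFlag → Set (c ⊔ ℓ)
  Generated e = ⟨ generator ⟩ (underlying e)

  open RawRelation cosetGeometry using () renaming (_≈_ to _≈ᴳ_; _∼_ to _≤ᴳ_)

  incident-generated : ∀ {e} X → Incident e X → Generated e
  incident-generated (_ , _ , p) c = conn-generated c p

  incident-move : ∀ {e f} X → Conn (Avoid (rankᶠ X)) e f → Incident e X → Incident f X
  incident-move X c i = conn-trans i c

  incident-resp : ∀ {e X Y} → X ≈ᴳ Y → Incident e X → Incident e Y
  incident-resp (≡.refl , s) c = conn-trans (sub⇒conn s) c

  incident⇒≈ : ∀ {e} X Y → rankᶠ X ≡ rankᶠ Y → Incident e X → Incident e Y → X ≈ᴳ Y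
  incident⇒≈ X Y ≡.refl c d = ≡.refl , conn⇒sub (conn-trans d (conn-sym c))

  ≤⇒incident : ∀ {X Y} → X ≤ᴳ Y → ∃ λ e → Incident e X × Incident e Y
  ≤⇒incident (_ , x , s , t) = even x , sub⇒conn s , sub⇒conn t

  -- The cosets contain even flags only; an odd common flag is made even by a
  -- reflection in a third rank.
  incident⇒≤ : ∀ {e} X Y → rankᶠ X Fin.≤ rankᶠ Y → Incident e X → Incident e Y → X ≤ᴳ Y
  incident⇒≤ {even x} X Y r≤s c d = r≤s , x , conn⇒sub c , conn⇒sub d
  incident⇒≤ {odd x} X Y r≤s c d with third-rank (rankᶠ X) (rankᶠ Y)
  ... | m , p , q = r≤s , _
    , conn⇒sub (conn-trans c (conn-step m p)) , conn⇒sub (conn-trans d (conn-step m q))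

  faceAt : Fin 6 → ∀ e → Generated e → Face
  faceAt r (even x) p = r , x , p
  faceAt r (odd x)  p = r , _ , reflect-generated (proj₁ (third-rank r r)) (odd x) p

  faceAt-rank : ∀ r e p → rankᶠ (faceAt r e p) ≡ r
  faceAt-rank r (even x) p = ≡.refl
  faceAt-rank r (odd x)  p = ≡.refl

  faceAt-incident : ∀ r e p → Incident e (faceAt r e p)
  faceAt-incident r (even x) p = conn-refl
  faceAt-incident r (odd x)  p = conn-sym (conn-step _ (proj₁ (proj₂ (third-rank r r))))

  ≈-equivalence : IsEquivalence _≈ᴳ_
  ≈-equivalence = record
    { refl  = λ {X} → incident⇒≈ X X ≡.refl conn-refl conn-refl
    ; sym   = λ {X} {Y} e → incident⇒≈ Y X (≡.sym (proj₁ e)) (incident-resp {X = X} {Y = Y} e conn-refl) conn-refl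
    ; trans = λ {X} {Y} {Z} e e′ → incident⇒≈ X Z (≡.trans (proj₁ e) (proj₁ e′)) conn-refl
                (incident-resp {X = Y} {Y = Z} e′ (incident-resp {X = X} {Y = Y} e conn-refl))
    }

  <-rank : ∀ {X Y} → X < Y → rankᶠ X Fin.< rankᶠ Y
  <-rank {X} {Y} (le , ne) with ≤⇒incident {X} {Y} le
  ... | e , i , j = Fin.≤∧≢⇒< (proj₁ le) λ r≡s → ne (incident⇒≈ X Y r≡s i j)

  incident⇒< : ∀ {e} X Y → rankᶠ X Fin.< rankᶠ Y → Incident e X → Incident e Y → X < Y
  incident⇒< X Y r<s i j = incident⇒≤ X Y (ℕ.<⇒≤ r<s) i j , λ e → ℕ.<-irrefl (≡.cong toℕ (proj₁ e)) r<s

  module _ (r-comm : IsCommuting) where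
    open Commuting r-comm

    Below Above : Fin 6 → Pred (Fin 4) 0ℓ
    Below s m = toℕ (proper m) ℕ.< toℕ s
    Above s m = toℕ s ℕ.< toℕ (proper m)

    below-avoids : ∀ {s t m} → toℕ s ℕ.≤ toℕ t → Below s m → Avoid t m
    below-avoids s≤t lt ≡.refl = ℕ.<-irrefl ≡.refl (ℕ.<-≤-trans lt s≤t)

    above-avoids : ∀ {s t m} → toℕ t ℕ.≤ toℕ s → Above s m → Avoid t m
    above-avoids t≤s lt ≡.refl = ℕ.<-irrefl ≡.refl (ℕ.≤-<-trans t≤s lt)

    split : ∀ s {e f} → Conn (Avoid s) e f → ∃ λ g → Conn (Below s) e g × Conn (Above s) g f
    split s {e} {f} = go s
      where
      at : ∀ j → Conn (Avoid (proper j)) e f → ∃ λ g → Conn (Below (proper j)) e g × Conn (Above (proper j)) g f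
      at j p with conn-split j (weaken (λ ne e → ne (≡.cong proper e)) p)
      ... | g , lo , hi = g
        , weaken (λ {m} lt → ≡.subst₂ ℕ._<_ (≡.sym (toℕ-proper m)) (≡.sym (toℕ-proper j)) (ℕ.s≤s lt)) lo
        , weaken (λ {m} lt → ≡.subst₂ ℕ._<_ (≡.sym (toℕ-proper j)) (≡.sym (toℕ-proper m)) (ℕ.s≤s lt)) hi
      go : ∀ s → Conn (Avoid s) e f → ∃ λ g → Conn (Below s) e g × Conn (Above s) g f
      go 0F p = e , conn-refl , weaken (λ _ → ℕ.s≤s ℕ.z≤n) p
      go 1F p = at 0F p
      go 2F p = at 1F p
      go 3F p = at 2F p
      go 4F p = at 3F p
      go 5F p = f , weaken (λ {m} _ → ℕ.s≤s (≡.subst (ℕ._< 4) (≡.sym (toℕ-inject₁ m)) (toℕ<n m))) p , conn-refl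

    -- A flag through `X`, `Y` and one through `Y`, `Z` are joined without the rank of `Y`. At the
    -- flag between the low and the high steps, `X` is kept by the high ones and `Z` by the low
    -- ones.
    ≤-transitive : ∀ {X Y Z} → X ≤ᴳ Y → Y ≤ᴳ Z → X ≤ᴳ Z
    ≤-transitive {X} {Y} {Z} p q with ≤⇒incident {X} {Y} p | ≤⇒incident {Y} {Z} q
    ... | e , eX , eY | f , fY , fZ with split (rankᶠ Y) (conn-trans (conn-sym fY) eY)
    ... | g , lo , hi = incident⇒≤ X Z (ℕ.≤-trans (proj₁ p) (proj₁ q))
      (incident-move X (conn-sym (weaken (above-avoids (proj₁ p)) hi)) eX)
      (incident-move Z (weaken (below-avoids (proj₁ q)) lo) fZ)

    isPartialOrder : IsPartialOrder _≈ᴳ_ _≤ᴳ_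
    isPartialOrder = record
      { isPreorder = record
        { isEquivalence = ≈-equivalence
        ; reflexive = λ {X} {Y} e → incident⇒≤ X Y (ℕ.≤-reflexive (≡.cong toℕ (proj₁ e)))
                        conn-refl (incident-resp {X = X} {Y = Y} e conn-refl)
        ; trans = λ {X} {Y} {Z} → ≤-transitive {X} {Y} {Z}
        }
      ; antisym = λ {X} {Y} → antisym {X} {Y}
      }
      where
      antisym : ∀ {X Y} → X ≤ᴳ Y → Y ≤ᴳ X → X ≈ᴳ Y
      antisym {X} {Y} p q with ≤⇒incident {X} {Y} p
      ... | e , i , j = incident⇒≈ X Y (Fin.≤-antisym (proj₁ p) (proj₁ q)) i j

    HasCommonFlag : List Face → Set (c ⊔ ℓ)
    HasCommonFlag Xs = ∃ λ e → Generated e × All (Incident e) Xs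

    -- The argument for transitivity of the order, with all of `Ys` in the place of `Z`.
    extend : ∀ {X Y Ys} → X < Y → All (Y <_) Ys → HasCommonFlag (Y ∷ Ys) → HasCommonFlag (X ∷ Y ∷ Ys)
    extend {X} {Y} {Ys} X<Y Y<Ys (e , _ , eY ∷ eYs) = meet (≤⇒incident {X} {Y} (proj₁ X<Y))
      where
      meet : (∃ λ f → Incident f X × Incident f Y) → HasCommonFlag (X ∷ Y ∷ Ys)
      meet (f , fX , fY) with split (rankᶠ Y) (conn-trans (conn-sym eY) fY)
      ... | g , lo , hi = g , incident-generated X gX , gX
        ∷ incident-move Y (weaken (below-avoids ℕ.≤-refl) lo) eY
        ∷ All.zipWith (λ {Z} (lt , i) → incident-move Z (weaken (below-avoids (proj₁ (proj₁ lt))) lo) i)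
                      (Y<Ys , eYs)
        where
        gX : Incident g X
        gX = incident-move X (conn-sym (weaken (above-avoids (proj₁ (proj₁ X<Y))) hi)) fX

    commonFlag : ∀ {Xs} → AllPairs _<_ Xs → HasCommonFlag Xs
    commonFlag [] = even ε , unit , []
    commonFlag {X ∷ []} _ = even _ , proj₂ (proj₂ X) , conn-refl ∷ []
    commonFlag {X ∷ Y ∷ Ys} ((X<Y ∷ _) ∷ inc@(Y<Ys ∷ _)) = extend X<Y Y<Ys (commonFlag inc)

    Spans : RFlag → Flag → Set (c ⊔ ℓ)
    Spans e Φ = Generated e × (∀ X → X ∈ faces Φ ⇔ Incident e X)

    comparable : ∀ {e} X Y → Incident e X → Incident e Y → X ≤ᴳ Y ⊎ Y ≤ᴳ X
    comparable X Y i j with Fin.≤-total (rankᶠ X) (rankᶠ Y)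
    ... | inj₁ le = inj₁ (incident⇒≤ X Y le i j)
    ... | inj₂ le = inj₂ (incident⇒≤ Y X le j i)

    ∈-incident : ∀ {e} X {Ys} → All (Incident e) Ys → X ∈ Ys → Incident e X
    ∈-incident X (i ∷ _) (here {Y} p) = incident-resp {X = Y} {Y = X} (IsEquivalence.sym ≈-equivalence {X} {Y} p) i
    ∈-incident X (_ ∷ is) (there p) = ∈-incident X is p

    -- A face incident with the common flag `e` is comparable with every face of `Φ`, so maximality
    -- puts it into `Φ`.
    spanning : ∀ Φ → ∃ λ e → Spans e Φ
    spanning Φ with commonFlag (chain Φ)
    ... | e , p , is = e , p , λ X → mk⇔ (∈-incident X is)
      (λ i → maximal Φ X λ Y Y∈ → comparable X Y i (∈-incident Y is Y∈))

    flagOf : ∀ e → Generated e → Flag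
    flagOf e p = record
      { faces   = tabulate (λ r → faceAt r e p)
      ; chain   = AllPairs.tabulate⁺-< {f = λ r → faceAt r e p} λ {r} {s} r<s →
          incident⇒< (faceAt r e p) (faceAt s e p)
            (≡.subst₂ Fin._<_ (≡.sym (faceAt-rank r e p)) (≡.sym (faceAt-rank s e p)) r<s)
            (faceAt-incident r e p) (faceAt-incident s e p)
      ; maximal = λ X comp → close X (comp (faceAt (rankᶠ X) e p) (own (rankᶠ X)))
      }
      where
      at : ∀ r X → X ≈ᴳ faceAt r e p → X ∈ tabulate (λ r → faceAt r e p)
      at r X q = Any.map (λ { {Y} ≡.refl → q }) (∈-tabulate⁺ {f = λ r → faceAt r e p} r)
      own : ∀ r → faceAt r e p ∈ tabulate (λ r → faceAt r e p)
      own r = at r (faceAt r e p) (IsEquivalence.refl ≈-equivalence {faceAt r e p})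
      close : ∀ X → let Y = faceAt (rankᶠ X) e p in X ≤ᴳ Y ⊎ Y ≤ᴳ X → X ∈ tabulate (λ r → faceAt r e p)
      close X (inj₁ le) with ≤⇒incident {X} {faceAt (rankᶠ X) e p} le
      ... | _ , i , j = at _ X (incident⇒≈ X (faceAt (rankᶠ X) e p) (≡.sym (faceAt-rank _ e p)) i j)
      close X (inj₂ le) with ≤⇒incident {faceAt (rankᶠ X) e p} {X} le
      ... | _ , j , i = at _ X (incident⇒≈ X (faceAt (rankᶠ X) e p) (≡.sym (faceAt-rank _ e p)) i j)

    flagOf-spans : ∀ e p → Spans e (flagOf e p)
    flagOf-spans e p = p , λ X → mk⇔
      (λ X∈ → ∈-incident X (All.tabulate λ {Y} Y∈ → inc Y Y∈) X∈)
      (λ i → Any.map (λ { ≡.refl → incident⇒≈ X (faceAt (rankᶠ X) e p) (≡.sym (faceAt-rank _ e p))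
                                     i (faceAt-incident _ e p) })
                     (∈-tabulate⁺ {f = λ r → faceAt r e p} (rankᶠ X)))
      where
      inc : ∀ Y → Y ∈ᴾ faces (flagOf e p) → Incident e Y
      inc Y Y∈ with ∈-tabulate⁻ {f = λ r → faceAt r e p} Y∈
      ... | r , ≡.refl = faceAt-incident r e p

    -- Ranks are distinct along a chain, which bounds the length by six, and `e` contributes a face
    -- of each rank.
    spans-length : ∀ {e} Φ → Spans e Φ → length (faces Φ) ≡ 6
    spans-length {e} Φ (p , sp) = ℕ.≤-antisym
      (Fin.injective⇒≤ {f = rankᶠ ∘ lookup (faces Φ)}
        (allPairs-lookup-injective {_≋_ = λ X Y → rankᶠ X ≡ rankᶠ Y} ≡.sym
          (λ {X} {Y} lt → Fin.<⇒≢ (<-rank {X} {Y} lt)) (chain Φ)))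
      (Fin.injective⇒≤ {f = position} λ {r} {s} eq →
        ≡.trans (≡.sym (position-rank r)) (≡.trans (≡.cong (rankᶠ ∘ lookup (faces Φ)) eq) (position-rank s)))
      where
      member : ∀ r → faceAt r e p ∈ faces Φ
      member r = Equivalence.from (sp (faceAt r e p)) (faceAt-incident r e p)
      position : Fin 6 → Fin (length (faces Φ))
      position r = Any.index (member r)
      position-rank : ∀ r → rankᶠ (lookup (faces Φ) (position r)) ≡ r
      position-rank r = ≡.trans (≡.sym (proj₁ (lookup-index (member r)))) (faceAt-rank r e p)

    -- The diamond condition and strong flag-connectedness

    module _ (free : IsFacewiseFree) (separating : IsSeparating)
             (conn? : ∀ j e f → Dec (Conn (Except j) e f)) where

      -- `Conn (Except j) e f` means that `e` and `f` have the same `j`-face, so the path obtained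
      -- changes no common face.
      conn-uncommon : ∀ {e f} → Generated e → Generated f → Conn (λ j → ¬ Conn (Except j) e f) e f
      conn-uncommon {e} {f} p q =
        conn-free separating (λ j → conn? j e f) id (generated⇒conn p q)

      avoid-proper : ∀ {j m} → Avoid (proper j) m → Except j m
      avoid-proper av e = av (≡.cong proper e)

      proper-avoid : ∀ {j m} → Except j m → Avoid (proper j) m
      proper-avoid ne e = ne (proper-injective e)

      reflect-incident : ∀ {e} j X → proper j ≢ rankᶠ X → Incident e X → Incident (reflect j e) X
      reflect-incident j X ne i = incident-move X (conn-step j ne) i

      not-incident : ∀ {e} j X → rankᶠ X ≡ proper j → Incident e X → ¬ Incident (reflect j e) X
      not-incident {e} j (_ , _) ≡.refl i i′ = free j e (weaken avoid-proper (conn-trans (conn-sym i) i′))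

      diamond : ∀ (j : Fin 4) X Y → X < Y → toℕ (rankᶠ X) ≡ toℕ j → toℕ (rankᶠ Y) ≡ 2 ℕ.+ toℕ j →
                ∃ λ H₁ → ∃ λ H₂ →
                  (rankᶠ H₁ ≡ proper j × X < H₁ × H₁ < Y) ×
                  (rankᶠ H₂ ≡ proper j × X < H₂ × H₂ < Y) ×
                  ¬ (H₁ ≈ᴳ H₂) ×
                  (∀ H → rankᶠ H ≡ proper j → X < H → H < Y → H ≈ᴳ H₁ ⊎ H ≈ᴳ H₂)
      diamond j X Y X<Y rX rY = between (≤⇒incident {X} {Y} (proj₁ X<Y))
        where
        X-low : rankᶠ X Fin.< proper j
        X-low = ≡.subst₂ ℕ._<_ (≡.sym rX) (≡.sym (toℕ-proper j)) ℕ.≤-refl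
        Y-high : proper j Fin.< rankᶠ Y
        Y-high = ≡.subst₂ ℕ._<_ (≡.sym (toℕ-proper j)) (≡.sym rY) ℕ.≤-refl
        Between : Face → Set (c ⊔ ℓ)
        Between H = rankᶠ H ≡ proper j × X < H × H < Y
        faceBetween : ∀ {e} → Incident e X → Incident e Y → ∃ λ H → Between H × Incident e H
        faceBetween {e} eX eY = H , (rH
            , incident⇒< X H (≡.subst (rankᶠ X Fin.<_) (≡.sym rH) X-low) eX eH
            , incident⇒< H Y (≡.subst (Fin._< rankᶠ Y) (≡.sym rH) Y-high) eH eY) , eH
          where
          p = incident-generated X eX
          H = faceAt (proper j) e p
          rH = faceAt-rank (proper j) e p
          eH = faceAt-incident (proper j) e p
        move : ∀ {e f} H → rankᶠ H ≡ proper j → Conn (Except j) e f → Incident e H → Incident f H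
        move H rH c = incident-move H (weaken (≡.subst (λ r → Avoid r _) (≡.sym rH) ∘ proper-avoid) c)
        between : (∃ λ e → Incident e X × Incident e Y) → ∃ λ H₁ → ∃ λ H₂ →
                  Between H₁ × Between H₂ × ¬ (H₁ ≈ᴳ H₂) ×
                  (∀ H → rankᶠ H ≡ proper j → X < H → H < Y → H ≈ᴳ H₁ ⊎ H ≈ᴳ H₂)
        between (e , eX , eY)
          with faceBetween eX eY
             | faceBetween (reflect-incident j X (Fin.<⇒≢ X-low ∘ ≡.sym) eX)
                           (reflect-incident j Y (Fin.<⇒≢ Y-high) eY)
        ... | H₁ , b₁ , e₁ | H₂ , b₂ , e₂ = H₁ , H₂ , b₁ , b₂ , distinct , only
          where
          distinct : ¬ (H₁ ≈ᴳ H₂)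
          distinct eq = not-incident j H₂ (proj₁ b₂) (incident-resp {X = H₁} {Y = H₂} eq e₁) e₂
          only : ∀ H → rankᶠ H ≡ proper j → X < H → H < Y → H ≈ᴳ H₁ ⊎ H ≈ᴳ H₂
          only H rH X<H H<Y with commonFlag {X ∷ H ∷ Y ∷ []} ((X<H ∷ X<Y ∷ []) ∷ (H<Y ∷ []) ∷ [] ∷ [])
          -- `X` and `Y` belong to both flags, so the path has no rank next to `j`, and `f` has the
          -- `j`-face of `e` or that of `reflect j e`.
          ... | f , pf , fX ∷ fH ∷ fY ∷ [] with conn-around j far (conn-uncommon (incident-generated X eX) pf)
            where
            common : ∀ {m} Z → rankᶠ Z ≡ proper m → Incident e Z → Incident f Z → Conn (Except m) e f
            common Z rZ eZ fZ =
              weaken (λ av eq → av (≡.trans (≡.cong proper eq) (≡.sym rZ))) (conn-trans (conn-sym eZ) fZ)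
            far : ∀ {m} → ¬ Conn (Except m) e f → suc (toℕ m) ≢ toℕ j × suc (toℕ j) ≢ toℕ m
            far {m} uncommon =
                -- `rankᶠ` is the rank plus one: `X` has `rankᶠ` equal to `j`, so it is the face of
                -- rank `m` = j - 1.
                (λ eq → uncommon (common X (toℕ-injective
                  (≡.trans rX (≡.trans (≡.sym eq) (≡.sym (toℕ-proper m))))) eX fX))
              , (λ eq → uncommon (common Y (toℕ-injective
                  (≡.trans rY (≡.trans (≡.cong suc eq) (≡.sym (toℕ-proper m))))) eY fY))
          ... | inj₁ d = inj₁ (incident⇒≈ H H₁ (≡.trans rH (≡.sym (proj₁ b₁))) fH (move H₁ (proj₁ b₁) d e₁))
          ... | inj₂ d = inj₂ (incident⇒≈ H H₂ (≡.trans rH (≡.sym (proj₁ b₂))) fH (move H₂ (proj₁ b₂) d e₂))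

      open Adjacency rankᶠ

      spans-adjacent : ∀ {e} j Θ Θ′ → Spans e Θ → Spans (reflect j e) Θ′ → Θ ~[ proper j ] Θ′
      spans-adjacent {e} j Θ Θ′ (p , sp) (_ , sp′) =
          (λ X ne → mk⇔
            (λ X∈ → Equivalence.from (sp′ X) (reflect-incident j X (ne ∘ ≡.sym) (Equivalence.to (sp X) X∈)))
            (λ X∈ → Equivalence.from (sp X) (incident-move X
                      (step j (ne ∘ ≡.sym) (done (r-involutive j e))) (Equivalence.to (sp′ X) X∈))))
        , λ eq → let X = faceAt (proper j) e p ; eX = faceAt-incident (proper j) e p in
            not-incident j X (faceAt-rank (proper j) e p) eX
              (Equivalence.to (sp′ X) (Equivalence.to (eq X) (Equivalence.from (sp X) eX)))

      stronglyFlagConnected :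
        ∀ (Φ Ψ : Flag) →
        let Step = λ Θ Θ′ → Adjacent Θ Θ′ × (∀ X → X ∈ faces Φ → X ∈ faces Ψ → X ∈ faces Θ′)
        in ∃ λ Ψ′ → Star Step Φ Ψ′ × Ψ′ ≐ Ψ
      stronglyFlagConnected Φ Ψ = connect (spanning Φ) (spanning Ψ)
        where
        Step : Flag → Flag → Set (c ⊔ ℓ)
        Step Θ Θ′ = Adjacent Θ Θ′ × (∀ X → X ∈ faces Φ → X ∈ faces Ψ → X ∈ faces Θ′)
        connect : (∃ λ e → Spans e Φ) → (∃ λ f → Spans f Ψ) → ∃ λ Ψ′ → Star Step Φ Ψ′ × Ψ′ ≐ Ψ
        connect (e , p , sp) (f , q , sq) =
          walk (conn-uncommon p q) Φ (p , sp) (λ X X∈ _ → Equivalence.to (sp X) X∈)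
          where
          walk : ∀ {g} → Conn (λ j → ¬ Conn (Except j) e f) g f → ∀ Θ → Spans g Θ →
                 (∀ X → X ∈ faces Φ → X ∈ faces Ψ → Incident g X) → ∃ λ Ψ′ → Star Step Θ Ψ′ × Ψ′ ≐ Ψ
          walk (done g≈f) Θ (_ , sg) _ = Θ , [-] , λ X → mk⇔
            (λ X∈ → Equivalence.from (sq X) (incident-move X (done g≈f) (Equivalence.to (sg X) X∈)))
            (λ X∈ → Equivalence.from (sg X)
                      (incident-move X (done (FlagGraph.sym graph g≈f)) (Equivalence.to (sq X) X∈)))
          walk {g} (step j uncommon d) Θ sg@(pg , _) keep =
            let Ψ′ , path , eq = walk d Θ′ sΘ′ keep′
            in Ψ′ , ((proper j , spans-adjacent j Θ Θ′ sg sΘ′)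
                    , λ X X∈ X∈′ → Equivalence.from (proj₂ sΘ′ X) (keep′ X X∈ X∈′)) ◅ path , eq
            where
            pg′ = reflect-generated j g pg
            Θ′ = flagOf (reflect j g) pg′
            sΘ′ = flagOf-spans (reflect j g) pg′
            keep′ : ∀ X → X ∈ faces Φ → X ∈ faces Ψ → Incident (reflect j g) X
            keep′ X X∈ X∈′ = reflect-incident j X
              -- If the rank of the common face `X` were `j`, then `j` would be a common rank, but
              -- the path uses uncommon ranks only.
              (λ eq → uncommon (weaken (λ av eq′ → av (≡.trans (≡.cong proper eq′) eq))
                (conn-trans (conn-sym (Equivalence.to (sp X) X∈)) (Equivalence.to (sq X) X∈′))))
              (keep X X∈ X∈′)

      polytopal : Polytopal A
      polytopal = record
        { isPartialOrder = isPartialOrder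
        ; rank = rankᶠ
        ; rank-cong = proj₁
        ; rank-mono = λ {X} {Y} → <-rank {X} {Y}
        ; least = 0F , ε , unit
        ; least-min = λ X → incident⇒≤ (0F , ε , unit) X ℕ.z≤n
            (weaken (λ _ ()) (generated⇒conn unit (proj₂ (proj₂ X)))) conn-refl
        ; rank-least = ≡.refl
        ; greatest = 5F , ε , unit
        ; greatest-max = λ X → incident⇒≤ X (5F , ε , unit) (ℕ.≤-pred (toℕ<n (rankᶠ X)))
            conn-refl (weaken (λ {m} _ → not-greatest m) (generated⇒conn unit (proj₂ (proj₂ X))))
        ; rank-greatest = ≡.refl
        ; flag-length = λ Φ → spans-length Φ (proj₂ (spanning Φ))
        ; diamond = diamond
        ; stronglyFlagConnected = stronglyFlagConnected
        }
        where
        not-greatest : ∀ m → Avoid 5F m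
        not-greatest m eq = ℕ.<-irrefl (≡.cong ℕ.pred (≡.trans (≡.sym (toℕ-proper m)) (≡.cong toℕ eq))) (toℕ<n m)

-- Flags of a finite polytope

module FlagCalculus {c ℓ₁ ℓ₂} (P : Polytope 4 c ℓ₁ ℓ₂) (finite : Polytope.IsFinite P) where
  open Polytope P
  open Poset poset using (module Eq; antisym; reflexive; ≤-respˡ-≈; ≤-respʳ-≈) renaming (trans to ≤-trans)
  open Symmetry P using (Γ; Maps)
  open BaseFaces P using (face; face-∈; face-rank; rank-unique; rank-preserved; to-strict) renaming (weaken to ∈ᴾ⇒∈)
  open Automorphism

  _≤?_ : ∀ x y → Dec (x ≤ y)
  _≤?_ = proj₂ finite

  _≈?_ : ∀ x y → Dec (x ≈ y)
  x ≈? y = Dec.map′ (λ (p , q) → antisym p q) (λ e → reflexive e , reflexive (Eq.sym e))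
                    ((x ≤? y) ×-dec (y ≤? x))

  size : ℕ
  size = proj₁ (proj₁ finite)

  enumerate : Fin size → Carrier
  enumerate = proj₁ (proj₂ (proj₁ finite))

  enumerate-surjective : ∀ x → ∃ λ i → ∀ {i′} → i′ ≡ i → enumerate i′ ≈ x
  enumerate-surjective = proj₂ (proj₂ (proj₂ (proj₁ finite)))

  <-trans : ∀ {x y z} → x < y → y < z → x < z
  <-trans (p , x≉y) (q , y≉z) = ≤-trans p q , λ e → x≉y (antisym p (≤-respʳ-≈ (Eq.sym e) q))

  ≤-rank⇒≈ : ∀ {x y} → x ≤ y → rank x ≡ rank y → x ≈ y
  ≤-rank⇒≈ {x} {y} le r = decidable-stable (x ≈? y) λ ne → Fin.<⇒≢ (rank-mono (le , ne)) r

  Comparable : Carrier → Carrier → Set ℓ₂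
  Comparable x y = x ≤ y ⊎ y ≤ x

  ∈-resp : ∀ {x y xs} → x ≈ y → y ∈ xs → x ∈ xs
  ∈-resp e = Any.map (Eq.trans e)

  private
    insert : Carrier → List Carrier → List Carrier
    insert y [] = [ y ]
    insert y (x ∷ xs) with y ≤? x
    ... | yes _ = y ∷ x ∷ xs
    ... | no  _ = x ∷ insert y xs

    insert-∈ : ∀ y xs → y ∈ insert y xs
    insert-∈ y [] = here Eq.refl
    insert-∈ y (x ∷ xs) with y ≤? x
    ... | yes _ = here Eq.refl
    ... | no  _ = there (insert-∈ y xs)

    insert-⊇ : ∀ y {xs x} → x ∈ xs → x ∈ insert y xs
    insert-⊇ y {x ∷ xs} p with y ≤? x | p
    ... | yes _ | q       = there q
    ... | no  _ | here e  = here e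
    ... | no  _ | there q = there (insert-⊇ y q)

    insert-all : ∀ {p} {Q : Pred Carrier p} {y xs} → Q y → All Q xs → All Q (insert y xs)
    insert-all q [] = q ∷ []
    insert-all {y = y} {x ∷ xs} q (p ∷ ps) with y ≤? x
    ... | yes _ = q ∷ p ∷ ps
    ... | no  _ = p ∷ insert-all q ps

    insert-chain : ∀ {y xs} → AllPairs _<_ xs → All (Comparable y) xs → ¬ y ∈ xs → AllPairs _<_ (insert y xs)
    insert-chain [] [] _ = [] ∷ []
    insert-chain {y} {x ∷ xs} (lt ∷ inc) (cmp ∷ cmps) y∉ with y ≤? x | cmp
    ... | yes y≤x | _        = let y<x = y≤x , y∉ ∘ here in (y<x ∷ All.map (<-trans y<x) lt) ∷ lt ∷ inc
    ... | no  y≰x | inj₁ y≤x = ⊥-elim (y≰x y≤x)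
    ... | no  y≰x | inj₂ x≤y = insert-all (x≤y , y∉ ∘ here ∘ Eq.sym) lt ∷ insert-chain inc cmps (y∉ ∘ there)

    comparable? : ∀ x y → Dec (Comparable x y)
    comparable? x y = (x ≤? y) ⊎-dec (y ≤? x)

    ComparableToAll : Carrier → List Carrier → Set (c ⊔ ℓ₁ ⊔ ℓ₂)
    ComparableToAll x ys = ∀ y → y ∈ ys → Comparable x y

    -- Greedy extension: a rejected face fails to be comparable with some face that stays in the
    -- chain, so no face of `es` comparable with the whole final chain is missing.
    grow : ∀ es {xs} → AllPairs _<_ xs → ∃ λ ys → AllPairs _<_ ys × (∀ {x} → x ∈ xs → x ∈ ys) ×
           (∀ {e} → e ∈ᴾ es → ComparableToAll e ys → e ∈ ys)
    grow [] {xs} inc = xs , inc , id , λ ()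
    grow (e ∷ es) {xs} inc with Any.any? (e ≈?_) xs | All.all? (comparable? e) xs
    ... | yes e∈ | _ with grow es inc
    ...   | ys , inc′ , ⊇ , full = ys , inc′ , ⊇ , λ where
            (here ≡.refl) _ → ⊇ e∈
            (there p)     → full p
    grow (e ∷ es) {xs} inc | no e∉ | yes cmp with grow es (insert-chain inc cmp e∉)
    ...   | ys , inc′ , ⊇ , full = ys , inc′ , ⊇ ∘ insert-⊇ e , λ where
            (here ≡.refl) _ → ⊇ (insert-∈ e xs)
            (there p)     → full p
    grow (e ∷ es) {xs} inc | no e∉ | no ¬cmp with grow es inc
    ...   | ys , inc′ , ⊇ , full = ys , inc′ , ⊇ , λ where
            (here ≡.refl) cmp → ⊥-elim (¬cmp (All.tabulate λ {y} y∈ → cmp y (⊇ (∈ᴾ⇒∈ y∈))))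
            (there p)     → full p

  flagThrough : ∀ x → ∃ λ (Ψ : Flag) → x ∈ faces Ψ
  flagThrough x with grow (tabulate enumerate) {[ x ]} ([] ∷ [])
  ... | ys , inc , ⊇ , full = record { faces = ys ; chain = inc ; maximal = max } , ⊇ (here Eq.refl)
    where
    max : ∀ z → ComparableToAll z ys → z ∈ ys
    max z cmp with enumerate-surjective z
    ... | i , fi = ∈-resp (Eq.sym (fi ≡.refl)) (full (∈-tabulate⁺ i) cmp′)
      where
      cmp′ : ComparableToAll (enumerate i) ys
      cmp′ y y∈ with cmp y y∈
      ... | inj₁ z≤y = inj₁ (≤-respˡ-≈ (Eq.sym (fi ≡.refl)) z≤y)
      ... | inj₂ y≤z = inj₂ (≤-respʳ-≈ (Eq.sym (fi ≡.refl)) y≤z)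

  ∈⇒≈ : ∀ Ψ {x} → x ∈ faces Ψ → x ≈ face Ψ (rank x)
  ∈⇒≈ Ψ x∈ = rank-unique (chain Ψ) x∈ (∈ᴾ⇒∈ (face-∈ Ψ _)) (≡.sym (face-rank Ψ _))

  rank-to : ∀ (γ : Automorphism poset) x → rank (to γ x) ≡ rank x
  rank-to γ x with flagThrough x
  ... | Ψ , x∈ = ≡.trans (rank-cong (to-cong γ (∈⇒≈ Ψ x∈)))
    (≡.trans (rank-preserved γ Ψ (face-∈ Ψ _)) (≡.sym (rank-cong (∈⇒≈ Ψ x∈))))

  -- Faces are indexed by rank instead of listed, so that adjacency, images and equality of flags
  -- can be examined one rank at a time.
  record RankedFlag : Set (c ⊔ ℓ₁ ⊔ ℓ₂) where
    field
      at      : Fin 6 → Carrier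
      at-rank : ∀ j → rank (at j) ≡ j
      at-mono : ∀ {i j} → i Fin.< j → at i < at j
  open RankedFlag public

  infix 4 _≑_
  _≑_ : RankedFlag → RankedFlag → Set ℓ₁
  φ ≑ ψ = ∀ j → at φ j ≈ at ψ j

  private
    chain-< : ∀ {xs u v} → AllPairs _<_ xs → u ∈ᴾ xs → v ∈ᴾ xs → rank u Fin.< rank v → u < v
    chain-< _         (here ≡.refl) (here ≡.refl) r = ⊥-elim (Fin.<-irrefl ≡.refl r)
    chain-< (lt ∷ _)  (here ≡.refl) (there q)     r = All.lookup lt q
    chain-< (lt ∷ _)  (there p)     (here ≡.refl) r = ⊥-elim (Fin.<-asym r (rank-mono (All.lookup lt p)))
    chain-< (_ ∷ inc) (there p)     (there q)     r = chain-< inc p q r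

  ranked : Flag → RankedFlag
  ranked Ψ = record
    { at = face Ψ
    ; at-rank = face-rank Ψ
    ; at-mono = λ {i} {j} i<j → chain-< (chain Ψ) (face-∈ Ψ i) (face-∈ Ψ j)
        (≡.subst₂ Fin._<_ (≡.sym (face-rank Ψ i)) (≡.sym (face-rank Ψ j)) i<j)
    }

  ≈⇒∈ : ∀ Ψ {x j} → x ≈ face Ψ j → x ∈ faces Ψ
  ≈⇒∈ Ψ e = ∈-resp e (∈ᴾ⇒∈ (face-∈ Ψ _))

  ∈⇒≈-at : ∀ Ψ {x j} → rank x ≡ j → x ∈ faces Ψ → x ≈ face Ψ j
  ∈⇒≈-at Ψ ≡.refl = ∈⇒≈ Ψ

  toFlag : ∀ φ → ∃ λ (Ψ : Flag) → ranked Ψ ≑ φ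
  toFlag φ = Ψ , λ j → close j
    where
    Ψ : Flag
    Ψ = record
      { faces = tabulate (at φ)
      ; chain = AllPairs.tabulate⁺-< (at-mono φ)
      ; maximal = λ x cmp → Any.map
          (λ { ≡.refl → max x (cmp _ (∈ᴾ⇒∈ (∈-tabulate⁺ {f = at φ} (rank x)))) })
          (∈-tabulate⁺ {f = at φ} (rank x))
      }
      where
      max : ∀ x → Comparable x (at φ (rank x)) → x ≈ at φ (rank x)
      max x (inj₁ le) = ≤-rank⇒≈ le (≡.sym (at-rank φ _))
      max x (inj₂ ge) = Eq.sym (≤-rank⇒≈ ge (at-rank φ _))
    close : ∀ j → face Ψ j ≈ at φ j
    close j = Eq.sym (∈⇒≈-at Ψ (at-rank φ j) (∈ᴾ⇒∈ (∈-tabulate⁺ {f = at φ} j)))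

  image : Automorphism poset → RankedFlag → RankedFlag
  image γ φ = record
    { at = to γ ∘ at φ
    ; at-rank = λ j → ≡.trans (rank-to γ _) (at-rank φ j)
    ; at-mono = to-strict γ ∘ at-mono φ
    }

  maps⇒≑ : ∀ γ Φ Ψ → Maps γ Φ Ψ → image γ (ranked Φ) ≑ ranked Ψ
  maps⇒≑ γ Φ Ψ m j =
    ∈⇒≈-at Ψ (≡.trans (rank-to γ _) (face-rank Φ j)) (Equivalence.to (m _) (∈ᴾ⇒∈ (face-∈ Φ j)))

  ≑⇒maps : ∀ γ Φ Ψ → image γ (ranked Φ) ≑ ranked Ψ → Maps γ Φ Ψ
  ≑⇒maps γ Φ Ψ e x = mk⇔
    (λ x∈ → ≈⇒∈ Ψ (Eq.trans (to-cong γ (∈⇒≈ Φ x∈)) (e (rank x))))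
    (λ γx∈ → ≈⇒∈ Φ (to-injective γ (Eq.trans (∈⇒≈-at Ψ (rank-to γ x) γx∈) (Eq.sym (e (rank x))))))

  record Neighbours (j : Fin 6) (φ ψ : RankedFlag) : Set (ℓ₁) where
    constructor neighbours
    field
      agree  : ∀ i → i ≢ j → at φ i ≈ at ψ i
      differ : ¬ at φ j ≈ at ψ j
  open Neighbours public

  neighbours-sym : ∀ {j φ ψ} → Neighbours j φ ψ → Neighbours j ψ φ
  neighbours-sym (neighbours a d) = neighbours (λ i ne → Eq.sym (a i ne)) (d ∘ Eq.sym)

  neighbours-resp : ∀ {j φ φ′ ψ ψ′} → φ ≑ φ′ → ψ ≑ ψ′ → Neighbours j φ ψ → Neighbours j φ′ ψ′
  neighbours-resp e e′ (neighbours a d) = neighbours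
    (λ i ne → Eq.trans (Eq.sym (e i)) (Eq.trans (a i ne) (e′ i)))
    (λ q → d (Eq.trans (e _) (Eq.trans q (Eq.sym (e′ _)))))

  image-neighbours : ∀ γ {j φ ψ} → Neighbours j φ ψ → Neighbours j (image γ φ) (image γ ψ)
  image-neighbours γ (neighbours a d) = neighbours (λ i ne → to-cong γ (a i ne)) (d ∘ to-injective γ)

  adjacent⇒neighbours : ∀ Φ Ψ j → Φ ~[ j ] Ψ → Neighbours j (ranked Φ) (ranked Ψ)
  adjacent⇒neighbours Φ Ψ j (same , ≠) = neighbours agree′ differ′
    where
    agree′ : ∀ i → i ≢ j → face Φ i ≈ face Ψ i
    agree′ i ne = ∈⇒≈-at Ψ (face-rank Φ i)
      (Equivalence.to (same _ (ne ∘ ≡.trans (≡.sym (face-rank Φ i)))) (∈ᴾ⇒∈ (face-∈ Φ i)))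
    differ′ : ¬ face Φ j ≈ face Ψ j
    differ′ e = ≠ λ x → mk⇔ (λ x∈ → ≈⇒∈ Ψ (Eq.trans (∈⇒≈ Φ x∈) (eq (rank x))))
                            (λ x∈ → ≈⇒∈ Φ (Eq.trans (∈⇒≈ Ψ x∈) (Eq.sym (eq (rank x)))))
      where
      eq : ∀ i → face Φ i ≈ face Ψ i
      eq i with i Fin.≟ j
      ... | yes ≡.refl = e
      ... | no  ne     = agree′ i ne

  -- The faces of the two improper ranks are the same in all flags.
  neighbours-proper : ∀ {φ ψ} j → Neighbours j φ ψ → ∃ λ i → j ≡ proper i
  neighbours-proper {φ} {ψ} 0F n = ⊥-elim (differ n (Eq.trans (Eq.sym (bottom φ)) (bottom ψ)))
    where
    bottom : ∀ φ → least ≈ at φ 0F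
    bottom φ = ≤-rank⇒≈ (least-min _) (≡.trans rank-least (≡.sym (at-rank φ 0F)))
  neighbours-proper 1F _ = 0F , ≡.refl
  neighbours-proper 2F _ = 1F , ≡.refl
  neighbours-proper 3F _ = 2F , ≡.refl
  neighbours-proper 4F _ = 3F , ≡.refl
  neighbours-proper {φ} {ψ} 5F n = ⊥-elim (differ n (Eq.trans (top φ) (Eq.sym (top ψ))))
    where
    top : ∀ φ → at φ 5F ≈ greatest
    top φ = ≤-rank⇒≈ (greatest-max _) (≡.trans (at-rank φ 5F) (≡.sym rank-greatest))

  lower upper : Fin 4 → Fin 6
  lower j = inject₁ (inject₁ j)
  upper j = suc (suc j)

  private
    third : ∀ {H₁ H₂ x y z} → x ≈ H₁ ⊎ x ≈ H₂ → y ≈ H₁ ⊎ y ≈ H₂ → z ≈ H₁ ⊎ z ≈ H₂ →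
            ¬ x ≈ y → ¬ x ≈ z → y ≈ z
    third (inj₁ p) (inj₁ q) _        x≉y _   = ⊥-elim (x≉y (Eq.trans p (Eq.sym q)))
    third (inj₂ p) (inj₂ q) _        x≉y _   = ⊥-elim (x≉y (Eq.trans p (Eq.sym q)))
    third (inj₁ p) (inj₂ _) (inj₁ s) _   x≉z = ⊥-elim (x≉z (Eq.trans p (Eq.sym s)))
    third (inj₂ p) (inj₁ _) (inj₂ s) _   x≉z = ⊥-elim (x≉z (Eq.trans p (Eq.sym s)))
    third (inj₁ _) (inj₂ q) (inj₂ s) _   _   = Eq.trans q (Eq.sym s)
    third (inj₂ _) (inj₁ q) (inj₁ s) _   _   = Eq.trans q (Eq.sym s)

    <-resp : ∀ {x x′ y y′} → x ≈ x′ → y ≈ y′ → x < y → x′ < y′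
    <-resp e e′ (le , ne) = ≤-respˡ-≈ e (≤-respʳ-≈ e′ le) , λ q → ne (Eq.trans e (Eq.trans q (Eq.sym e′)))

  private
    toℕ-lower : ∀ j → toℕ (lower j) ≡ toℕ j
    toℕ-lower j = ≡.trans (toℕ-inject₁ _) (toℕ-inject₁ j)

    lower<proper : ∀ j → lower j Fin.< proper j
    lower<proper j = ≡.subst₂ ℕ._<_ (≡.sym (toℕ-lower j)) (≡.sym (toℕ-proper j)) ℕ.≤-refl

    proper<upper : ∀ j → proper j Fin.< upper j
    proper<upper j = ≡.subst (ℕ._< toℕ (upper j)) (≡.sym (toℕ-proper j)) ℕ.≤-refl

  lower≢proper : ∀ j → lower j ≢ proper j
  lower≢proper j = Fin.<⇒≢ (lower<proper j)

  upper≢proper : ∀ j → upper j ≢ proper j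
  upper≢proper j = Fin.<⇒≢ (proper<upper j) ∘ ≡.sym

  -- The diamond has two faces in the middle, so whatever differs from the one in `φ` is the other.
  -- Only three faces of each flag matter, which allows comparing flags that are not known to be
  -- adjacent.
  diamond-unique : ∀ j φ ψ χ →
    at φ (lower j) ≈ at ψ (lower j) → at φ (upper j) ≈ at ψ (upper j) →
    at φ (lower j) ≈ at χ (lower j) → at φ (upper j) ≈ at χ (upper j) →
    ¬ at φ (proper j) ≈ at ψ (proper j) → ¬ at φ (proper j) ≈ at χ (proper j) →
    at ψ (proper j) ≈ at χ (proper j)
  diamond-unique j φ ψ χ lψ uψ lχ uχ φ≉ψ φ≉χ
    with diamond j (at φ (lower j)) (at φ (upper j))
           (at-mono φ (ℕ.<-trans (lower<proper j) (proper<upper j)))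
           (≡.trans (≡.cong toℕ (at-rank φ _)) (toℕ-lower j)) (≡.cong toℕ (at-rank φ _))
  ... | H₁ , H₂ , _ , _ , _ , only = third
      (between φ Eq.refl Eq.refl) (between ψ lψ uψ) (between χ lχ uχ) φ≉ψ φ≉χ
    where
    between : ∀ ω → at φ (lower j) ≈ at ω (lower j) → at φ (upper j) ≈ at ω (upper j) →
              at ω (proper j) ≈ H₁ ⊎ at ω (proper j) ≈ H₂
    between ω l u = only (at ω (proper j)) (at-rank ω _)
      (<-resp (Eq.sym l) Eq.refl (at-mono ω (lower<proper j)))
      (<-resp Eq.refl (Eq.sym u) (at-mono ω (proper<upper j)))

  neighbours-unique : ∀ j {φ ψ χ} → Neighbours (proper j) φ ψ → Neighbours (proper j) φ χ → ψ ≑ χ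
  neighbours-unique j {φ} {ψ} {χ} n m i with i Fin.≟ proper j
  ... | no  ne = Eq.trans (Eq.sym (agree n i ne)) (agree m i ne)
  ... | yes ≡.refl = diamond-unique j φ ψ χ
    (agree n _ (lower≢proper j)) (agree n _ (upper≢proper j))
    (agree m _ (lower≢proper j)) (agree m _ (upper≢proper j)) (differ n) (differ m)

  private
    fixes-neighbour : ∀ γ {φ ψ} j → Neighbours j φ ψ → image γ φ ≑ φ → image γ ψ ≑ ψ
    fixes-neighbour γ {φ} {ψ} j n e with neighbours-proper {φ} {ψ} j n
    ... | i , ≡.refl = neighbours-unique i {φ} {image γ ψ} {ψ}
      (neighbours-resp {φ = image γ φ} {φ} {image γ ψ} {image γ ψ} e (λ _ → Eq.refl)
        (image-neighbours γ {φ = φ} {ψ} n)) n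

  -- Uniqueness of neighbours carries fixedness along a path from `Φ` to a flag through `x`.
  flag-fixed⇒identity : ∀ γ Φ → image γ (ranked Φ) ≑ ranked Φ → ∀ x → to γ x ≈ x
  flag-fixed⇒identity γ Φ e x with flagThrough x
  ... | Ψ , x∈ with stronglyFlagConnected Φ Ψ
  ... | Ψ′ , path , Ψ′≐Ψ = Eq.trans (to-cong γ x≈) (Eq.trans (walk path e (rank x)) (Eq.sym x≈))
    where
    Step : Flag → Flag → Set (c ⊔ ℓ₁)
    Step Θ Θ′ = Adjacent Θ Θ′ × (∀ x → x ∈ faces Φ → x ∈ faces Ψ → x ∈ faces Θ′)
    walk : ∀ {Θ} → Star Step Θ Ψ′ → image γ (ranked Θ) ≑ ranked Θ → image γ (ranked Ψ′) ≑ ranked Ψ′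
    walk [-] fix = fix
    walk {Θ} (_◅_ {j = Θ′} ((j , adj) , _) path) fix =
      walk path (fixes-neighbour γ {ranked Θ} {ranked Θ′} j (adjacent⇒neighbours Θ Θ′ j adj) fix)
    x≈ : x ≈ face Ψ′ (rank x)
    x≈ = ∈⇒≈ Ψ′ (Equivalence.from (Ψ′≐Ψ x) x∈)

  same-image⇒≈ : ∀ γ δ φ → image γ φ ≑ image δ φ → ∀ x → to γ x ≈ to δ x
  same-image⇒≈ γ δ φ e x with toFlag φ
  ... | Φ , Φ≑φ = Eq.trans (Eq.sym (to-from δ _)) (to-cong δ (flag-fixed⇒identity (γ ∙ δ ⁻¹) Φ fixed x))
    where
    open Group Γ using (_∙_; _⁻¹)
    fixed : image (γ ∙ δ ⁻¹) (ranked Φ) ≑ ranked Φ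
    fixed j = Eq.trans
      (from-cong δ (Eq.trans (to-cong γ (Φ≑φ j)) (Eq.trans (e j) (to-cong δ (Eq.sym (Φ≑φ j))))))
      (from-to δ _)

  -- A change of the `j`-face leaves the two faces around the `i`-face alone.
  Far : Fin 4 → Fin 4 → Set
  Far i j = lower i ≢ proper j × upper i ≢ proper j

  -- `reflected i` plays the role of Φⁱ. It is given as a flag and not by a reflection, which a
  -- chiral polytope lacks; ρᵢ₋₁ρᵢ takes Φⁱ⁻¹ to Φⁱ in any case. `relabel` accommodates the dual,
  -- where ranks run in the opposite order.
  record RotationAction {a ℓ} (A : GeneratedGroup 3 a ℓ) (φ : RankedFlag) : Set (c ⊔ ℓ₁ ⊔ ℓ₂ ⊔ a ⊔ ℓ) where
    module A = GeneratedGroup A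
    field
      act      : A.Carrier → Automorphism poset
      act-cong : ∀ {g h} → g A.≈ h → ∀ x → to (act g) x ≈ to (act h) x
      act-ε    : ∀ x → to (act A.ε) x ≈ x
      act-∙    : ∀ g h x → to (act (g A.∙ h)) x ≈ to (act h) (to (act g) x)

      relabel            : Fin 4 → Fin 4
      relabel-involutive : ∀ i → relabel (relabel i) ≡ i
      relabel-far        : ∀ {i j} → suc (toℕ i) ℕ.< toℕ j →
                           Far (relabel i) (relabel j) × Far (relabel j) (relabel i)

      reflected            : Fin 4 → RankedFlag
      reflected-neighbours : ∀ i → Neighbours (proper (relabel i)) φ (reflected i)
      generator-maps       : ∀ i → image (act (A.generator i)) (reflected (inject₁ i)) ≑ reflected (suc i)

    open RotationGraph A

    prefix-maps : ∀ i → image (act (prefix i)) (reflected 0F) ≑ reflected i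
    prefix-maps 0F j = act-ε _
    prefix-maps 1F j = generator-maps 0F j
    prefix-maps 2F j = Eq.trans (act-∙ _ _ _) (Eq.trans (to-cong (act _) (generator-maps 0F j)) (generator-maps 1F j))
    prefix-maps 3F j = Eq.trans (act-∙ _ _ _) (Eq.trans (to-cong (act _) (prefix-maps 2F j)) (generator-maps 2F j))

    flagAt : RFlag → RankedFlag
    flagAt (even g) = image (act g) φ
    flagAt (odd g)  = image (act g) (reflected 0F)

    flagAt-cong : ∀ {e f} → e ≈ᶠ f → flagAt e ≑ flagAt f
    flagAt-cong (even p) j = act-cong p _
    flagAt-cong (odd p)  j = act-cong p _

    act-inverse : ∀ g x → to (act (g A.⁻¹)) (to (act g) x) ≈ x
    act-inverse g x = Eq.trans (Eq.sym (act-∙ _ _ _)) (Eq.trans (act-cong (A.inverseʳ g) x) (act-ε x))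

    -- Automorphisms preserve neighbours, so everything follows from the neighbours of the base
    -- flag; `flagAt` thereby turns steps of the graph into adjacencies of P.
    reflect-neighbours : ∀ i e → Neighbours (proper (relabel i)) (flagAt e) (flagAt (reflect i e))
    reflect-neighbours i (even g) = neighbours-resp
      {φ = image (act g) φ} {image (act g) φ} {image (act g) (reflected i)} {flagAt (odd _)}
      (λ _ → Eq.refl)
      (λ j → Eq.trans (to-cong (act g) (Eq.sym (prefix-maps i j))) (Eq.sym (act-∙ _ _ _)))
      (image-neighbours (act g) {φ = φ} {reflected i} (reflected-neighbours i))
    -- The inverse of `prefix i` takes `reflected i` to `reflected 0F`, and `φ` to the neighbour
    -- that is sought, before `g` is applied.
    reflect-neighbours i (odd g) = neighbours-resp
      {φ = image (act g) (image back (reflected i))} {flagAt (odd g)}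
      {image (act g) (image back φ)} {flagAt (even _)}
      (λ j → to-cong (act g) (Eq.trans (to-cong back (Eq.sym (prefix-maps i j))) (act-inverse (prefix i) _)))
      (λ j → Eq.sym (act-∙ _ _ _))
      (image-neighbours (act g) {φ = image back (reflected i)} {image back φ}
        (image-neighbours back {φ = reflected i} {φ}
          (neighbours-sym {φ = φ} {reflected i} (reflected-neighbours i))))
      where
      back : Automorphism poset
      back = act (prefix i A.⁻¹)

    conn-agree : ∀ {h} {I : Pred (Fin 4) h} {e f} j → (∀ {i} → I i → j ≢ proper (relabel i)) →
                 Conn I e f → at (flagAt e) j ≈ at (flagAt f) j
    conn-agree j avoid (done p) = flagAt-cong p j
    conn-agree {e = e} j avoid (step i p c) = Eq.trans (agree (reflect-neighbours i e) j (avoid p)) (conn-agree j avoid c)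

    relabel-injective : ∀ {i j} → relabel i ≡ relabel j → i ≡ j
    relabel-injective e = ≡.trans (≡.sym (relabel-involutive _)) (≡.trans (≡.cong relabel e) (relabel-involutive _))

    relabel-≢ : ∀ {i j} → i ≢ j → proper (relabel i) ≢ proper (relabel j)
    relabel-≢ ne e = ne (relabel-injective (proper-injective e))

    -- Steps of ranks other than `j` keep the face of rank `relabel j`, which `reflect j` changes. A
    -- single action on P settles this, also for the mix.
    facewise-free : IsFacewiseFree
    facewise-free j e c = differ (reflect-neighbours j e)
      (conn-agree (proper (relabel j)) (λ i≢j → relabel-≢ (i≢j ∘ ≡.sym)) c)

    private
      -- Both faces lie between the same two faces, which steps of rank `j` do not touch, and both
      -- differ from the face of `flagAt (reflect j e)` there.
      comm-at : ∀ i j e → i ≢ j → Far (relabel i) (relabel j) →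
                let l = proper (relabel i) in
                at (flagAt (reflect i (reflect j e))) l ≈ at (flagAt (reflect j (reflect i e))) l
      comm-at i j e i≢j (far₁ , far₂) =
        diamond-unique (relabel i)
          (flagAt (reflect j e)) (flagAt (reflect i (reflect j e))) (flagAt (reflect j (reflect i e)))
          (agree ij _ (lower≢proper _)) (agree ij _ (upper≢proper _))
          (around _ far₁ (lower≢proper _)) (around _ far₂ (upper≢proper _))
          (differ ij)
          (λ q → differ (reflect-neighbours i e) (Eq.trans (agree (reflect-neighbours j e) _ (relabel-≢ i≢j))
                   (Eq.trans q (Eq.sym (agree (reflect-neighbours j (reflect i e)) _ (relabel-≢ i≢j))))))
        where
        ij = reflect-neighbours i (reflect j e)
        around : ∀ l → l ≢ proper (relabel j) → l ≢ proper (relabel i) →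
                 at (flagAt (reflect j e)) l ≈ at (flagAt (reflect j (reflect i e))) l
        around l ≢j ≢i = Eq.trans (Eq.sym (agree (reflect-neighbours j e) l ≢j))
          (Eq.trans (agree (reflect-neighbours i e) l ≢i) (agree (reflect-neighbours j (reflect i e)) l ≢j))

    reflect-comm : ∀ {i j} → suc (toℕ i) ℕ.< toℕ j → ∀ e →
                   flagAt (reflect i (reflect j e)) ≑ flagAt (reflect j (reflect i e))
    reflect-comm {i} {j} i<j e l with l Fin.≟ proper (relabel i) | l Fin.≟ proper (relabel j)
    ... | yes ≡.refl | _ = comm-at i j e i≢j (proj₁ (relabel-far i<j))
      where
      i≢j : i ≢ j
      i≢j ≡.refl = ℕ.<-asym i<j ℕ.≤-refl
    ... | no _ | yes ≡.refl = Eq.sym (comm-at j i e (i≢j ∘ ≡.sym) (proj₂ (relabel-far i<j)))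
      where
      i≢j : i ≢ j
      i≢j ≡.refl = ℕ.<-asym i<j ℕ.≤-refl
    ... | no ≢i | no ≢j = Eq.trans (Eq.sym (there′ i j ≢i ≢j)) (there′ j i ≢j ≢i)
      where
      there′ : ∀ i j → l ≢ proper (relabel i) → l ≢ proper (relabel j) →
               at (flagAt e) l ≈ at (flagAt (reflect i (reflect j e))) l
      there′ i j ≢i ≢j =
        Eq.trans (agree (reflect-neighbours j e) l ≢j) (agree (reflect-neighbours i (reflect j e)) l ≢i)

    -- Automorphisms that agree on one flag are equal, so commuting on flags becomes a relation
    -- between automorphisms.
    act-comm : ∀ {i j} → suc (toℕ i) ℕ.< toℕ j → ∀ e x →
               to (act (underlying (reflect i (reflect j e)))) x ≈ to (act (underlying (reflect j (reflect i e)))) x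
    act-comm {i} {j} i<j (even g) = same-image⇒≈
      (act (prefix i A.⁻¹ A.∙ (prefix j A.∙ g))) (act (prefix j A.⁻¹ A.∙ (prefix i A.∙ g)))
      φ (reflect-comm i<j (even g))
    act-comm {i} {j} i<j (odd g)  = same-image⇒≈
      (act (prefix i A.∙ (prefix j A.⁻¹ A.∙ g))) (act (prefix j A.∙ (prefix i A.⁻¹ A.∙ g)))
      (reflected 0F) (reflect-comm i<j (odd g))

    -- Strong flag-connectedness joins `Φ` to `Ψ` without changing common faces. A flag has at most
    -- one neighbour of each proper rank, so every adjacency on the way is matched by a step of the
    -- graph.
    conn-lift : ∀ {d} (D : Pred (Fin 4) d) e Φ Ψ →
                flagAt e ≑ ranked Φ → (∀ {j} → D j → face Φ (proper j) ≈ face Ψ (proper j)) →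
                ∃ λ f → Conn (λ i → ¬ D (relabel i)) e f × flagAt f ≑ ranked Ψ
    conn-lift D e Φ Ψ start common = finish (stronglyFlagConnected Φ Ψ)
      where
      Step : Flag → Flag → Set (c ⊔ ℓ₁)
      Step Θ Θ′ = Adjacent Θ Θ′ × (∀ x → x ∈ faces Φ → x ∈ faces Ψ → x ∈ faces Θ′)
      Goal : RFlag → RankedFlag → Set _
      Goal e ψ = ∃ λ f → Conn (λ i → ¬ D (relabel i)) e f × flagAt f ≑ ψ
      walk : ∀ {Θ Ψ′} e → flagAt e ≑ ranked Θ → (∀ {j} → D j → face Φ (proper j) ≈ face Θ (proper j)) →
             Star Step Θ Ψ′ → Goal e (ranked Ψ′)
      walk e here′ keep [-] = e , done (FlagGraph.refl graph) , here′
      walk {Θ} {Ψ′} e here′ keep (_◅_ {j = Θ′} ((j , adj) , stay) path) =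
        next (neighbours-proper {ranked Θ} {ranked Θ′} j n) n
        where
        n : Neighbours j (ranked Θ) (ranked Θ′)
        n = adjacent⇒neighbours Θ Θ′ j adj
        keep′ : ∀ {j} → D j → face Φ (proper j) ≈ face Θ′ (proper j)
        keep′ {j} d = ∈⇒≈-at Θ′ (face-rank Φ _) (stay _ (∈ᴾ⇒∈ (face-∈ Φ _)) (≈⇒∈ Ψ (common d)))
        next : (∃ λ i → j ≡ proper i) → Neighbours j (ranked Θ) (ranked Θ′) → Goal e (ranked Ψ′)
        next (i , ≡.refl) n with walk {Θ′} (reflect (relabel i) e) there′ keep′ path
          where
          there′ : flagAt (reflect (relabel i) e) ≑ ranked Θ′
          there′ = neighbours-unique i {ranked Θ} {flagAt (reflect (relabel i) e)} {ranked Θ′}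
            (neighbours-resp {φ = flagAt e} {ranked Θ} {flagAt (reflect (relabel i) e)}
              {flagAt (reflect (relabel i) e)} here′ (λ _ → Eq.refl)
              (≡.subst (λ k → Neighbours (proper k) (flagAt e) (flagAt (reflect (relabel i) e)))
                       (relabel-involutive i) (reflect-neighbours (relabel i) e))) n
        -- If this rank belonged to `D`, its face would be kept, against `differ`.
        ... | f , conn , end = f , step (relabel i) (λ d → let d′ = ≡.subst D (relabel-involutive i) d in
                differ n (Eq.trans (Eq.sym (keep d′)) (keep′ d′))) conn , end
      finish : (∃ λ Ψ′ → Star Step Φ Ψ′ × Ψ′ ≐ Ψ) → Goal e (ranked Ψ)
      finish (Ψ′ , path , Ψ′≐Ψ) with walk {Φ} {Ψ′} e start (λ _ → Eq.refl) path
      ... | f , conn , end = f , conn , λ j → Eq.trans (end j)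
        (∈⇒≈-at Ψ (face-rank Ψ′ j) (Equivalence.to (Ψ′≐Ψ _) (∈ᴾ⇒∈ (face-∈ Ψ′ j))))

-- Chiral and directly regular polytopes

module Rotations {c ℓ₁ ℓ₂} (P : Polytope 4 c ℓ₁ ℓ₂) (finite : Polytope.IsFinite P) where
  open Polytope P
  open Poset poset using (module Eq)
  open Symmetry P
  open BaseFaces P using (face)
  open FlagCalculus P finite
  open Automorphism
  open Group Γ using (_∙_; _⁻¹; ε)
  open GroupNotions Γ

  record RotationBase (Φ : Flag) (σ : Fin 3 → Automorphism poset) : Set (c ⊔ ℓ₁ ⊔ ℓ₂) where
    field
      reflected            : Fin 4 → RankedFlag
      reflected-neighbours : ∀ i → Neighbours (proper i) (ranked Φ) (reflected i)
      rotates              : ∀ i → image (σ i) (reflected (inject₁ i)) ≑ reflected (suc i)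

  far? : ∀ i j → Dec (Far i j)
  far? i j = ¬? (lower i Fin.≟ proper j) ×-dec ¬? (upper i Fin.≟ proper j)

  far-id : ∀ i j → suc (toℕ i) ℕ.< toℕ j → Far i j × Far j i
  far-id = toWitness {a? = Fin.all? λ i → Fin.all? λ j → (suc (toℕ i) ℕ.<? toℕ j) →-dec
    (far? i j ×-dec far? j i)} tt

  far-opposite : ∀ i j → suc (toℕ i) ℕ.< toℕ j →
                 Far (opposite i) (opposite j) × Far (opposite j) (opposite i)
  far-opposite = toWitness {a? = Fin.all? λ i → Fin.all? λ j → (suc (toℕ i) ℕ.<? toℕ j) →-dec
    (far? (opposite i) (opposite j) ×-dec far? (opposite j) (opposite i))} tt

  Rotation : (Fin 3 → Automorphism poset) → GeneratedGroup 3 (c ⊔ ℓ₁ ⊔ ℓ₂) (c ⊔ ℓ₁)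
  Rotation σ = record { ambient = Γ ; generator = σ }

  Mix : (Fin 3 → Automorphism poset) → GeneratedGroup 3 (c ⊔ ℓ₁ ⊔ ℓ₂) (c ⊔ ℓ₁)
  Mix σ = Rotation σ ⋄ (Rotation σ ᵟ)

  module _ {Φ σ} (base : RotationBase Φ σ) where
    open RotationBase base

    rotationAction : RotationAction (Rotation σ) (ranked Φ)
    rotationAction = record
      { act = id ; act-cong = id ; act-ε = λ _ → Eq.refl ; act-∙ = λ _ _ _ → Eq.refl
      ; relabel = id ; relabel-involutive = λ _ → ≡.refl ; relabel-far = far-id _ _
      ; reflected = reflected ; reflected-neighbours = reflected-neighbours ; generator-maps = rotates
      }

    mixAction₁ : RotationAction (Mix σ) (ranked Φ)
    mixAction₁ = record
      { act = proj₁ ; act-cong = proj₁ ; act-ε = λ _ → Eq.refl ; act-∙ = λ _ _ _ → Eq.refl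
      ; relabel = id ; relabel-involutive = λ _ → ≡.refl ; relabel-far = far-id _ _
      ; reflected = reflected ; reflected-neighbours = reflected-neighbours ; generator-maps = rotates
      }

    -- The generator `i` acts as the inverse of the rotation `opposite i`, so it runs backwards from
    -- one Φʲ to Φʲ⁻¹, in keeping with the reversed ranks.
    mixAction₂ : RotationAction (Mix σ) (ranked Φ)
    mixAction₂ = record
      { act = proj₂ ; act-cong = proj₂ ; act-ε = λ _ → Eq.refl ; act-∙ = λ _ _ _ → Eq.refl
      ; relabel = opposite ; relabel-involutive = opposite-involutive ; relabel-far = far-opposite _ _
      ; reflected = reflected ∘ opposite ; reflected-neighbours = reflected-neighbours ∘ opposite
      ; generator-maps = λ where
          0F → back 2F
          1F → back 1F
          2F → back 0F
      }
      where
      back : ∀ i → image (σ i ⁻¹) (reflected (suc i)) ≑ reflected (inject₁ i)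
      back i j = Eq.trans (from-cong (σ i) (Eq.sym (rotates i j))) (from-to (σ i) _)

    module _ (base-unreflected : ∀ w → ⟨ σ ⟩ w → ¬ (image w (ranked Φ) ≑ reflected 0F)) where
      open RotationAction rotationAction using (conn-lift; flagAt)
      open RotationGraph (Rotation σ) using (Conn; RFlag; even; odd; conn⇒sub; conn-generated)
      open GeneratedGroup (Rotation σ) using (Sub)

      -- The lifted path ends over wΦ. If its end `even v` is even, `v` equals `w` by freeness and
      -- the path puts it into `Sub`; an odd end would make `w ∙ v ⁻¹` take Φ to Φ⁰.
      stabilizer⊆Sub : ∀ {d} (D : Pred (Fin 4) d) w → ⟨ σ ⟩ w →
        (∀ {j} → D j → to w (face Φ (proper j)) ≈ face Φ (proper j)) → Sub (λ i → ¬ D i) w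
      stabilizer⊆Sub D w w∈ fixes with toFlag (image w (ranked Φ))
      ... | Ψ , Ψ≑ with conn-lift D (even ε) Φ Ψ (λ _ → Eq.refl)
                                  (λ d → Eq.trans (Eq.sym (fixes d)) (Eq.sym (Ψ≑ _)))
      ... | even v , conn , v≑ =
        resp (same-image⇒≈ v w (ranked Φ) (λ j → Eq.trans (v≑ j) (Ψ≑ j))) (conn⇒sub conn)
      ... | odd v , conn , v≑ = ⊥-elim (base-unreflected (w ∙ v ⁻¹)
        (mul w∈ (inv (conn-generated conn unit)))
        λ j → Eq.trans (from-cong v (Eq.sym (Eq.trans (v≑ j) (Ψ≑ j)))) (from-to v _))

  private
    module ChiralBase {Φ} (ch : Chiral Φ) where
      open Chiral ch

      Ψ Ψ′ : Fin 3 → Flag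
      Ψ i  = proj₁ (σ-maps i)
      Ψ′ i = proj₁ (proj₂ (σ-maps i))

      adjacent : ∀ i → Neighbours (proper (suc i)) (ranked Φ) (ranked (Ψ i))
      adjacent i = adjacent⇒neighbours Φ (Ψ i) _ (proj₁ (proj₂ (proj₂ (σ-maps i))))

      adjacent′ : ∀ i → Neighbours (proper (inject₁ i)) (image (σ i) (ranked Φ)) (ranked (Ψ i))
      adjacent′ i = neighbours-resp {φ = ranked (Ψ′ i)} {image (σ i) (ranked Φ)} {ranked (Ψ i)} {ranked (Ψ i)}
        (λ j → Eq.sym (maps⇒≑ (σ i) Φ (Ψ′ i) (proj₂ (proj₂ (proj₂ (proj₂ (σ-maps i))))) j)) (λ _ → Eq.refl)
        (neighbours-sym {φ = ranked (Ψ i)} {ranked (Ψ′ i)}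
          (adjacent⇒neighbours (Ψ i) (Ψ′ i) _ (proj₁ (proj₂ (proj₂ (proj₂ (σ-maps i)))))))

      reflected : Fin 4 → RankedFlag
      -- `σ-maps` names no Φ⁰. Since σ₁ takes Φ to the 0-neighbour of Φ¹, the preimage of Φ¹ under
      -- σ₁ is the 0-neighbour of Φ.
      reflected 0F      = image (σ 0F ⁻¹) (ranked (Ψ 0F))
      reflected (suc i) = ranked (Ψ i)

      reflected-neighbours : ∀ i → Neighbours (proper i) (ranked Φ) (reflected i)
      reflected-neighbours 0F = neighbours-resp
        {φ = image (σ 0F ⁻¹) (image (σ 0F) (ranked Φ))} {ranked Φ} {reflected 0F} {reflected 0F}
        (λ _ → from-to (σ 0F) _) (λ _ → Eq.refl)
        (image-neighbours (σ 0F ⁻¹) {φ = image (σ 0F) (ranked Φ)} {ranked (Ψ 0F)} (adjacent′ 0F))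
      reflected-neighbours (suc i) = adjacent i

      rotates : ∀ i → image (σ i) (reflected (inject₁ i)) ≑ reflected (suc i)
      rotates i = neighbours-unique (inject₁ i)
        {image (σ i) (ranked Φ)} {image (σ i) (reflected (inject₁ i))} {ranked (Ψ i)}
        (image-neighbours (σ i) {φ = ranked Φ} {reflected (inject₁ i)} (reflected-neighbours (inject₁ i)))
        (adjacent′ i)

      base : RotationBase Φ σ
      base = record { reflected = reflected ; reflected-neighbours = reflected-neighbours ; rotates = rotates }

      -- If `w` took Φ to Φ⁰, then `w ∙ σ 0F` would take it to Φ¹, and two adjacent flags would
      -- share an orbit.
      unreflected : ∀ w → ⟨ σ ⟩ w → ¬ (image w (ranked Φ) ≑ reflected 0F)
      unreflected w _ e = proj₂ isChiral Φ (Ψ 0F) (_ , proj₁ (proj₂ (proj₂ (σ-maps 0F))))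
        (w ∙ σ 0F , ≑⇒maps (w ∙ σ 0F) Φ (Ψ 0F) λ j → Eq.trans (to-cong (σ 0F) (e j)) (rotates 0F j))

    module RegularBase {Φ} (dr : DirectlyRegular Φ) where
      open DirectlyRegular dr

      Ψ : Fin 4 → Flag
      Ψ i = proj₁ (ρ-maps i)

      adjacent : ∀ i → Neighbours (proper i) (ranked Φ) (ranked (Ψ i))
      adjacent i = adjacent⇒neighbours Φ (Ψ i) _ (proj₁ (proj₂ (ρ-maps i)))

      forth : ∀ i → image (ρ i) (ranked Φ) ≑ ranked (Ψ i)
      forth i = maps⇒≑ (ρ i) Φ (Ψ i) (proj₂ (proj₂ (ρ-maps i)))

      back : ∀ i → image (ρ i) (ranked (Ψ i)) ≑ ranked Φ
      back i = neighbours-unique i {ranked (Ψ i)} {image (ρ i) (ranked (Ψ i))} {ranked Φ}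
        (neighbours-resp {φ = image (ρ i) (ranked Φ)} {ranked (Ψ i)}
          {image (ρ i) (ranked (Ψ i))} {image (ρ i) (ranked (Ψ i))}
          (forth i) (λ _ → Eq.refl) (image-neighbours (ρ i) {φ = ranked Φ} {ranked (Ψ i)} (adjacent i)))
        (neighbours-sym {φ = ranked Φ} {ranked (Ψ i)} (adjacent i))

      base : RotationBase Φ σ
      base = record
        { reflected = ranked ∘ Ψ
        ; reflected-neighbours = adjacent
        ; rotates = λ i j → Eq.trans (to-cong (ρ (suc i)) (back (inject₁ i) j)) (forth (suc i) j)
        }

      open RotationAction (rotationAction base) using (conn-lift)
      open RotationGraph (Rotation σ) using (even; odd; conn-generated)

      -- If w ∈ ⟨ σ ⟩ acts on the base flag as ρ₀, then ⟨ σ ⟩ reaches odd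
      -- flags as well and is the whole group.
      unreflected : ∀ w → ⟨ σ ⟩ w → ¬ (image w (ranked Φ) ≑ ranked (Ψ 0F))
      unreflected w w∈ e = Fin.0≢1+n (proj₁ (proj₂ index-2) (whole (f 0F ∙ f 1F ⁻¹)))
        where
        f : Fin 2 → Automorphism poset
        f = proj₁ index-2
        whole : ∀ γ → ⟨ σ ⟩ γ
        whole γ with toFlag (image γ (ranked Φ))
        ... | Θ , Θ≑ with conn-lift (λ _ → ⊥) (even ε) Φ Θ (λ _ → Eq.refl) (λ ())
        ... | even v , conn , v≑ = resp
          (same-image⇒≈ v γ (ranked Φ) (λ j → Eq.trans (v≑ j) (Θ≑ j))) (conn-generated conn unit)
        ... | odd v , conn , v≑ = resp
          (same-image⇒≈ (w ∙ v) γ (ranked Φ) (λ j → Eq.trans (to-cong v (e j)) (Eq.trans (v≑ j) (Θ≑ j))))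
          (mul w∈ (conn-generated conn unit))

  rotationBase : ∀ {Φ} (S : ChiralOrDirectlyRegular Φ) → RotationBase Φ (rotation S)
  rotationBase (inj₁ ch) = ChiralBase.base ch
  rotationBase (inj₂ dr) = RegularBase.base dr

  rotation-unreflected : ∀ {Φ} (S : ChiralOrDirectlyRegular Φ) → ∀ w → ⟨ rotation S ⟩ w →
                         ¬ (image w (ranked Φ) ≑ RotationBase.reflected (rotationBase S) 0F)
  rotation-unreflected (inj₁ ch) = ChiralBase.unreflected ch
  rotation-unreflected (inj₂ dr) = RegularBase.unreflected dr

-- Finite groups

∤⇒coprime : ∀ {q} k → Prime q → ¬ q ∣ k → Coprime k q
∤⇒coprime k q-prime q∤k (d∣k , d∣q) with prime⇒irreducible q-prime d∣q
... | inj₁ d≡1    = d≡1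
... | inj₂ ≡.refl = ⊥-elim (q∤k d∣k)

module Powers {c ℓ} (G : Group c ℓ) where
  open Group G
  open Algebra.Properties.Group G
  open Algebra.Properties.Monoid.Mult monoid renaming (_×_ to _·_)
  open Relation.Binary.Reasoning.Setoid setoid

  ·-ε : ∀ n → n · ε ≈ ε
  ·-ε zero    = refl
  ·-ε (suc n) = trans (identityˡ _) (·-ε n)

  module _ {q x} (q·x : q · x ≈ ε) where

    multiple-· : ∀ n → (n * q) · x ≈ ε
    multiple-· n = trans (sym (×-assocˡ x n q)) (trans (×-congʳ n q·x) (·-ε n))

    ∣⇒·≈ε : ∀ {k} → q ∣ k → k · x ≈ ε
    ∣⇒·≈ε (divides-refl n) = multiple-· n

    root : Prime q → ∀ k → ¬ q ∣ k → ∃ λ n → n · (k · x) ≈ x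
    root q-prime k q∤k with coprime-Bézout (∤⇒coprime k q-prime q∤k)
    ... | Bézout.+- a b eq = a , (begin
      a · (k · x)          ≈⟨ ×-assocˡ x a k ⟩
      (a * k) · x          ≡⟨ ≡.cong (_· x) eq ⟨
      x ∙ (b * q) · x      ≈⟨ ∙-congˡ (multiple-· b) ⟩
      x ∙ ε                ≈⟨ identityʳ x ⟩
      x                    ∎)
    -- Here `a * k` is -1 modulo `q`, so its square is 1 and `a * k * a` inverts `k`.
    ... | Bézout.-+ a b eq = a * k * a , ∙-cancelʳ ((a * k) · x) _ _ (begin
      (a * k * a) · (k · x) ∙ (a * k) · x       ≈⟨ ∙-congʳ (×-assocˡ x (a * k * a) k) ⟩
      (a * k * a * k) · x ∙ (a * k) · x         ≈⟨ ×-homo-+ x (a * k * a * k) (a * k) ⟨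
      (a * k * a * k + a * k) · x               ≡⟨ ≡.cong (_· x) (factor a k) ⟩
      (a * k * (1 + a * k)) · x                 ≡⟨ ≡.cong (λ t → (a * k * t) · x) eq ⟩
      (a * k * (b * q)) · x                     ≡⟨ ≡.cong (_· x) (≡.sym (ℕ.*-assoc (a * k) b q)) ⟩
      (a * k * b * q) · x                       ≈⟨ multiple-· (a * k * b) ⟩
      ε                                         ≈⟨ multiple-· b ⟨
      (b * q) · x                               ≡⟨ ≡.cong (_· x) eq ⟨
      x ∙ (a * k) · x                           ∎)
      where
      factor : ∀ a k → a * k * a * k + a * k ≡ a * k * (1 + a * k)
      factor = solve-∀

    ·≈ε⇒∣ : Prime q → ¬ x ≈ ε → ∀ k → k · x ≈ ε → q ∣ k
    ·≈ε⇒∣ q-prime x≉ε k k·x = decidable-stable (q ∣? k) λ q∤k →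
      let n , e = root q-prime k q∤k in x≉ε (trans (sym e) (trans (×-congʳ n k·x) (·-ε n)))

    private
      ·-injective-≤ : Prime q → ¬ x ≈ ε → ∀ {a b} → a ℕ.≤ b → b ℕ.< q → a · x ≈ b · x → a ≡ b
      ·-injective-≤ q-prime x≉ε {a} {b} a≤b b<q e with b ∸ a in eq
      ... | zero  = ℕ.≤-antisym a≤b (ℕ.m∸n≡0⇒m≤n eq)
      ... | suc d = ⊥-elim (ℕ.<-irrefl ≡.refl (ℕ.<-≤-trans b<q
                      (ℕ.≤-trans (∣⇒≤ (·≈ε⇒∣ q-prime x≉ε (suc d) vanish)) (≡.subst (ℕ._≤ b) eq (ℕ.m∸n≤m b a)))))
        where
        vanish : suc d · x ≈ ε
        vanish = ∙-cancelˡ (a · x) _ _ (begin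
          a · x ∙ suc d · x  ≈⟨ ×-homo-+ x a (suc d) ⟨
          (a + suc d) · x    ≡⟨ ≡.cong (λ t → (a + t) · x) eq ⟨
          (a + (b ∸ a)) · x  ≡⟨ ≡.cong (_· x) (ℕ.m+[n∸m]≡n a≤b) ⟩
          b · x              ≈⟨ e ⟨
          a · x              ≈⟨ identityʳ _ ⟨
          a · x ∙ ε          ∎)

    ·-injective : Prime q → ¬ x ≈ ε → ∀ {a b} → a ℕ.< q → b ℕ.< q → a · x ≈ b · x → a ≡ b
    ·-injective q-prime x≉ε {a} {b} a<q b<q e with ℕ.≤-total a b
    ... | inj₁ a≤b = ·-injective-≤ q-prime x≉ε a≤b b<q e
    ... | inj₂ b≤a = ≡.sym (·-injective-≤ q-prime x≉ε b≤a a<q (sym e))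

    ·-mod : .{{_ : NonZero q}} → ∀ a → (a % q) · x ≈ a · x
    ·-mod a = begin
      (a % q) · x                        ≈⟨ identityʳ _ ⟨
      (a % q) · x ∙ ε                    ≈⟨ ∙-congˡ (multiple-· (a / q)) ⟨
      (a % q) · x ∙ ((a / q) * q) · x    ≈⟨ ×-homo-+ x (a % q) _ ⟨
      (a % q + (a / q) * q) · x          ≡⟨ ≡.cong (_· x) (m≡m%n+[m/n]*n a q) ⟨
      a · x                              ∎

    -- Exponents are natural numbers, and `pred q` stands for -1.
    ·-⁻¹ : .{{_ : NonZero q}} → ∀ a → (a · x) ⁻¹ ≈ (a * ℕ.pred q) · x
    ·-⁻¹ a = sym (inverseʳ-unique (a · x) _ (begin
      a · x ∙ (a * ℕ.pred q) · x    ≈⟨ ×-homo-+ x a _ ⟨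
      (a + a * ℕ.pred q) · x        ≡⟨ ≡.cong (_· x) (≡.sym (ℕ.*-suc a (ℕ.pred q))) ⟩
      (a * suc (ℕ.pred q)) · x      ≡⟨ ≡.cong (λ t → (a * t) · x) (ℕ.suc-pred q) ⟩
      (a * q) · x                   ≈⟨ multiple-· a ⟩
      ε                             ∎))

    ⁻¹-order : .{{_ : NonZero q}} → q · (x ⁻¹) ≈ ε
    ⁻¹-order = begin
      q · (x ⁻¹)                    ≈⟨ ×-congʳ q (⁻¹-cong (×-homo-1 x)) ⟨
      q · ((1 · x) ⁻¹)              ≈⟨ ×-congʳ q (·-⁻¹ 1) ⟩
      q · ((1 * ℕ.pred q) · x)      ≈⟨ ×-assocˡ x q (1 * ℕ.pred q) ⟩
      (q * (1 * ℕ.pred q)) · x      ≡⟨ ≡.cong (_· x) (ℕ.*-comm q (1 * ℕ.pred q)) ⟩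
      (1 * ℕ.pred q * q) · x        ≈⟨ multiple-· (1 * ℕ.pred q) ⟩
      ε                             ∎

    -- `i * pred q + j` is j - i modulo `q`, written without subtraction.
    ∣⇒·≈· : .{{_ : NonZero q}} → ∀ i j → q ∣ i * ℕ.pred q + j → j · x ≈ i · x
    ∣⇒·≈· i j q∣ = ∙-cancelˡ ((i · x) ⁻¹) _ _ (begin
      (i · x) ⁻¹ ∙ j · x               ≈⟨ ∙-congʳ (·-⁻¹ i) ⟩
      (i * ℕ.pred q) · x ∙ j · x       ≈⟨ ×-homo-+ x (i * ℕ.pred q) j ⟨
      (i * ℕ.pred q + j) · x           ≈⟨ ∣⇒·≈ε q∣ ⟩
      ε                                ≈⟨ inverseˡ _ ⟨
      (i · x) ⁻¹ ∙ i · x               ∎)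

  IsPower : Carrier → Pred Carrier ℓ
  IsPower x y = ∃ λ n → y ≈ n · x

  record IsSubgroup {h} (H : Pred Carrier h) : Set (c ⊔ ℓ ⊔ h) where
    field
      unit : H ε
      mul  : ∀ {y z} → H y → H z → H (y ∙ z)
      inv  : ∀ {y} → H y → H (y ⁻¹)
      resp : ∀ {y z} → y ≈ z → H y → H z

  powers-subgroup : ∀ {q x} .{{_ : NonZero q}} → q · x ≈ ε → IsSubgroup (IsPower x)
  powers-subgroup {q} {x} q·x = record
    { unit = 0 , refl
    ; mul  = λ (a , p) (b , p′) → a + b , trans (∙-cong p p′) (sym (×-homo-+ x a b))
    ; inv  = λ (a , p) → a * ℕ.pred q , trans (⁻¹-cong p) (·-⁻¹ q·x a)
    ; resp = λ e (a , p) → a , trans (sym e) p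
    }

  generated⊆ : ∀ {i h} {I : Set i} {s : I → Carrier} {H : Pred Carrier h} → IsSubgroup H →
               (∀ k → H (s k)) → ∀ {y} → GroupNotions.⟨_⟩ G s y → H y
  generated⊆ {H = H} sub base = go
    where
    open IsSubgroup sub
    open GroupNotions G using (⟨_⟩)
    go : ∀ {y} → ⟨ _ ⟩ y → H y
    go (GroupNotions.gen k)    = base k
    go GroupNotions.unit       = unit
    go (GroupNotions.mul p q)  = mul (go p) (go q)
    go (GroupNotions.inv p)    = inv (go p)
    go (GroupNotions.resp e p) = resp e (go p)

module Lagrange {k c ℓ} (A : GeneratedGroup k c ℓ) {m} (size : GeneratedGroup.HasSize A m) where
  open GeneratedGroup A
  open Algebra.Properties.Group ambient
  open Powers ambient using (IsSubgroup)
  open Relation.Binary.Reasoning.Setoid setoid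

  private
    element : Fin m → Carrier
    element i = proj₁ (proj₁ size i)

    element-generated : ∀ i → ⟨ generator ⟩ (element i)
    element-generated i = proj₂ (proj₁ size i)

    element-injective : ∀ {i j} → element i ≈ element j → i ≡ j
    element-injective = proj₁ (proj₂ size)

    position : ∀ {g} → ⟨ generator ⟩ g → ∃ λ i → element i ≈ g
    position p with proj₂ (proj₂ size) (_ , p)
    ... | i , e = i , e ≡.refl

    decide : ∀ {g h} → ⟨ generator ⟩ g → ⟨ generator ⟩ h → Dec (g ≈ h)
    decide p q with position p | position q
    ... | i , e | j , e′ = Dec.map′ (λ { ≡.refl → trans (sym e) e′ })
                                    (λ g≈h → element-injective (trans e (trans g≈h (sym e′)))) (i Fin.≟ j)

  -- Every element is in exactly one way a member of `family` times a coset representative, and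
  -- injections in both directions make `m` the product of the two numbers.
  subgroup-size∣ : ∀ {h d} {H : Pred Carrier h} → IsSubgroup H → (family : Fin d → Carrier) →
    (∀ i → ⟨ generator ⟩ (family i)) → (∀ i → H (family i)) → (∀ {g} → H g → ∃ λ i → g ≈ family i) →
    (∀ {i j} → family i ≈ family j → i ≡ j) → d ∣ m
  subgroup-size∣ {d = d} {H} subgroup family family-generated family⊆H H⊆family family-injective =
    divides (length reps) (≡.trans (ℕ.≤-antisym
      (Fin.injective⇒≤ {f = λ x → Fin.combine (proj₁ (split x)) (proj₂ (split x))} split-injective)
      (Fin.injective⇒≤ {f = λ y → join (Fin.remQuot (length reps) y)} join-injective)) (ℕ.*-comm d _))
    where
    module H = IsSubgroup subgroup
    _∼_ : Rel (Fin m) _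
    x ∼ y = H (element x ∙ element y ⁻¹)
    ∼-sym : ∀ {x y} → x ∼ y → y ∼ x
    ∼-sym p = H.resp (trans (⁻¹-anti-homo-∙ _ _) (∙-congʳ (⁻¹-involutive _))) (H.inv p)
    ∼-trans : ∀ {x y z} → x ∼ y → y ∼ z → x ∼ z
    ∼-trans {x} {y} {z} p q = H.resp (begin
      (element x ∙ element y ⁻¹) ∙ (element y ∙ element z ⁻¹)  ≈⟨ assoc _ _ _ ⟩
      element x ∙ (element y ⁻¹ ∙ (element y ∙ element z ⁻¹))  ≈⟨ ∙-congˡ (assoc _ _ _) ⟨
      element x ∙ ((element y ⁻¹ ∙ element y) ∙ element z ⁻¹)  ≈⟨ ∙-congˡ (∙-congʳ (inverseˡ _)) ⟩
      element x ∙ (ε ∙ element z ⁻¹)                           ≈⟨ ∙-congˡ (identityˡ _) ⟩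
      element x ∙ element z ⁻¹                                 ∎) (H.mul p q)
    -- `family` lists `H`, and the enumeration behind `size` decides equality of generated elements.
    _∼?_ : ∀ x y → Dec (x ∼ y)
    x ∼? y = Dec.map′ (λ (i , e) → H.resp (sym e) (family⊆H i)) H⊆family
      (Fin.any? λ i → decide (mul (element-generated x) (inv (element-generated y))) (family-generated i))
    cosets : DecSetoid _ _
    cosets = record
      { _≈_ = _∼_
      ; isDecEquivalence = record
        { isEquivalence = record
          { refl = H.resp (sym (inverseʳ _)) H.unit ; sym = ∼-sym ; trans = ∼-trans }
        ; _≟_ = _∼?_
        }
      }
    reps : List (Fin m)
    reps = deduplicate _∼?_ (allFin m)
    rep∈ : ∀ x → Any (x ∼_) reps
    rep∈ x = Membership.∈-deduplicate⁺ (DecSetoid.setoid cosets) _∼?_ (λ p q → ∼-trans q (∼-sym p))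
      (Any.map (λ { ≡.refl → DecSetoid.refl cosets }) (∈-allFin x))
    rep : Fin (length reps) → Carrier
    rep i = element (lookup reps i)
    split : Fin m → Fin d × Fin (length reps)
    split x = proj₁ (H⊆family (lookup-index (rep∈ x))) , Any.index (rep∈ x)
    split-eq : ∀ x → element x ≈ family (proj₁ (split x)) ∙ rep (proj₂ (split x))
    split-eq x = trans (sym (trans (assoc _ _ _) (trans (∙-congˡ (inverseˡ _)) (identityʳ _))))
      (∙-congʳ (proj₂ (H⊆family (lookup-index (rep∈ x)))))
    split-injective : ∀ {x y} →
      Fin.combine (proj₁ (split x)) (proj₂ (split x)) ≡ Fin.combine (proj₁ (split y)) (proj₂ (split y)) → x ≡ y
    split-injective {x} {y} e with Fin.combine-injective (proj₁ (split x)) _ (proj₁ (split y)) _ e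
    ... | e₁ , e₂ = element-injective (begin
      element x                                          ≈⟨ split-eq x ⟩
      family (proj₁ (split x)) ∙ rep (proj₂ (split x))   ≡⟨ ≡.cong₂ (λ i j → family i ∙ rep j) e₁ e₂ ⟩
      family (proj₁ (split y)) ∙ rep (proj₂ (split y))   ≈⟨ split-eq y ⟨
      element y                                          ∎)
    join : Fin d × Fin (length reps) → Fin m
    join (i , j) = proj₁ (position (mul (family-generated i) (element-generated (lookup reps j))))
    join-eq : ∀ i j → element (join (i , j)) ≈ family i ∙ rep j
    join-eq i j = proj₂ (position (mul (family-generated i) (element-generated (lookup reps j))))
    join-∼ : ∀ i j → join (i , j) ∼ lookup reps j
    join-∼ i j = H.resp (sym (trans (∙-congʳ (join-eq i j))
      (trans (assoc _ _ _) (trans (∙-congˡ (inverseʳ _)) (identityʳ _))))) (family⊆H i)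
    join-injective′ : ∀ {p p′} → join p ≡ join p′ → p ≡ p′
    join-injective′ {i , j} {i′ , j′} e with
      allPairs-lookup-injective ∼-sym id (deduplicate-! cosets (allFin m))
        (∼-trans (∼-sym (join-∼ i j)) (≡.subst (_∼ lookup reps j′) (≡.sym e) (join-∼ i′ j′)))
    ... | ≡.refl = ≡.cong (_, j) (family-injective (∙-cancelʳ (rep j) _ _
      (trans (sym (join-eq i j)) (trans (reflexive (≡.cong element e)) (join-eq i′ j)))))
    join-injective : ∀ {y y′} →
      join (Fin.remQuot (length reps) y) ≡ join (Fin.remQuot (length reps) y′) → y ≡ y′
    join-injective {y} {y′} e = ≡.trans (≡.sym (Fin.combine-remQuot {n = d} (length reps) y))
      (≡.trans (≡.cong (λ (i , j) → Fin.combine i j) (join-injective′ e))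
               (Fin.combine-remQuot {n = d} (length reps) y′))

module _ {k b ℓᵇ c ℓᶜ} (B : GeneratedGroup k b ℓᵇ) (C : GeneratedGroup k c ℓᶜ) where
  private
    module B = GeneratedGroup B
    module C = GeneratedGroup C
    module Bᴾ = Powers B.ambient
    module Cᴾ = Powers C.ambient
    module Bᴹ = Algebra.Properties.Monoid.Mult (Group.monoid B.ambient)
    module Cᴹ = Algebra.Properties.Monoid.Mult (Group.monoid C.ambient)
  open GeneratedGroup (B ⋄ C) using (generator; ⟨_⟩; unit; mul; inv; resp; HasSize; ambient)
  open Powers ambient using (IsSubgroup)
  open Bᴹ using () renaming (_×_ to _·ᴮ_)
  open Cᴹ using () renaming (_×_ to _·ᶜ_)

  mix-power : ∀ {x y} n → ⟨ generator ⟩ (x , y) → ⟨ generator ⟩ (n ·ᴮ x , n ·ᶜ y)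
  mix-power zero    p = unit
  mix-power (suc n) p = mul p (mix-power n p)

  -- Cancelling the first component of (ix, jy) by a power of (x, y) leaves (ε, (j - i)y). As j - i
  -- is a unit modulo `q`, this yields (ε, y), then (x, ε), hence a product of two cyclic groups of
  -- order `q`.
  prime-square∣size : ∀ {m} → HasSize m → ∀ {q} → Prime q → ∀ {x y} →
    q ·ᴮ x B.≈ B.ε → ¬ x B.≈ B.ε → q ·ᶜ y C.≈ C.ε → ¬ y C.≈ C.ε →
    ⟨ generator ⟩ (x , y) → ∀ i j → ⟨ generator ⟩ (i ·ᴮ x , j ·ᶜ y) → ¬ q ∣ i * ℕ.pred q + j → q * q ∣ m
  prime-square∣size {m} size {q} q-prime {x} {y} qx x≉ε qy y≉ε xy∈ i j ij∈ q∤ =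
    Lagrange.subgroup-size∣ (B ⋄ C) size {H = H} subgroup family
      (λ t → full (row t) (column t)) (λ t → (row t , B.refl) , (column t , C.refl)) covers injective
    where
    instance
      q≢0 : NonZero q
      q≢0 = prime⇒nonZero q-prime
    H : Pred (B.Carrier × C.Carrier) _
    H (g , h) = Bᴾ.IsPower x g × Cᴾ.IsPower y h
    subgroup : IsSubgroup H
    subgroup = record
      { unit = X.unit , Y.unit
      ; mul  = λ (p , q) (p′ , q′) → X.mul p p′ , Y.mul q q′
      ; inv  = λ (p , q) → X.inv p , Y.inv q
      ; resp = λ (e , e′) (p , q) → X.resp e p , Y.resp e′ q
      }
      where
      module X = Bᴾ.IsSubgroup (Bᴾ.powers-subgroup qx)
      module Y = Cᴾ.IsSubgroup (Cᴾ.powers-subgroup qy)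
    k₀ : ℕ
    k₀ = i * ℕ.pred q + j
    cancel-x : (i * ℕ.pred q) ·ᴮ x B.∙ i ·ᴮ x B.≈ B.ε
    cancel-x = B.trans (B.∙-congʳ (B.sym (Bᴾ.·-⁻¹ qx i))) (B.inverseˡ _)
    second : ⟨ generator ⟩ (B.ε , k₀ ·ᶜ y)
    second = resp (cancel-x , C.sym (Cᴹ.×-homo-+ y (i * ℕ.pred q) j)) (mul (mix-power (i * ℕ.pred q) xy∈) ij∈)
    y∈ : ⟨ generator ⟩ (B.ε , y)
    y∈ with Cᴾ.root qy q-prime k₀ q∤
    ... | n , e = resp (Bᴾ.·-ε n , e) (mix-power n second)
    x∈ : ⟨ generator ⟩ (x , C.ε)
    x∈ = resp
      (B.trans (B.∙-congˡ ε⁻¹≈ε) (B.identityʳ x) , C.inverseʳ y) (mul xy∈ (inv y∈))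
      where open Algebra.Properties.Group B.ambient using (ε⁻¹≈ε)
    full : ∀ a b → ⟨ generator ⟩ (a ·ᴮ x , b ·ᶜ y)
    full a b = resp
      (B.trans (B.∙-congˡ (Bᴾ.·-ε b)) (B.identityʳ _) , C.trans (C.∙-congʳ (Cᴾ.·-ε a)) (C.identityˡ _))
      (mul (mix-power a x∈) (mix-power b y∈))
    power : Fin q × Fin q → B.Carrier × C.Carrier
    power (a , b) = toℕ a ·ᴮ x , toℕ b ·ᶜ y
    family : Fin (q * q) → B.Carrier × C.Carrier
    family t = power (Fin.remQuot q t)
    row column : Fin (q * q) → ℕ
    row t    = toℕ (proj₁ (Fin.remQuot {q} q t))
    column t = toℕ (proj₂ (Fin.remQuot {q} q t))
    covers : ∀ {g} → H g → ∃ λ t → (proj₁ g B.≈ proj₁ (family t)) × (proj₂ g C.≈ proj₂ (family t))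
    covers {g , h} ((a , e) , (b , e′)) = Fin.combine a′ b′ ,
      ≡.subst (λ p → (g B.≈ proj₁ (power p)) × (h C.≈ proj₂ (power p))) (≡.sym (Fin.remQuot-combine a′ b′))
        ( B.trans e (B.trans (B.sym (Bᴾ.·-mod qx a)) (Bᴹ.×-congˡ {x} (≡.sym (toℕ-fromℕ< (m%n<n a q)))))
        , C.trans e′ (C.trans (C.sym (Cᴾ.·-mod qy b)) (Cᴹ.×-congˡ {y} (≡.sym (toℕ-fromℕ< (m%n<n b q))))))
      where
      a′ b′ : Fin q
      a′ = Fin.fromℕ< (m%n<n a q)
      b′ = Fin.fromℕ< (m%n<n b q)
    injective : ∀ {t t′} →
      (proj₁ (family t) B.≈ proj₁ (family t′)) × (proj₂ (family t) C.≈ proj₂ (family t′)) → t ≡ t′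
    injective {t} {t′} (e , e′) = ≡.trans (≡.sym (Fin.combine-remQuot {n = q} q t)) (≡.trans
      (≡.cong₂ Fin.combine
        (toℕ-injective (Bᴾ.·-injective qx q-prime x≉ε
          (toℕ<n (proj₁ (Fin.remQuot {q} q t))) (toℕ<n (proj₁ (Fin.remQuot {q} q t′))) e))
        (toℕ-injective (Cᴾ.·-injective qy q-prime y≉ε
          (toℕ<n (proj₂ (Fin.remQuot {q} q t))) (toℕ<n (proj₂ (Fin.remQuot {q} q t′))) e′)))
      (Fin.combine-remQuot {n = q} q t′))

-- The mix of a polytope with its dual

module FiniteAutomorphisms {c ℓ₁ ℓ₂} (P : Polytope 4 c ℓ₁ ℓ₂) (finite : Polytope.IsFinite P) where
  open Polytope P
  open Poset poset using (module Eq)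
  open FlagCalculus P finite
  open Rotations P finite using (Mix)
  open Automorphism

  private
    position : Carrier → Fin size
    position x = proj₁ (enumerate-surjective x)

    position-≈ : ∀ x → enumerate (position x) ≈ x
    position-≈ x = proj₂ (enumerate-surjective x) ≡.refl

    position-injective : ∀ {x y} → position x ≡ position y → x ≈ y
    position-injective e = Eq.trans (Eq.sym (position-≈ _))
      (Eq.trans (Eq.reflexive (≡.cong enumerate e)) (position-≈ _))

    SameOn : Automorphism poset → Automorphism poset → Set ℓ₁
    SameOn γ δ = ∀ i → to γ (enumerate i) ≈ to δ (enumerate i)

    sameOn⇒≈ : ∀ γ δ → SameOn γ δ → ∀ x → to γ x ≈ to δ x
    sameOn⇒≈ γ δ same x = Eq.trans (to-cong γ (Eq.sym (position-≈ x)))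
      (Eq.trans (same _) (to-cong δ (position-≈ x)))

  code : Automorphism poset → Fin (size ℕ.^ size)
  code γ = Fin.funToFin (λ i → position (to γ (enumerate i)))

  code-injective : ∀ γ δ → code γ ≡ code δ → ∀ x → to γ x ≈ to δ x
  code-injective γ δ e = sameOn⇒≈ γ δ λ i → position-injective
    (≡.trans (≡.sym (Fin.finToFun-funToFin (λ i → position (to γ (enumerate i))) i))
      (≡.trans (≡.cong (λ t → Fin.finToFun t i) e)
               (Fin.finToFun-funToFin (λ i → position (to δ (enumerate i))) i)))

  _≟ᵃ_ : ∀ γ δ → Dec (∀ x → to γ x ≈ to δ x)
  γ ≟ᵃ δ = Dec.map′ (sameOn⇒≈ γ δ) (λ e i → e _)
    (Fin.all? λ i → to γ (enumerate i) ≈? to δ (enumerate i))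

  module _ (σ : Fin 3 → Automorphism poset) where
    open RotationGraph (Mix σ)

    private
      K : ℕ
      K = size ℕ.^ size ℕ.* size ℕ.^ size

      pairCode : Automorphism poset × Automorphism poset → Fin K
      pairCode (γ , δ) = Fin.combine (code γ) (code δ)

      pairCode-injective : ∀ g h → pairCode g ≡ pairCode h →
        (∀ x → to (proj₁ g) x ≈ to (proj₁ h) x) × (∀ x → to (proj₂ g) x ≈ to (proj₂ h) x)
      pairCode-injective (γ , δ) (γ′ , δ′) e with Fin.combine-injective (code γ) (code δ) (code γ′) (code δ′) e
      ... | e₁ , e₂ = code-injective γ γ′ e₁ , code-injective δ δ′ e₂

      flagCode : RFlag → Fin (K ℕ.+ K)
      flagCode (even g) = pairCode g Fin.↑ˡ K
      flagCode (odd g)  = K Fin.↑ʳ pairCode g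

      ↑ˡ≢↑ʳ : ∀ i j → i Fin.↑ˡ K ≢ K Fin.↑ʳ j
      ↑ˡ≢↑ʳ i j e with ≡.trans (≡.sym (Fin.splitAt-↑ˡ K i K))
                               (≡.trans (≡.cong (Fin.splitAt K) e) (Fin.splitAt-↑ʳ K K j))
      ... | ()

      flagCode-injective : ∀ {e f} → flagCode e ≡ flagCode f → e ≈ᶠ f
      flagCode-injective {even g} {even h} e = even (pairCode-injective g h (Fin.↑ˡ-injective K _ _ e))
      flagCode-injective {odd g}  {odd h}  e = odd (pairCode-injective g h (Fin.↑ʳ-injective K _ _ e))
      flagCode-injective {even g} {odd h}  e = ⊥-elim (↑ˡ≢↑ʳ _ _ e)
      flagCode-injective {odd g}  {even h} e = ⊥-elim (↑ˡ≢↑ʳ _ _ (≡.sym e))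

      _≟ᶠ_ : ∀ e f → Dec (e ≈ᶠ f)
      even (γ , δ) ≟ᶠ even (γ′ , δ′) = Dec.map′ even (λ { (even e) → e }) ((γ ≟ᵃ γ′) ×-dec (δ ≟ᵃ δ′))
      odd (γ , δ)  ≟ᶠ odd (γ′ , δ′)  = Dec.map′ odd (λ { (odd e) → e }) ((γ ≟ᵃ γ′) ×-dec (δ ≟ᵃ δ′))
      even _       ≟ᶠ odd _          = no λ ()
      odd _        ≟ᶠ even _         = no λ ()

    -- The search runs over all pairs of automorphisms, generated or not; they are counted by their
    -- tables of values on the enumerated faces, once for each parity.
    mix-conn? : ∀ j e f → Dec (Conn (Except j) e f)
    mix-conn? j = FlagGraph.conn? graph flagCode flagCode-injective _≟ᶠ_ (λ i → ¬? (i Fin.≟ j))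

module MixWithDual {c ℓ₁ ℓ₂} (P : Polytope 4 c ℓ₁ ℓ₂) (finite : Polytope.IsFinite P) {Φ : Polytope.Flag P}
                   (S : Symmetry.ChiralOrDirectlyRegular P Φ) where
  open Polytope P
  open Poset poset using (module Eq)
  open Rank4 P
  open BaseFaces P using (face)
  open FlagCalculus P finite using (RotationAction; at-mono; ranked; differ; agree)
  open Rotations P finite
  open Automorphism
  open Group Γ using (_∙_; _⁻¹; ε) renaming (sym to ≈-sym; trans to ≈-trans; refl to ≈-refl)

  σ : Fin 3 → Automorphism poset
  σ = rotation S

  base : RotationBase Φ σ
  base = rotationBase S

  module R = GeneratedGroup (Rotation σ)
  module M = GeneratedGroup (Mix σ)
  module A₁ = RotationAction (mixAction₁ base)
  module A₂ = RotationAction (mixAction₂ base)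
  open RotationGraph (Mix σ)

  commuting : IsCommuting
  commuting lt (even g) = even (A₁.act-comm lt (even g) , A₂.act-comm lt (even g))
  commuting lt (odd g)  = odd (A₁.act-comm lt (odd g) , A₂.act-comm lt (odd g))

  fixes₁ : ∀ {h} {J : Pred (Fin 4) h} {z} → Conn J (even M.ε) (even z) → ∀ j → ¬ J j →
           to (proj₁ z) (face Φ (proper j)) ≈ face Φ (proper j)
  fixes₁ {J = J} c j ¬J = Eq.sym (A₁.conn-agree (proper j)
    (λ {i} p e → ¬J (≡.subst J (≡.sym (proper-injective e)) p)) c)

  -- The second component belongs to the dual, so it is rank `opposite j` of the graph that moves
  -- the `j`-face.
  fixes₂ : ∀ {h} {J : Pred (Fin 4) h} {z} → Conn J (even M.ε) (even z) → ∀ j → ¬ J (opposite j) →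
           to (proj₂ z) (face Φ (proper j)) ≈ face Φ (proper j)
  fixes₂ {J = J} c j ¬J = Eq.sym (A₂.conn-agree (proper j)
    (λ {i} p e → ¬J (≡.subst J (≡.trans (≡.sym (opposite-involutive i))
                                        (≡.cong opposite (≡.sym (proper-injective e)))) p)) c)

  components : ∀ {z} → M.⟨ M.generator ⟩ z → R.⟨ σ ⟩ (proj₁ z) × R.⟨ σ ⟩ (proj₂ z)
  components = Powers.generated⊆ M.ambient
    {H = λ z → R.⟨ σ ⟩ (proj₁ z) × R.⟨ σ ⟩ (proj₂ z)} (record
    { unit = R.unit , R.unit
    ; mul  = λ (p , q) (p′ , q′) → R.mul p p′ , R.mul q q′
    ; inv  = λ (p , q) → R.inv p , R.inv q
    ; resp = λ (e , e′) (p , q) → R.resp e p , R.resp e′ q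
    }) (λ i → R.gen i , R.inv (R.gen (opposite i)))

  stabilizer : ∀ {d} (D : Pred (Fin 4) d) w → R.⟨ σ ⟩ w →
    (∀ {j} → D j → to w (face Φ (proper j)) ≈ face Φ (proper j)) → R.Sub (λ i → ¬ D i) w
  stabilizer = stabilizer⊆Sub base (rotation-unreflected S)

  -- A generator `τ i j` needs two different ranks, so `Sub` of a single rank has no generators.
  fixes-all-but-one : ∀ k w → R.⟨ σ ⟩ w →
    (∀ {j} → j ≢ k → to w (face Φ (proper j)) ≈ face Φ (proper j)) → w R.≈ ε
  fixes-all-but-one k w w∈ fixes = Powers.generated⊆ Γ (record
    { unit = ≈-refl {ε}
    ; mul  = λ {y} {z} p q → R.∙-cong {y} {ε} {z} {ε} p q
    ; inv  = λ {y} p → R.⁻¹-cong {y} {ε} p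
    ; resp = λ {y} {z} e p → ≈-trans {z} {y} {ε} (≈-sym {y} {z} e) p
    }) (λ (i , j , i≤j , p , q) → ⊥-elim (impossible i j i≤j (stable p) (stable q)))
    (stabilizer (_≢ k) w w∈ fixes)
    where
    stable : ∀ {i} → ¬ (i ≢ k) → i ≡ k
    stable = decidable-stable (_ Fin.≟ _)
    impossible : ∀ i j → i Fin.≤ j → inject₁ i ≡ k → suc j ≡ k → ⊥
    impossible i j i≤j e e′ = ℕ.<-irrefl ≡.refl (≡.subst (ℕ._≤ toℕ j)
      (≡.trans (≡.sym (toℕ-inject₁ i)) (≡.cong toℕ (≡.trans e (≡.sym e′)))) i≤j)

  -- Only `k` lies in both ranges, so each component of an element of the intersection fixes all
  -- base faces but one and is trivial.
  separates-at : ∀ k {e f} → Conn (λ m → toℕ k ℕ.≤ toℕ m) e f →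
                 Conn (λ m → toℕ m ℕ.< suc (toℕ k)) e f → Conn (_≡ k) e f
  separates-at k = conn-∩ k ≡.refl (λ { ≡.refl → ℕ.≤-refl }) (λ { ≡.refl → ℕ.≤-refl }) trivial
    where
    outside : ∀ j → j ≢ k → ¬ toℕ k ℕ.≤ toℕ j ⊎ ¬ toℕ j ℕ.< suc (toℕ k)
    outside j j≢k with ℕ.<-cmp (toℕ j) (toℕ k)
    ... | tri< j<k _ _ = inj₁ (ℕ.<⇒≱ j<k)
    ... | tri≈ _ e _   = ⊥-elim (j≢k (toℕ-injective e))
    ... | tri> _ _ k<j = inj₂ (λ j<1+k → ℕ.<⇒≱ k<j (ℕ.≤-pred j<1+k))
    trivial : ∀ z → Conn (λ m → toℕ k ℕ.≤ toℕ m) (even M.ε) (even z) →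
              Conn (λ m → toℕ m ℕ.< suc (toℕ k)) (even M.ε) (even z) → Conn (_≡ k) (even M.ε) (even z)
    trivial z c d with components (conn-generated c M.unit)
    ... | z₁∈ , z₂∈ = done (even
        ( ≈-sym {proj₁ z} {ε} (fixes-all-but-one k (proj₁ z) z₁∈ fixed₁)
        , ≈-sym {proj₂ z} {ε} (fixes-all-but-one (opposite k) (proj₂ z) z₂∈ fixed₂)))
      where
      fixed₁ : ∀ {j} → j ≢ k → to (proj₁ z) (face Φ (proper j)) ≈ face Φ (proper j)
      fixed₁ {j} j≢k with outside j j≢k
      ... | inj₁ below = fixes₁ c j below
      ... | inj₂ above = fixes₁ d j above
      fixed₂ : ∀ {j} → j ≢ opposite k → to (proj₂ z) (face Φ (proper j)) ≈ face Φ (proper j)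
      fixed₂ {j} j≢ with outside (opposite j)
        (λ e → j≢ (≡.trans (≡.sym (opposite-involutive j)) (≡.cong opposite e)))
      ... | inj₁ below = fixes₂ c j below
      ... | inj₂ above = fixes₂ d j above

  facewiseFree : IsFacewiseFree
  facewiseFree = A₁.facewise-free

  -- The two ranges have no common rank for `conn-∩`. Enlarging the first by `k` leaves `e ≈ f` or
  -- `r k e ≈ f`, and freeness excludes the latter because `c` avoids `k`.
  separates-above : ∀ k {e f} → Conn (λ m → suc (toℕ k) ℕ.≤ toℕ m) e f →
                    Conn (λ m → toℕ m ℕ.< suc (toℕ k)) e f → e ≈ᶠ f
  separates-above k {e} {f} c d
    with FlagGraph.conn-singleton graph k (separates-at k (FlagGraph.weaken graph ℕ.<⇒≤ c) d)
  ... | inj₁ e≈f  = e≈f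
  ... | inj₂ re≈f = ⊥-elim (facewiseFree k e (FlagGraph.conn-trans graph
          (FlagGraph.weaken graph (λ { k<m ≡.refl → ℕ.<-irrefl ≡.refl k<m }) c)
          (done (FlagGraph.sym graph re≈f))))

  module Γᴾ = Powers Γ
  open Algebra.Properties.Monoid.Mult (Group.monoid Γ) using () renaming (_×_ to _·_)

  private
    F₂ : Carrier
    F₂ = face Φ 3F

    -- σ₂ takes Φ¹, which contains F₂, to Φ², which does not. As F₂ lies in the facet and in the
    -- vertex-figure, σ₂ restricts nontrivially to both.
    σ₂-moves-F₂ : ¬ to (σ 1F) F₂ ≈ F₂
    σ₂-moves-F₂ e = differ (reflected-neighbours 2F)
      (Eq.trans (Eq.sym e) (Eq.trans (to-cong (σ 1F) (agree (reflected-neighbours 1F) 3F (λ ()))) (rotates 1F 3F)))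
      where open RotationBase base

    _≤ᶠ_ : ∀ i j → {i Fin.< j} → face Φ i ≤ face Φ j
    _≤ᶠ_ i j {i<j} = proj₁ (at-mono (ranked Φ) i<j)

  -- Restriction of automorphisms to a section

  module _ {F G : Carrier} where
    private
      Section : Group _ _
      Section = automorphismGroup (section poset F G)
      module Sec = Group Section
      open Algebra.Properties.Monoid.Mult Sec.monoid using () renaming (_×_ to _·ˢ_)

    Restricts : Automorphism (section poset F G) → Automorphism poset → Set _
    Restricts u γ = ∀ v → proj₁ (to u v) ≈ to γ (proj₁ v)

    restricts-∙ : ∀ {u v γ δ} → Restricts u γ → Restricts v δ → Restricts (u Sec.∙ v) (γ ∙ δ)
    restricts-∙ {δ = δ} p q w = Eq.trans (q _) (to-cong δ (p w))

    restricts-⁻¹ : ∀ {u γ} → Restricts u γ → Restricts (u Sec.⁻¹) (γ ⁻¹)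
    restricts-⁻¹ {u} {γ} p w = Eq.trans (Eq.sym (from-to γ _)) (from-cong γ (Eq.trans (Eq.sym (p _)) (to-from u w)))

    restricts-· : ∀ {u γ} n → Restricts u γ → Restricts (n ·ˢ u) (n · γ)
    restricts-· zero p w = Eq.refl
    restricts-· {u} {γ} (suc n) p = restricts-∙ {u} {n ·ˢ u} {γ} {n · γ} p (restricts-· {u} {γ} n p)

    restricts-≈ : ∀ {u v γ δ} → Restricts u γ → Restricts v δ → γ R.≈ δ → u Sec.≈ v
    restricts-≈ p q e w = Eq.trans (p w) (Eq.trans (e _) (Eq.sym (q w)))

  -- The intersection of ⟨β₁, β₂⟩ and ⟨β₂, β₃⟩

  module _ {q} (q-prime : Prime q) (σ₂-order : q · σ 1F R.≈ ε) {m}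
           (size : GeneratedGroup.HasSize (Γ⁺-facet S ⋄ (Γ⁺-vertexFigure S ᵟ)) m) (q²∤m : ¬ q ^ 2 ∣ m) where

    private
      instance
        q≢0 : NonZero q
        q≢0 = prime⇒nonZero q-prime

      module K = GeneratedGroup (Γ⁺-facet S)
      module L = GeneratedGroup (Γ⁺-vertexFigure S ᵟ)
      module N = GeneratedGroup (Γ⁺-facet S ⋄ (Γ⁺-vertexFigure S ᵟ))
      open Algebra.Properties.Monoid.Mult (Group.monoid K.ambient) using () renaming (_×_ to _·ᴷ_)
      open Algebra.Properties.Monoid.Mult (Group.monoid L.ambient) using () renaming (_×_ to _·ᴸ_)

      x : K.Carrier
      x = K.generator 1F

      -- This is the restriction of σ₂⁻¹: dualizing reverses the order of the generators σ₂, σ₃ and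
      -- inverts them.
      y : L.Carrier
      y = L.generator 1F

      s u : Automorphism poset
      s = σ 1F
      u = σ 1F ⁻¹

      u-order : q · u R.≈ ε
      u-order = Γᴾ.⁻¹-order {q} {s} σ₂-order

      x-order : q ·ᴷ x K.≈ K.ε
      x-order = restricts-≈ {u = q ·ᴷ x} {K.ε} {q · s} {ε}
        (restricts-· {u = x} {s} q (λ _ → Eq.refl)) (λ _ → Eq.refl) σ₂-order

      y-order : q ·ᴸ y L.≈ L.ε
      y-order = restricts-≈ {u = q ·ᴸ y} {L.ε} {q · u} {ε}
        (restricts-· {u = y} {u} q (λ _ → Eq.refl)) (λ _ → Eq.refl) u-order

      x≉ε : ¬ x K.≈ K.ε
      x≉ε e = σ₂-moves-F₂ (e (F₂ , (0F ≤ᶠ 3F) {ℕ.s≤s ℕ.z≤n} , (3F ≤ᶠ 4F) {ℕ.≤-refl}))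

      y≉ε : ¬ y L.≈ L.ε
      y≉ε e = σ₂-moves-F₂ (Eq.trans
        (to-cong s (Eq.sym (e (F₂ , (1F ≤ᶠ 3F) {ℕ.s≤s (ℕ.s≤s ℕ.z≤n)} , (3F ≤ᶠ 5F) {ℕ.n≤1+n 4}))))
        (to-from s F₂))

      Restriction : M.Carrier → Set _
      Restriction z = ∃ λ ((v , w) : N.Carrier) →
        N.⟨ N.generator ⟩ (v , w) × Restricts v (proj₁ z) × Restricts w (proj₂ z)

      Outer : Pred (Fin 4) 0ℓ
      Outer j = j ≡ 0F ⊎ j ≡ 3F

      -- The components of β₁ = (σ₁, σ₃⁻¹) and β₂ = (σ₂, σ₂⁻¹) preserve the facet and the
      -- vertex-figure respectively, and their restrictions are the generators of Γ⁺(K) ⋄ Γ⁺(L^δ).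
      restriction : ∀ {z} → M.Sub (λ m → toℕ m ℕ.< 3) z → Restriction z
      restriction = Powers.generated⊆ M.ambient {H = Restriction} (record
        { unit = N.ε , N.unit , (λ _ → Eq.refl) , (λ _ → Eq.refl)
        ; mul  = λ {z} {z′} ((v , w) , p , r , t) ((v′ , w′) , p′ , r′ , t′) →
                   (v K.∙ v′ , w L.∙ w′) , N.mul p p′
                 , restricts-∙ {u = v} {v′} {proj₁ z} {proj₁ z′} r r′
                 , restricts-∙ {u = w} {w′} {proj₂ z} {proj₂ z′} t t′
        ; inv  = λ {z} ((v , w) , p , r , t) → (v K.⁻¹ , w L.⁻¹) , N.inv p
                 , restricts-⁻¹ {u = v} {proj₁ z} r , restricts-⁻¹ {u = w} {proj₂ z} t
        ; resp = λ (e , e′) (vw , p , r , t) →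
                   vw , p , (λ a → Eq.trans (r a) (e _)) , (λ a → Eq.trans (t a) (e′ _))
        }) (λ (i , j , i≤j , _ , j<2) → at-generator i j i≤j j<2)
        where
        at-generator : ∀ i j → i Fin.≤ j → toℕ (suc j) ℕ.< 3 → Restriction (M.τ i j)
        at-generator 0F 0F _ _ = N.generator 0F , N.gen 0F , (λ _ → Eq.refl) , (λ _ → Eq.refl)
        at-generator 0F 1F _ _ = (N.generator 0F N.∙ N.generator 1F) , N.mul (N.gen 0F) (N.gen 1F)
          , (λ _ → Eq.refl) , (λ _ → Eq.refl)
        at-generator 1F 1F _ _ = N.generator 1F , N.gen 1F , (λ _ → Eq.refl) , (λ _ → Eq.refl)
        at-generator 1F 0F () _
        at-generator 2F 0F () _
        at-generator 2F 1F (ℕ.s≤s ()) _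
        at-generator _ 2F _ (ℕ.s≤s (ℕ.s≤s (ℕ.s≤s ())))

      -- Ranks 1 and 2 remain outside `Outer`, so the only generator is `τ 1F 1F`, which is σ₂.
      middle : ∀ {h} {H : Pred (Automorphism poset) h} → Γᴾ.IsSubgroup H → H s →
               ∀ {w} → R.Sub (λ i → ¬ Outer i) w → H w
      middle {H = H} sub Hs = Γᴾ.generated⊆ sub (λ (i , j , i≤j , p , q) → at-generator i j i≤j p q)
        where
        at-generator : ∀ i j → i Fin.≤ j → ¬ Outer (inject₁ i) → ¬ Outer (suc j) → H (R.τ i j)
        at-generator 0F j  _ p q = ⊥-elim (p (inj₁ ≡.refl))
        at-generator _  2F _ p q = ⊥-elim (q (inj₂ ≡.refl))
        at-generator 1F 1F _ p q = Γᴾ.IsSubgroup.resp sub (λ _ → Eq.refl) Hs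
        at-generator 1F 0F () p q
        at-generator 2F 0F () p q
        at-generator 2F 1F (ℕ.s≤s ()) p q

      Middle : Pred (Fin 4) 0ℓ
      Middle m = 1 ℕ.≤ toℕ m × toℕ m ℕ.< 3

      middle-power : ∀ n → M.Sub Middle (n · s , n · u)
      middle-power zero    = M.unit
      middle-power (suc n) = M.mul {x = s , u} {y = n · s , n · u}
        (M.resp {x = M.τ 1F 1F} {y = s , u} ((λ _ → Eq.refl) , (λ _ → Eq.refl))
          (M.gen (1F , 1F , ℕ.≤-refl , (ℕ.≤-refl , ℕ.s≤s (ℕ.s≤s ℕ.z≤n)) , (ℕ.s≤s ℕ.z≤n , ℕ.≤-refl))))
        (middle-power n)

      -- Otherwise ⟨β₁, β₂⟩ would contain ⟨σ₂⟩ × ⟨σ₂⟩, which restriction to the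
      -- sections maps injectively into Γ⁺(K) ⋄ Γ⁺(L^δ).
      exponents-agree : ∀ z → M.Sub (λ m → toℕ m ℕ.< 3) z → ∀ i j →
                        proj₁ z R.≈ i · s → proj₂ z R.≈ j · u → q ∣ i * ℕ.pred q + j
      exponents-agree z z∈ i j e₁ e₂ = decidable-stable (q ∣? _) λ q∤ → q²∤m
        (≡.subst (_∣ m) (≡.cong (q *_) (≡.sym (ℕ.*-identityʳ q)))
          (prime-square∣size (Γ⁺-facet S) (Γ⁺-vertexFigure S ᵟ) size q-prime {x} {y}
            x-order x≉ε y-order y≉ε (N.gen 1F) i j ij∈ q∤))
        where
        ij∈ : N.⟨ N.generator ⟩ (i ·ᴷ x , j ·ᴸ y)
        ij∈ with restriction z∈
        ... | (v , w) , p , r , t = N.resp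
          ( restricts-≈ {u = v} {i ·ᴷ x} {proj₁ z} {i · s} r (restricts-· {u = x} {s} i (λ _ → Eq.refl)) e₁
          , restricts-≈ {u = w} {j ·ᴸ y} {proj₂ z} {j · u} t (restricts-· {u = y} {u} j (λ _ → Eq.refl)) e₂) p

      separates-middle : ∀ z → Conn (λ m → 1 ℕ.≤ toℕ m) (even M.ε) (even z) →
                         Conn (λ m → toℕ m ℕ.< 3) (even M.ε) (even z) → Conn Middle (even M.ε) (even z)
      separates-middle z c d = sub⇒conn (M.resp (e₁′ , e₂′) (middle-power i))
        where
        z∈ : R.⟨ σ ⟩ (proj₁ z) × R.⟨ σ ⟩ (proj₂ z)
        z∈ = components (conn-generated c M.unit)
        power₁ : Γᴾ.IsPower s (proj₁ z)
        power₁ = middle (Γᴾ.powers-subgroup {q} {s} σ₂-order) (1 , λ _ → Eq.refl)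
          (stabilizer Outer (proj₁ z) (proj₁ z∈) λ where
            (inj₁ ≡.refl) → fixes₁ c 0F (λ ())
            (inj₂ ≡.refl) → fixes₁ d 3F (ℕ.<-irrefl ≡.refl))
        power₂ : Γᴾ.IsPower u (proj₂ z)
        -- Duality exchanges vertex and facet, so the paths `c` and `d` change roles.
        power₂ = middle powers (Γᴾ.IsSubgroup.inv powers {u} (1 , λ _ → Eq.refl))
          (stabilizer Outer (proj₂ z) (proj₂ z∈) λ where
            (inj₁ ≡.refl) → fixes₂ d 0F (ℕ.<-irrefl ≡.refl)
            (inj₂ ≡.refl) → fixes₂ c 3F (λ ()))
          where
          powers : Γᴾ.IsSubgroup (Γᴾ.IsPower u)
          powers = Γᴾ.powers-subgroup {q} {u} u-order
        i j : ℕ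
        i = proj₁ power₁
        j = proj₁ power₂
        z∈Sub : M.Sub (λ m → toℕ m ℕ.< 3) z
        z∈Sub = M.resp ((λ _ → Eq.refl) , (λ _ → Eq.refl)) (conn⇒sub d)
        -- With exponents equal modulo `q`, `z` is the power of β₂ with exponent `i`.
        j≈i : j · u R.≈ i · u
        j≈i = Γᴾ.∣⇒·≈· {q} {u} u-order i j (exponents-agree z z∈Sub i j (proj₂ power₁) (proj₂ power₂))
        e₁′ : i · s R.≈ proj₁ (z M.∙ M.ε M.⁻¹)
        e₁′ a = Eq.sym (proj₂ power₁ a)
        e₂′ : i · u R.≈ proj₂ (z M.∙ M.ε M.⁻¹)
        e₂′ a = Eq.sym (Eq.trans (proj₂ power₂ a) (j≈i a))

    -- For a = 0 the path `d` already has the right ranks. Otherwise the interval is empty, a single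
    -- rank or {1, 2}, and only the last case uses the condition on q².
    separating : IsSeparating
    separating 0 b _ c d = FlagGraph.weaken graph (ℕ.z≤n ,_) d
    separating 1 1F _ c d = done (separates-above 0F c d)
    separating 2 2F _ c d = done (separates-above 1F c d)
    separating 3 3F _ c d = done (separates-above 2F c d)
    separating 1 2F _ c d = FlagGraph.weaken graph (λ { ≡.refl → ℕ.≤-refl , ℕ.≤-refl }) (separates-at 1F c d)
    separating 2 3F _ c d = FlagGraph.weaken graph (λ { ≡.refl → ℕ.≤-refl , ℕ.≤-refl }) (separates-at 2F c d)
    separating 1 3F _ c d = conn-∩ 1F (ℕ.≤-refl , ℕ.s≤s (ℕ.s≤s ℕ.z≤n)) proj₁ proj₂ separates-middle c d
    separating (suc _) 0F ()
    separating (suc (suc _)) 1F (ℕ.s≤s ())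
    separating (suc (suc (suc _))) 2F (ℕ.s≤s (ℕ.s≤s ()))
    separating (suc (suc (suc (suc _)))) 3F (ℕ.s≤s (ℕ.s≤s (ℕ.s≤s ())))

    mix-polytopal : Polytopal (Mix σ)
    mix-polytopal = CosetPolytope.polytopal (Mix σ) commuting facewiseFree separating
      (FiniteAutomorphisms.mix-conn? P finite σ)

proposition4p3 : ∀ {c ℓ₁ ℓ₂} (P : Polytope 4 c ℓ₁ ℓ₂) → Polytope.IsFinite P →
    let open Rank4 P in
    (Φ : Polytope.Flag P) (S : ChiralOrDirectlyRegular Φ) →
    (p q r : ℕ) → HasType S (p ∷ q ∷ r ∷ []) →
    Prime q →
    (m : ℕ) → GeneratedGroup.HasSize (Γ⁺-facet S ⋄ (Γ⁺-vertexFigure S ᵟ)) m →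
    ¬ (q ^ 2 ∣ m) →
    Polytopal (Γ⁺ S ⋄ (Γ⁺ S ᵟ))
proposition4p3 P finite Φ S p q r type q-prime m size q²∤m =
  MixWithDual.mix-polytopal P finite S q-prime (proj₁ (proj₂ (type 1F))) size q²∤m
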